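{- There exists $g>0$ such that for every cubic graph $G$ with girth at least $g$ there is a probability distribution on the independent sets of $G$ such that, for every vertex $v$ of $G$, an independent set drawn according to this distribution contains $v$ with probability at least $0.4352$.
   Context: Graphs are finite and simple. A graph is cubic if every vertex has degree three. The girth of a graph is the length of its shortest cycle. An independent set is a set of pairwise non-adjacent vertices. -}

module Defs where

open import Data.Fin.Base using (Fin; zero; suc; inject₁; fromℕ)
open import Data.Fin.Subset using (Subset; inside; outside; _∈_; ∣_∣)
open import Data.Fin.Subset.Properties using (_∈?_)
open import Data.List.Base using (List; []; _∷_; _++_; map; filter; foldr)
open import Data.Nat.Base using (ℕ; zero; suc; _≤_)
open import Data.Product.Base using (_×_)
open import Data.Rational.Base using (ℚ; 0ℚ; 1ℚ) renaming (_+_ to _+ℚ_; _≤_ to _≤ℚ_)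
open import Data.Vec.Base as Vec using (tabulate)
open import Function.Base using (_∘_)
open import Function.Definitions using (Injective)
open import Level using (0ℓ)
open import Relation.Binary.Core using (Rel)
open import Relation.Binary.Definitions using (Decidable; Irreflexive; Symmetric)
open import Relation.Binary.PropositionalEquality.Core using (_≡_)
open import Relation.Nullary.Decidable.Core using (does)
open import Relation.Nullary.Negation.Core using (¬_)
open import Relation.Unary using (Pred)

record Graph (n : ℕ) : Set₁ where
  infix 4 _~_ _~?_
  field
    _~_      : Rel (Fin n) 0ℓ
    _~?_     : Decidable _~_
    ~-sym    : Symmetric _~_
    ~-irrefl : Irreflexive _≡_ _~_

  neighbours : Fin n → Subset n
  neighbours v = tabulate λ w → does (v ~? w)

  degree : Fin n → ℕ
  degree v = ∣ neighbours v ∣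

Cubic : ∀ {n} → Graph n → Set
Cubic G = ∀ v → Graph.degree G v ≡ 3

-- A closed walk of length k ≥ 3 whose first k vertices are distinct.
record Cycle {n : ℕ} (G : Graph n) (k : ℕ) : Set where
  open Graph G
  field
    length≥3 : 3 ≤ k
    walk     : Fin (suc k) → Fin n
    step     : ∀ (i : Fin k) → walk (inject₁ i) ~ walk (suc i)
    closed   : walk (fromℕ k) ≡ walk zero
    distinct : Injective _≡_ _≡_ (walk ∘ inject₁)

IsGirth : ∀ {n} → Graph n → ℕ → Set
IsGirth G k = Cycle G k × (∀ l → Cycle G l → k ≤ l)

-- An acyclic graph has no (i.e. infinite) girth and satisfies this for every g.
GirthAtLeast : ∀ {n} → Graph n → ℕ → Set
GirthAtLeast G g = ∀ k → IsGirth G k → g ≤ k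

Independent : ∀ {n} → Graph n → Pred (Subset n) 0ℓ
Independent G S = ∀ u v → u ∈ S → v ∈ S → ¬ (u ~ v)
  where open Graph G

-- Every subset of Fin n, listed exactly once.
subsets : ∀ n → List (Subset n)
subsets zero    = Vec.[] ∷ []
subsets (suc n) = map (outside Vec.∷_) (subsets n) ++ map (inside Vec.∷_) (subsets n)

sumℚ : List ℚ → ℚ
sumℚ = foldr _+ℚ_ 0ℚ

-- A probability distribution on the subsets of Fin n satisfying P, given by its
-- mass function, extended by zero to all subsets. Masses are rational.
record Distribution {n : ℕ} (P : Pred (Subset n) 0ℓ) : Set where
  field
    mass      : Subset n → ℚ
    mass≥0    : ∀ S → 0ℚ ≤ℚ mass S
    supported : ∀ S → ¬ P S → mass S ≡ 0ℚ
    total     : sumℚ (map mass (subsets n)) ≡ 1ℚ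

  probContains : Fin n → ℚ
  probContains v = sumℚ (map mass (filter (v ∈?_) (subsets n)))

{-# OPTIONS --safe #-}

-- A local random process selects the set. In each round every vertex tosses a coin. A vertex
-- with at most one undecided neighbour joins and excludes that neighbour. A vertex with two
-- undecided neighbours whose coin shows fold defers its decision: the two neighbours become
-- one cluster that is accepted or rejected as a whole, and the vertex joins iff the cluster
-- is rejected. A vertex with three undecided neighbours whose coin shows cut is excluded.
-- Conflicting simultaneous actions exclude the vertices concerned, so that two neighbours
-- never both join.
--
-- For girth larger than twice the radius that the process explores, the three limbs at a
-- vertex are independent random binary trees. Conditionally on what the root has seen, its
-- live limbs stay independent and identically distributed, so the laws of the states of limbs
-- and root obey a recursion in the round number. This recursion is evaluated in fixed-point
-- arithmetic, always rounding down, and 500 rounds give probability above 0.4352.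

module Submission where

open import Defs
open import Data.Bool.Base using (Bool; true; false; _∨_; if_then_else_)
open import Data.Empty using (⊥; ⊥-elim)
open import Data.Fin.Base as Fin using (Fin; zero; suc; toℕ)
import Data.Fin.Properties as Fin
open import Data.Fin.Subset using (Subset; inside; outside; _∈_; ∣_∣)
open import Data.Fin.Subset.Properties using (_∈?_)
import Data.Integer.Base as ℤ
import Data.Integer.Properties as ℤ
open import Data.List.Base using (List; []; _∷_; _++_; map; length; drop; filter)
open import Data.List.Properties using (length-++)
open import Data.List.Relation.Binary.Permutation.Propositional as Perm using (_↭_; prep; swap; ↭-refl; ↭-sym; ↭-trans)
open import Data.List.Relation.Binary.Permutation.Propositional.Properties as Perm using (++-comm; drop-∷; ↭-singleton-inv; ∈-resp-↭; ↭-length; ++⁺ˡ)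
open import Data.List.Relation.Binary.Pointwise as PW using (Pointwise; []; _∷_)
open import Data.List.Relation.Unary.All as All using (All; []; _∷_)
open import Data.List.Relation.Unary.All.Properties using (++⁺)
open import Data.List.Relation.Unary.Any using (here; there)
open import Data.Nat.Base as ℕ using (ℕ; zero; suc; NonZero; _∸_; s≤s; z≤n; _<_)
open import Data.Nat.Coprimality as Coprime using (1-coprimeTo)
open import Data.Nat.DivMod using (m/n*n≤m; /-monoʳ-≤)
open import Data.Nat.Induction using (<-rec)
import Data.Nat.Properties as ℕ
open import Data.Product.Base using (Σ; ∃; _×_; _,_; proj₁; proj₂)
open import Data.Rational.Base using (ℚ; mkℚ; 0ℚ; 1ℚ; nonNegative; 1/_; *≤*; _/_) renaming (_≤_ to _≤ℚ_)
import Data.Rational.Base as ℚ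
open import Data.Rational.Solver using (module +-*-Solver)
open import Data.Rational.Unnormalised.Base using (mkℚᵘ; *≡*)
import Data.Rational.Unnormalised.Properties as ℚᵘ
open import Data.Sum.Base using (_⊎_; inj₁; inj₂)
open import Data.Unit.Base using (⊤; tt)
open import Data.Vec.Base as Vec using (_∷_; []; here; there; tabulate)
open import Data.Vec.Properties using (lookup∘tabulate; []=⇒lookup; lookup⇒[]=)
open import Function.Base using (_∘_)
open import Relation.Binary.Definitions using (tri<; tri≈; tri>)
open import Relation.Binary.PropositionalEquality
open import Relation.Nullary using (¬_; Dec; yes; no; does)
open import Relation.Nullary.Decidable using (_×-dec_; dec-true)
open import Relation.Unary using (Pred)

-- Folding is the classical reduction at a vertex of degree two: some maximum independent set
-- contains the vertex or both its neighbours, so the choice can be deferred. The process is run on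
-- the universal cover. Each edge carries one message per direction and round (`letter`), computed
-- from the limb behind it on the assumption that the receiver has not acted. Independence holds for
-- every labelling: the views of two neighbours stay coupled until one acts and are incompatible
-- afterwards. The obstacle is conditioning: the law of a limb that is still live would have to be
-- divided by its survival probability. Instead the limb measure `μ` stays unnormalised, and the
-- coefficients of a `Law` are densities against its powers. The recursion then uses only sums and
-- products of nonnegative numbers, through which rounding down is sound. Conditional independence
-- is stated by duality (`Claim`): a law bounds the expectation of every nonnegative function of the
-- state by its values at each number of limbs, a form that can be nested under further
-- expectations.

-- Non-backtracking walks

pick : ∀ {n} (S : Subset n) → Fin ∣ S ∣ → Fin n
pick (inside  ∷ S) zero    = zero
pick (inside  ∷ S) (suc i) = suc (pick S i)
pick (outside ∷ S) i       = suc (pick S i)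

pick-∈ : ∀ {n} (S : Subset n) i → pick S i ∈ S
pick-∈ (inside  ∷ S) zero    = here
pick-∈ (inside  ∷ S) (suc i) = there (pick-∈ S i)
pick-∈ (outside ∷ S) i       = there (pick-∈ S i)

pick-injective : ∀ {n} (S : Subset n) {i j} → pick S i ≡ pick S j → i ≡ j
pick-injective (inside  ∷ S) {zero}  {zero}  e = refl
pick-injective (inside  ∷ S) {suc i} {suc j} e = cong suc (pick-injective S (Fin.suc-injective e))
pick-injective (outside ∷ S) e = pick-injective S (Fin.suc-injective e)

pick-surjective : ∀ {n} (S : Subset n) {x} → x ∈ S → ∃ λ i → pick S i ≡ x
pick-surjective (inside  ∷ S) here      = zero , refl
pick-surjective (inside  ∷ S) (there m) with i , e ← pick-surjective S m = suc i , cong suc e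
pick-surjective (outside ∷ S) (there m) with i , e ← pick-surjective S m = i , cong suc e

other : Fin 3 → Bool → Fin 3
other zero             false = suc zero
other zero             true  = suc (suc zero)
other (suc zero)       false = zero
other (suc zero)       true  = suc (suc zero)
other (suc (suc zero)) false = zero
other (suc (suc zero)) true  = suc zero

other-≢ : ∀ i b → other i b ≢ i
other-≢ zero             false ()
other-≢ zero             true  ()
other-≢ (suc zero)       false ()
other-≢ (suc zero)       true  ()
other-≢ (suc (suc zero)) false ()
other-≢ (suc (suc zero)) true  ()

others-≢ : ∀ i → other i false ≢ other i true
others-≢ zero             ()
others-≢ (suc zero)       ()
others-≢ (suc (suc zero)) ()

module Arcs {n} (G : Graph n) (cubic : Cubic G) where

  open Graph G
  open import Data.Nat.Base using (_+_; _≤_)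

  nbr : Fin n → Fin 3 → Fin n
  nbr v i = pick (neighbours v) (subst Fin (sym (cubic v)) i)

  nbr-~ : ∀ v i → v ~ nbr v i
  nbr-~ v i with v ~? w in eq
    where w = nbr v i
  ... | yes a = a
  ... | no  _ with () ← trans (sym ([]=⇒lookup (pick-∈ (neighbours v) (subst Fin (sym (cubic v)) i)))) (trans (lookup∘tabulate _ (nbr v i)) (cong does eq))

  nbr-injective : ∀ v {i j} → nbr v i ≡ nbr v j → i ≡ j
  nbr-injective v e = cancel (pick-injective (neighbours v) e)
    where
    cancel : ∀ {k l} {e : k ≡ l} {i j : Fin k} → subst Fin e i ≡ subst Fin e j → i ≡ j
    cancel {e = refl} p = p

  nbr-surjective : ∀ {v w} → v ~ w → ∃ λ i → nbr v i ≡ w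
  nbr-surjective {v} {w} a with i , e ← pick-surjective (neighbours v) (lookup⇒[]= w (neighbours v) (trans (lookup∘tabulate _ w) (dec-true (v ~? w) a))) =
    subst Fin (cubic v) i , trans (cong (pick (neighbours v)) (subst-sym-subst (cubic v))) e

  -- The arc (u , i) leads from nbr u i to u.
  Arc : Set
  Arc = Fin n × Fin 3

  head tail : Arc → Fin n
  head (u , i) = u
  tail (u , i) = nbr u i

  back : ∀ u j → ∃ λ i → nbr (nbr u j) i ≡ u
  back u j = nbr-surjective (~-sym (nbr-~ u j))

  into : Fin n → Fin 3 → Arc
  into u j = nbr u j , proj₁ (back u j)

  tail-into : ∀ u j → tail (into u j) ≡ u
  tail-into u j = proj₂ (back u j)

  arc-≡ : ∀ {a b : Arc} → head a ≡ head b → tail a ≡ tail b → a ≡ b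
  arc-≡ {u , i} {.u , j} refl e = cong (u ,_) (nbr-injective u e)

  rev : Arc → Arc
  rev (u , i) = into u i

  rev-into : ∀ u j → rev (into u j) ≡ (u , j)
  rev-into u j = arc-≡ (tail-into u j) (tail-into (nbr u j) (proj₁ (back u j)))

  down : Bool → Arc → Arc
  down b (u , i) = into u (other i b)

  finish : Arc → List Bool → Fin n
  finish a []      = head a
  finish a (b ∷ p) = finish (down b a) p

  -- Phrased by end vertices instead of by `rev`, so that it turns directly into the inequality of
  -- vertices two apart on a walk.
  data Succ (a b : Arc) : Set where
    succ : head a ≡ tail b → tail a ≢ head b → Succ a b

  rev-succ : ∀ {a b} → Succ a b → Succ (rev b) (rev a)
  rev-succ {u , i} {v , j} (succ e n) = succ (trans (sym e) (sym (tail-into u i))) (λ e′ → n (trans (sym e′) (tail-into v j)))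

  down-succ : ∀ b a → Succ a (down b a)
  down-succ b (u , i) = succ (sym (tail-into u (other i b))) (λ e → other-≢ i b (sym (nbr-injective u e)))

  data Path : Arc → Arc → ℕ → Set where
    stop : ∀ {a} → Path a a 0
    step : ∀ {a b c k} → Succ a b → Path b c k → Path a c (suc k)

  _◅◅_ : ∀ {a b c k l} → Path a b k → Path b c l → Path a c (k + l)
  stop     ◅◅ q = q
  step s p ◅◅ q = step s (p ◅◅ q)

  reverse : ∀ {a b k} → Path a b k → Path (rev b) (rev a) k
  reverse stop = stop
  reverse {k = suc k} (step s p) = subst (Path _ _) (ℕ.+-comm k 1) (reverse p ◅◅ step (rev-succ s) stop)

  -- A path of `k` steps visits `k + 2` vertices, since its first arc already has two ends. Indices
  -- range over ℕ, constant past the end, so that stretches of a walk are obtained by shifting the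
  -- index.
  vertex : ∀ {a b k} → Path a b k → ℕ → Fin n
  vertex {a} p          zero    = tail a
  vertex {a} stop       (suc i) = head a
  vertex     (step s p) (suc i) = vertex p i

  vertex-end : ∀ {a b k} (p : Path a b k) → vertex p (suc k) ≡ head b
  vertex-end stop       = refl
  vertex-end (step s p) = vertex-end p

  vertex-~ : ∀ {a b k} (p : Path a b k) i → i ≤ k → vertex p i ~ vertex p (suc i)
  vertex-~ {u , i} stop zero z≤n = ~-sym (nbr-~ u i)
  vertex-~ {u , i} (step (succ e _) p) zero z≤n = subst (nbr u i ~_) e (~-sym (nbr-~ u i))
  vertex-~ (step s p) (suc i) (s≤s le) = vertex-~ p i le

  vertex-≢ : ∀ {a b k} (p : Path a b k) i → i < k → vertex p i ≢ vertex p (2 + i)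
  vertex-≢ (step (succ _ n) stop)       zero    _        = n
  vertex-≢ (step (succ _ n) (step (succ e _) p)) zero _ = λ e′ → n (trans e′ (sym e))
  vertex-≢ (step s p)                   (suc i) (s≤s lt) = vertex-≢ p i lt

  descend : ∀ a p → ∃ λ b → Path a b (length p) × head b ≡ finish a p
  descend a []      = a , stop , refl
  descend a (b ∷ p) with c , q , e ← descend (down b a) p = c , step (down-succ b a) q , e

  module _ {g} (girth : GirthAtLeast G g) where

    -- `GirthAtLeast` speaks of shortest cycles only; by strong induction a shortest counterexample
    -- would be such a cycle.
    no-cycle : ∀ l → l < g → ¬ Cycle G l
    no-cycle = <-rec (λ l → l < g → ¬ Cycle G l) λ l rec l<g c →
      ℕ.<⇒≱ l<g (girth l (c , λ l′ c′ → ℕ.≮⇒≥ (λ l′<l → rec l′<l (ℕ.<-trans l′<l l<g) c′)))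

    -- If a vertex repeats, the stretch between two of its visits is a shorter closed walk; turning
    -- back is forbidden only at inner vertices, so the stretch is again admissible. Without a
    -- repetition the walk is a cycle, or it has length one or two, which irreflexivity and the ban
    -- on turning back exclude.
    no-closed-walk : ∀ L → 1 ≤ L → L < g → (w : ℕ → Fin n) → (∀ i → i < L → w i ~ w (suc i)) →
                     (∀ i → suc i < L → w i ≢ w (2 + i)) → w 0 ≡ w L → ⊥
    no-closed-walk = <-rec _ λ L rec 1≤L L<g w adj nb closed → repeat L rec 1≤L L<g w adj nb closed
      (Fin.any? λ i → Fin.any? λ j → (i Fin.<? j) ×-dec (w (toℕ i) Fin.≟ w (toℕ j)))
      where
      P : ℕ → Set
      P L = 1 ≤ L → L < g → (w : ℕ → Fin n) → (∀ i → i < L → w i ~ w (suc i)) → (∀ i → suc i < L → w i ≢ w (2 + i)) → w 0 ≡ w L → ⊥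
      repeat : ∀ L → (∀ {L′} → L′ < L → P L′) → 1 ≤ L → L < g → (w : ℕ → Fin n) → (∀ i → i < L → w i ~ w (suc i)) →
               (∀ i → suc i < L → w i ≢ w (2 + i)) → w 0 ≡ w L →
               Dec (∃ λ (i : Fin L) → ∃ λ (j : Fin L) → i Fin.< j × w (toℕ i) ≡ w (toℕ j)) → ⊥
      repeat L rec 1≤L L<g w adj nb closed (yes (i , j , i<j , e)) = rec {m} m<L (ℕ.m<n⇒0<n∸m i<j) (ℕ.<-trans m<L L<g) (λ k → w (k + toℕ i))
        (λ k k<m → adj (k + toℕ i) (shrink k k<m)) (λ k k<m → nb (k + toℕ i) (shrink (suc k) k<m)) (trans e (cong w (sym (ℕ.m∸n+n≡m (ℕ.<⇒≤ i<j)))))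
        where
        m = toℕ j ℕ.∸ toℕ i
        m<L : m < L
        m<L = ℕ.≤-<-trans (ℕ.m∸n≤m (toℕ j) (toℕ i)) (Fin.toℕ<n j)
        shrink : ∀ k → k < m → k + toℕ i < L
        shrink k k<m = ℕ.<-trans (subst (k + toℕ i <_) (ℕ.m∸n+n≡m (ℕ.<⇒≤ i<j)) (ℕ.+-monoˡ-< (toℕ i) k<m)) (Fin.toℕ<n j)
      repeat 1 rec _ L<g w adj nb closed (no _) = ~-irrefl closed (adj 0 (s≤s z≤n))
      repeat 2 rec _ L<g w adj nb closed (no _) = nb 0 (s≤s (s≤s z≤n)) closed
      repeat L@(suc (suc (suc _))) rec _ L<g w adj nb closed (no d) = no-cycle L L<g record
        { length≥3 = s≤s (s≤s (s≤s z≤n))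
        ; walk     = w ∘ toℕ
        ; step     = λ i → subst (λ k → w k ~ w (suc (toℕ i))) (sym (Fin.toℕ-inject₁ i)) (adj (toℕ i) (Fin.toℕ<n i))
        ; closed   = trans (cong w (Fin.toℕ-fromℕ L)) (sym closed)
        ; distinct = λ {i} {j} e → inj i j (subst₂ (λ k l → w k ≡ w l) (Fin.toℕ-inject₁ i) (Fin.toℕ-inject₁ j) e)
        }
        where
        inj : ∀ i j → w (toℕ i) ≡ w (toℕ j) → i ≡ j
        inj i j e with Fin.<-cmp i j
        ... | tri< i<j _ _ = ⊥-elim (d (i , j , i<j , e))
        ... | tri≈ _ i≡j _ = i≡j
        ... | tri> _ _ j<i = ⊥-elim (d (j , i , j<i , sym e))

    -- A path of `k` steps has `k + 1` edges; hence the bound on `suc k`.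
    no-closed-path : ∀ {a b k} → Path a b k → suc k < g → tail a ≢ head b
    no-closed-path {k = k} p k<g e = no-closed-walk (suc k) (s≤s z≤n) k<g (vertex p) (λ i i≤k → vertex-~ p i (ℕ.≤-pred i≤k))
      (λ i i<k → vertex-≢ p i (ℕ.≤-pred i<k)) (trans e (sym (vertex-end p)))

    module _ {R} (2R<g : R + R < g) where

      -- Joining the two descents at u would give a closed non-backtracking walk.
      finish-disjoint : ∀ u {j j′} → j ≢ j′ → ∀ p q → length p < R → length q < R → finish (into u j) p ≢ finish (into u j′) q
      finish-disjoint u {j} {j′} j≢j′ p q p<R q<R e with descend (into u j) p | descend (into u j′) q
      ... | a , P , ea | b , Q , eb = no-closed-path (reverse P ◅◅ step turn Q)
        -- The closed walk has `(length p + 1) + (length q + 1)` edges, at most `R + R`.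
        (ℕ.≤-<-trans (ℕ.≤-trans (ℕ.≤-reflexive (cong suc (ℕ.+-suc (length p) (length q)))) (ℕ.≤-trans (ℕ.≤-reflexive (sym (ℕ.+-suc (suc (length p)) (length q)))) (ℕ.+-mono-≤ p<R q<R))) 2R<g)
        (trans (tail-into (head a) (proj₂ a)) (trans ea (trans e (sym eb))))
        where
        turn : Succ (rev (into u j)) (into u j′)
        turn = subst (λ c → Succ c (into u j′)) (sym (rev-into u j)) (succ (sym (tail-into u j′)) (λ e → j≢j′ (nbr-injective u e)))

      finish-≢ : ∀ u j p → length p < R → finish (into u j) p ≢ u
      finish-≢ u j p p<R e with descend (into u j) p
      ... | a , P , ea = no-closed-path P (ℕ.≤-<-trans (ℕ.≤-trans p<R (ℕ.m≤m+n R R)) 2R<g) (trans (tail-into u j) (sym (trans ea e)))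

open import Data.Rational.Base using (_+_; _*_; _≤_)
open import Data.Rational.Properties

-- Fixed-point arithmetic

*-monoʳ : ∀ {r p q} → 0ℚ ≤ r → p ≤ q → r * p ≤ r * q
*-monoʳ {r} 0≤r = *-monoˡ-≤-nonNeg r {{nonNegative 0≤r}}

*-monoˡ : ∀ {r p q} → 0ℚ ≤ r → p ≤ q → p * r ≤ q * r
*-monoˡ {r} 0≤r = *-monoʳ-≤-nonNeg r {{nonNegative 0≤r}}

*-mono : ∀ {p q r s} → 0ℚ ≤ p → 0ℚ ≤ s → p ≤ q → r ≤ s → p * r ≤ q * s
*-mono 0≤p 0≤s p≤q r≤s = ≤-trans (*-monoʳ 0≤p r≤s) (*-monoˡ 0≤s p≤q)

0≤+ : ∀ {p q} → 0ℚ ≤ p → 0ℚ ≤ q → 0ℚ ≤ p + q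
0≤+ = +-mono-≤

0≤* : ∀ {p q} → 0ℚ ≤ p → 0ℚ ≤ q → 0ℚ ≤ p * q
0≤* {p} 0≤p 0≤q = subst (_≤ p * _) (*-zeroʳ p) (*-monoʳ 0≤p 0≤q)

p≤p+q : ∀ {p q} → 0ℚ ≤ q → p ≤ p + q
p≤p+q {p} 0≤q = subst (_≤ p + _) (+-identityʳ p) (+-monoʳ-≤ p 0≤q)

q≤p+q : ∀ {p q} → 0ℚ ≤ p → q ≤ p + q
q≤p+q {p} {q} 0≤p = subst (_≤ p + q) (+-identityˡ q) (+-monoˡ-≤ q 0≤p)

0≤1 : 0ℚ ≤ 1ℚ
0≤1 = *≤* (ℤ.+≤+ ℕ.z≤n)

fromℕ : ℕ → ℚ
fromℕ m = mkℚ (ℤ.+ m) 0 (Coprime.sym (1-coprimeTo m))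

fromℕ-+ : ∀ m n → fromℕ (m ℕ.+ n) ≡ fromℕ m + fromℕ n
fromℕ-+ m n = toℚᵘ-injective (ℚᵘ.≃-trans (*≡* (cong (ℤ._* ℤ.+ 1) eq)) (ℚᵘ.≃-sym (toℚᵘ-homo-+ (fromℕ m) (fromℕ n))))
  where
  eq : ℤ.+ (m ℕ.+ n) ≡ ℤ.+ m ℤ.* ℤ.+ 1 ℤ.+ ℤ.+ n ℤ.* ℤ.+ 1
  eq = cong₂ ℤ._+_ (sym (ℤ.*-identityʳ (ℤ.+ m))) (sym (ℤ.*-identityʳ (ℤ.+ n)))

fromℕ-* : ∀ m n → fromℕ (m ℕ.* n) ≡ fromℕ m * fromℕ n
fromℕ-* m n = toℚᵘ-injective (ℚᵘ.≃-trans (*≡* (cong (ℤ._* ℤ.+ 1) (ℤ.pos-* m n))) (ℚᵘ.≃-sym (toℚᵘ-homo-* (fromℕ m) (fromℕ n))))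

fromℕ-mono : ∀ {m n} → m ℕ.≤ n → fromℕ m ≤ fromℕ n
fromℕ-mono m≤n = *≤* (ℤ.*-monoʳ-≤-nonNeg (ℤ.+ 1) (ℤ.+≤+ m≤n))

0≤fromℕ : ∀ m → 0ℚ ≤ fromℕ m
0≤fromℕ m = fromℕ-mono {0} {m} ℕ.z≤n

fromℕ-pos : ∀ m .{{_ : NonZero m}} → ℚ.Positive (fromℕ m)
fromℕ-pos (suc m) = _

module FixedPoint (one : ℕ) .{{_ : NonZero one}} where

  private
    instance
      pos : ℚ.Positive (fromℕ one)
      pos = fromℕ-pos one

      nz : ℚ.NonZero (fromℕ one)
      nz = pos⇒nonZero (fromℕ one)

    inv : ℚ
    inv = 1/ fromℕ one

    inv* : inv * fromℕ one ≡ 1ℚ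
    inv* = *-inverseˡ (fromℕ one)

    0≤inv : 0ℚ ≤ inv
    0≤inv = nonNegative⁻¹ inv {{pos⇒nonNeg inv {{1/pos⇒pos (fromℕ one)}}}}

  infixl 7 _⊗_
  infix 4 _≲_

  _⊗_ : ℕ → ℕ → ℕ
  a ⊗ b = (a ℕ.* b) ℕ./ one

  opaque
    num : ℕ → ℚ
    num m = inv * fromℕ m

    num-one : num one ≡ 1ℚ
    num-one = inv*

    num-zero : num 0 ≡ 0ℚ
    num-zero = *-zeroʳ inv

    num-+ : ∀ m n → num (m ℕ.+ n) ≡ num m + num n
    num-+ m n = trans (cong (inv *_) (fromℕ-+ m n)) (*-distribˡ-+ inv (fromℕ m) (fromℕ n))

    num-mono : ∀ {m n} → m ℕ.≤ n → num m ≤ num n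
    num-mono m≤n = *-monoʳ 0≤inv (fromℕ-mono m≤n)

    -- The floor in `⊗` is the only rounding inside the recursion. Since all quantities are
    -- nonnegative, its direction survives later sums and products.
    num-⊗ : ∀ m n → num (m ⊗ n) ≤ num m * num n
    num-⊗ m n = begin
      inv * fromℕ (m ⊗ n)                       ≡⟨ cong (_* fromℕ (m ⊗ n)) (sym (*-identityʳ inv)) ⟩
      inv * 1ℚ * fromℕ (m ⊗ n)                  ≡⟨ cong (λ i → inv * i * fromℕ (m ⊗ n)) (sym inv*) ⟩
      inv * (inv * fromℕ one) * fromℕ (m ⊗ n)   ≡⟨ solve 3 (λ i o x → i :* (i :* o) :* x := i :* i :* (x :* o)) refl inv (fromℕ one) (fromℕ (m ⊗ n)) ⟩
      inv * inv * (fromℕ (m ⊗ n) * fromℕ one)   ≡⟨ cong (inv * inv *_) (sym (fromℕ-* (m ⊗ n) one)) ⟩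
      inv * inv * fromℕ (m ⊗ n ℕ.* one)         ≤⟨ *-monoʳ (0≤* 0≤inv 0≤inv) (fromℕ-mono (m/n*n≤m (m ℕ.* n) one)) ⟩
      inv * inv * fromℕ (m ℕ.* n)               ≡⟨ cong (inv * inv *_) (fromℕ-* m n) ⟩
      inv * inv * (fromℕ m * fromℕ n)           ≡⟨ solve 3 (λ i x y → i :* i :* (x :* y) := i :* x :* (i :* y)) refl inv (fromℕ m) (fromℕ n) ⟩
      inv * fromℕ m * (inv * fromℕ n)           ∎
      where open ≤-Reasoning
            open +-*-Solver

    0≤num : ∀ m → 0ℚ ≤ num m
    0≤num m = 0≤* 0≤inv (0≤fromℕ m)

    num-ratio : ∀ {a b m} .{{_ : NonZero b}} → a ℕ.* one ℕ.≤ b ℕ.* m → ℤ.+ a ℚ./ b ≤ num m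
    num-ratio {a} {b@(suc _)} {m} le = *-cancelʳ-≤-pos (fromℕ b) (begin
      ℤ.+ a ℚ./ b * fromℕ b          ≡⟨ toℚᵘ-injective (ℚᵘ.≃-trans (toℚᵘ-homo-* (ℤ.+ a ℚ./ b) (fromℕ b))
                                       (ℚᵘ.≃-trans (ℚᵘ.*-congʳ (toℚᵘ-fromℚᵘ (mkℚᵘ (ℤ.+ a) (ℕ.pred b))))
                                         (*≡* (ℤ.*-assoc (ℤ.+ a) (ℤ.+ b) (ℤ.+ 1))))) ⟩
      fromℕ a                      ≡⟨ sym (*-identityˡ (fromℕ a)) ⟩
      1ℚ * fromℕ a                 ≡⟨ cong (_* fromℕ a) (sym inv*) ⟩
      inv * fromℕ one * fromℕ a    ≡⟨ solve 3 (λ i o x → i :* o :* x := i :* (x :* o)) refl inv (fromℕ one) (fromℕ a) ⟩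
      inv * (fromℕ a * fromℕ one)  ≡⟨ cong (inv *_) (sym (fromℕ-* a one)) ⟩
      inv * fromℕ (a ℕ.* one)      ≤⟨ *-monoʳ 0≤inv (fromℕ-mono le) ⟩
      inv * fromℕ (b ℕ.* m)        ≡⟨ cong (inv *_) (fromℕ-* b m) ⟩
      inv * (fromℕ b * fromℕ m)    ≡⟨ solve 3 (λ i x y → i :* (x :* y) := i :* y :* x) refl inv (fromℕ b) (fromℕ m) ⟩
      inv * fromℕ m * fromℕ b      ∎)
      where open ≤-Reasoning
            open +-*-Solver

  _≲_ : ℕ → ℚ → Set
  m ≲ q = num m ≤ q

  ⊗-* : ∀ {m n p q} → m ≲ p → n ≲ q → m ⊗ n ≲ p * q
  ⊗-* {m} {n} m≲p n≲q = ≤-trans (num-⊗ m n) (*-mono (0≤num m) (≤-trans (0≤num n) n≲q) m≲p n≲q)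

  +-+ : ∀ {m n p q} → m ≲ p → n ≲ q → m ℕ.+ n ≲ p + q
  +-+ {m} {n} m≲p n≲q = ≤-trans (≤-reflexive (num-+ m n)) (+-mono-≤ m≲p n≲q)

-- Expectations over random trees

-- An expectation as a positive linear functional. Total mass is left open, so that the
-- sub-probability measures of live limbs are covered; `Normalised` adds it where it holds.
record Positive (A : Set) : Set₁ where
  field
    ⟨_⟩   : (A → ℚ) → ℚ
    mono  : ∀ {f g} → (∀ a → f a ≤ g a) → ⟨ f ⟩ ≤ ⟨ g ⟩
    add   : ∀ f g → ⟨ (λ a → f a + g a) ⟩ ≡ ⟨ f ⟩ + ⟨ g ⟩
    scale : ∀ k f → ⟨ (λ a → k * f a) ⟩ ≡ k * ⟨ f ⟩

  ext : ∀ {f g} → (∀ a → f a ≡ g a) → ⟨ f ⟩ ≡ ⟨ g ⟩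
  ext e = ≤-antisym (mono (λ a → ≤-reflexive (e a))) (mono (λ a → ≤-reflexive (sym (e a))))

  null : ⟨ (λ _ → 0ℚ) ⟩ ≡ 0ℚ
  null = trans (ext (λ _ → sym (*-zeroˡ 0ℚ))) (trans (scale 0ℚ (λ _ → 0ℚ)) (*-zeroˡ ⟨ (λ _ → 0ℚ) ⟩))

  const : ∀ k → ⟨ (λ _ → k) ⟩ ≡ k * ⟨ (λ _ → 1ℚ) ⟩
  const k = trans (ext (λ _ → sym (*-identityʳ k))) (scale k (λ _ → 1ℚ))

  pos : ∀ {f} → (∀ a → 0ℚ ≤ f a) → 0ℚ ≤ ⟨ f ⟩
  pos 0≤f = ≤-trans (≤-reflexive (sym null)) (mono 0≤f)

open Positive public

module _ {A B : Set} where
  infixr 5 _⊠_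

  _⊠_ : Positive A → Positive B → Positive (A × B)
  ⟨ P ⊠ Q ⟩ f = ⟨ P ⟩ λ a → ⟨ Q ⟩ λ b → f (a , b)
  mono (P ⊠ Q) le = mono P λ a → mono Q λ b → le (a , b)
  add (P ⊠ Q) f g = trans (ext P λ a → add Q _ _) (add P _ _)
  scale (P ⊠ Q) k f = trans (ext P λ a → scale Q k _) (scale P k _)

dirac : Positive ⊤
⟨ dirac ⟩ f = f tt
mono dirac le = le tt
add dirac f g = refl
scale dirac k f = refl

Normalised : ∀ {A} → Positive A → Set
Normalised P = ⟨ P ⟩ (λ _ → 1ℚ) ≡ 1ℚ

const₁ : ∀ {A} (P : Positive A) → Normalised P → ∀ k → ⟨ P ⟩ (λ _ → k) ≡ k
const₁ P n k = trans (const P k) (trans (cong (k *_) n) (*-identityʳ k))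

-- Random coins and labelled binary trees

data Coin : Set where
  idle fold cut : Coin

Label Tree : Set
Label = ℕ → Coin
Tree = List Bool → Label

infixr 5 _◁_
_◁_ : Coin → Label → Label
(c ◁ ℓ) zero = c
(c ◁ ℓ) (suc k) = ℓ k

label : Tree → Label
label T = T []

child : Bool → Tree → Tree
child b T p = T (b ∷ p)

node : Label → Tree → Tree → Tree
node ℓ L M [] = ℓ
node ℓ L M (false ∷ p) = L p
node ℓ L M (true ∷ p) = M p

blank : Tree
blank _ _ = idle

-- Probabilities are natural numbers in units of 1 / one.
module Sampling (one : ℕ) .{{_ : NonZero one}} (foldRate cutRate : ℕ → ℕ)
                (valid : ∀ t → foldRate t ℕ.+ cutRate t ℕ.≤ one) where

  open FixedPoint one

  idleRate : ℕ → ℕ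
  idleRate t = one ∸ (foldRate t ℕ.+ cutRate t)

  opaque
    coin : ℕ → Positive Coin
    ⟨ coin t ⟩ f = num (idleRate t) * f idle + (num (foldRate t) * f fold + num (cutRate t) * f cut)
    mono (coin t) le = +-mono-≤ (*-monoʳ (0≤num _) (le idle)) (+-mono-≤ (*-monoʳ (0≤num _) (le fold)) (*-monoʳ (0≤num _) (le cut)))
    add (coin t) f g = solve 9 (λ p q r a b c x y z → p :* (a :+ x) :+ (q :* (b :+ y) :+ r :* (c :+ z)) :=
        (p :* a :+ (q :* b :+ r :* c)) :+ (p :* x :+ (q :* y :+ r :* z))) refl
        (num (idleRate t)) (num (foldRate t)) (num (cutRate t)) (f idle) (f fold) (f cut) (g idle) (g fold) (g cut)
      where open +-*-Solver
    scale (coin t) k f = solve 7 (λ p q r a b c k → p :* (k :* a) :+ (q :* (k :* b) :+ r :* (k :* c)) :=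
        k :* (p :* a :+ (q :* b :+ r :* c))) refl
        (num (idleRate t)) (num (foldRate t)) (num (cutRate t)) (f idle) (f fold) (f cut) k
      where open +-*-Solver

    coin-normalised : ∀ t → Normalised (coin t)
    coin-normalised t = begin
      num (idleRate t) * 1ℚ + (num (foldRate t) * 1ℚ + num (cutRate t) * 1ℚ)
        ≡⟨ cong₂ _+_ (*-identityʳ (num (idleRate t))) (cong₂ _+_ (*-identityʳ (num (foldRate t))) (*-identityʳ (num (cutRate t)))) ⟩
      num (idleRate t) + (num (foldRate t) + num (cutRate t))
        ≡⟨ cong (num (idleRate t) +_) (sym (num-+ (foldRate t) (cutRate t))) ⟩
      num (idleRate t) + num (foldRate t ℕ.+ cutRate t)
        ≡⟨ sym (num-+ (idleRate t) (foldRate t ℕ.+ cutRate t)) ⟩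
      num (idleRate t ℕ.+ (foldRate t ℕ.+ cutRate t))
        ≡⟨ cong num (ℕ.m∸n+n≡m (valid t)) ⟩
      num one
        ≡⟨ num-one ⟩
      1ℚ ∎
      where open ≡-Reasoning

    -- Two abstract positive functionals need not commute. A coin is a mixture of three point
    -- masses, so linearity of `P` suffices.
    coin-swap : ∀ {A} (P : Positive A) t (f : A → Coin → ℚ) →
                ⟨ P ⟩ (λ a → ⟨ coin t ⟩ (f a)) ≡ ⟨ coin t ⟩ (λ c → ⟨ P ⟩ (λ a → f a c))
    coin-swap P t f =
        trans (add P (λ a → num (idleRate t) * f a idle) _) (cong₂ _+_ (scale P (num (idleRate t)) (λ a → f a idle))
          (trans (add P (λ a → num (foldRate t) * f a fold) (λ a → num (cutRate t) * f a cut))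
            (cong₂ _+_ (scale P (num (foldRate t)) (λ a → f a fold)) (scale P (num (cutRate t)) (λ a → f a cut)))))

    coin-split : ∀ t f → ⟨ coin t ⟩ f ≡ num (idleRate t) * f idle + (num (foldRate t) * f fold + num (cutRate t) * f cut)
    coin-split t f = refl

  -- Tosses the coins of rounds `t` to `t + n - 1` and stores them from index zero on; all later
  -- entries are `idle`.
  labels : ℕ → ℕ → Positive Label
  ⟨ labels t zero ⟩ f = f (λ _ → idle)
  mono (labels t zero) le = le (λ _ → idle)
  add (labels t zero) f g = refl
  scale (labels t zero) k f = refl
  ⟨ labels t (suc n) ⟩ f = ⟨ coin t ⟩ λ c → ⟨ labels (suc t) n ⟩ λ ℓ → f (c ◁ ℓ)
  mono (labels t (suc n)) le = mono (coin t) λ c → mono (labels (suc t) n) λ ℓ → le (c ◁ ℓ)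
  add (labels t (suc n)) f g = trans (ext (coin t) λ c → add (labels (suc t) n) (λ ℓ → f (c ◁ ℓ)) (λ ℓ → g (c ◁ ℓ))) (add (coin t) _ _)
  scale (labels t (suc n)) k f = trans (ext (coin t) λ c → scale (labels (suc t) n) k (λ ℓ → f (c ◁ ℓ))) (scale (coin t) k _)

  labels-normalised : ∀ t n → Normalised (labels t n)
  labels-normalised t zero = refl
  labels-normalised t (suc n) = trans (ext (coin t) λ _ → labels-normalised (suc t) n) (coin-normalised t)

  labels-swap : ∀ {A} (P : Positive A) t n (f : A → Label → ℚ) →
                ⟨ P ⟩ (λ a → ⟨ labels t n ⟩ (f a)) ≡ ⟨ labels t n ⟩ (λ ℓ → ⟨ P ⟩ (λ a → f a ℓ))
  labels-swap P t zero f = refl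
  labels-swap P t (suc n) f =
    trans (coin-swap P t (λ a c → ⟨ labels (suc t) n ⟩ λ ℓ → f a (c ◁ ℓ))) (ext (coin t) λ c → labels-swap P (suc t) n (λ a ℓ → f a (c ◁ ℓ)))

  -- Coin `k` is independent of everything that reads only earlier coins. At `k = 0` the function
  -- `h` reads nothing of the label, so it can be frozen at the idle label and the remaining coins
  -- integrated out.
  resample : ∀ t n {k s} → k ℕ.< n → t ℕ.+ k ≡ s → (h : Label → Coin → ℚ) →
             (∀ ℓ ℓ′ → (∀ i → i ℕ.< k → ℓ i ≡ ℓ′ i) → ∀ c → h ℓ c ≡ h ℓ′ c) →
             ⟨ labels t n ⟩ (λ ℓ → h ℓ (ℓ k)) ≡ ⟨ labels t n ⟩ (λ ℓ → ⟨ coin s ⟩ (h ℓ))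
  resample t (suc n) {zero} {s} _ t+0≡s h inv rewrite sym (trans (sym (ℕ.+-identityʳ t)) t+0≡s) = begin
    ⟨ coin t ⟩ (λ c → ⟨ labels (suc t) n ⟩ (λ ℓ → h (c ◁ ℓ) c))
      ≡⟨ ext (coin t) (λ c → ext (labels (suc t) n) λ ℓ → inv (c ◁ ℓ) (λ _ → idle) (λ _ ()) c) ⟩
    ⟨ coin t ⟩ (λ c → ⟨ labels (suc t) n ⟩ (λ ℓ → h (λ _ → idle) c))
      ≡⟨ ext (coin t) (λ c → const₁ (labels (suc t) n) (labels-normalised (suc t) n) _) ⟩
    ⟨ coin t ⟩ (h (λ _ → idle))
      ≡⟨ const₁ (labels t (suc n)) (labels-normalised t (suc n)) _ ⟨
    ⟨ labels t (suc n) ⟩ (λ ℓ → ⟨ coin t ⟩ (h (λ _ → idle)))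
      ≡⟨ ext (labels t (suc n)) (λ ℓ → ext (coin t) (inv (λ _ → idle) ℓ (λ _ ()))) ⟩
    ⟨ labels t (suc n) ⟩ (λ ℓ → ⟨ coin t ⟩ (h ℓ)) ∎
    where open ≡-Reasoning
  resample t (suc n) {suc k} (ℕ.s≤s k<n) t+k≡s h inv =
    ext (coin t) λ c → resample (suc t) n k<n (trans (sym (ℕ.+-suc t k)) t+k≡s) (λ ℓ → h (c ◁ ℓ))
      λ ℓ ℓ′ agree → inv (c ◁ ℓ) (c ◁ ℓ′) λ { zero _ → refl ; (suc i) (ℕ.s≤s i<k) → agree i i<k }

  module Horizon (H : ℕ) where

    trees : ℕ → Positive Tree
    ⟨ trees zero ⟩ f = f blank
    mono (trees zero) le = le blank
    add (trees zero) f g = refl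
    scale (trees zero) k f = refl
    ⟨ trees (suc R) ⟩ f = ⟨ labels 0 H ⟩ λ ℓ → ⟨ trees R ⟩ λ L → ⟨ trees R ⟩ λ M → f (node ℓ L M)
    mono (trees (suc R)) le = mono (labels 0 H) λ ℓ → mono (trees R) λ L → mono (trees R) λ M → le (node ℓ L M)
    add (trees (suc R)) f g =
      trans (ext (labels 0 H) λ ℓ → trans (ext (trees R) λ L → add (trees R) (λ M → f (node ℓ L M)) (λ M → g (node ℓ L M))) (add (trees R) _ _)) (add (labels 0 H) _ _)
    scale (trees (suc R)) k f =
      trans (ext (labels 0 H) λ ℓ → trans (ext (trees R) λ L → scale (trees R) k (λ M → f (node ℓ L M))) (scale (trees R) k _)) (scale (labels 0 H) k _)

    trees-normalised : ∀ R → Normalised (trees R)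
    trees-normalised zero = refl
    trees-normalised (suc R) = trans
      (ext (labels 0 H) λ ℓ → trans (ext (trees R) λ L → trees-normalised R) (trees-normalised R))
      (labels-normalised 0 H)

-- The process on a labelled tree, seen by a parent and by a root

-- The state of the vertex at the top of a limb as long as its parent does not act: alone
-- or merged into a cluster, with the live limbs away from the parent; dead once it is
-- excluded, and gone once it has acted on its parent.
data State : Set where
  single cluster : List Tree → State
  dead gone      : State

-- The action on the parent. A limb vanishes when its top vertex is excluded, and kills when
-- that vertex joins the set; it fuses ps when that vertex folds, so that the parent is merged
-- with the other neighbour, whose further limbs are ps.
data Letter : Set where
  quiet vanish kill : Letter
  fuse            : List Tree → Letter

-- The message of a folding vertex to its parent, given the state of its other neighbour. Merging
-- requires that neighbour to be unmerged and to have further limbs; otherwise the folding vertex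
-- tries to join, which excludes the parent.
offer : State → Letter
offer (single (x ∷ xs)) = fuse (x ∷ xs)
offer _                 = kill

act : (Tree → State) → State → Coin → Letter
act X (single [])          c    = kill
act X (single (e ∷ []))    fold = offer (X e)
act X (single (e ∷ []))    _    = quiet
act X (single (_ ∷ _ ∷ _)) cut  = vanish
act X (single (_ ∷ _ ∷ _)) _    = quiet
act X (cluster [])         c    = kill
act X (cluster (_ ∷ _))    c    = quiet
act X dead                 c    = vanish
act X gone                 c    = quiet

keep : Tree → State → State
keep p (single ls)  = single (p ∷ ls)
keep p (cluster ls) = cluster (p ∷ ls)
keep p dead         = dead
keep p gone         = gone

-- The first argument comes from the limbs received by a fusion, the second from the vertex's own
-- remaining limbs. A second fusion or a kill in the same round spoils the second argument, and the
-- vertex is excluded.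
attach : State → State → State
attach (cluster qs) (single ls) = cluster (qs ++ ls)
attach _            _           = dead

tryCluster : Letter → Tree → State → State
tryCluster quiet    p r = keep p r
tryCluster vanish   p r = r
tryCluster kill     p r = dead
tryCluster (fuse _) p r = dead

clusterOf : (Tree → Letter) → List Tree → State
clusterOf m []       = cluster []
clusterOf m (p ∷ ls) = tryCluster (m p) p (clusterOf m ls)

trySingle : (Tree → Letter) → Letter → Tree → State → State
trySingle m quiet     p r = keep p r
trySingle m vanish    p r = r
trySingle m kill      p r = dead
trySingle m (fuse ps) p r = attach (clusterOf m ps) r

singleOf : (Tree → Letter) → List Tree → State
singleOf m []       = single []
singleOf m (p ∷ ls) = trySingle m (m p) p (singleOf m ls)

next : (Tree → Letter) → Letter → State → State
next m quiet (single ls)  = singleOf m ls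
next m quiet (cluster ls) = clusterOf m ls
next m _     _            = gone

emit : (Tree → State) → ℕ → Tree → Letter
emit X t T = act X (X T) (label T t)

X : ℕ → Tree → State
X zero    T = single (child false T ∷ child true T ∷ [])
X (suc t) T = next (emit (X t) t) (emit (X t) t T) (X t T)

letter : ℕ → Tree → Letter
letter t = emit (X t) t

-- Round `s` reads only coin `s` of the top label. This makes the coin of round `t` fresh when the
-- state at time `t` is known.
X-label : ∀ t {L M ℓ ℓ′} → (∀ s → s ℕ.< t → ℓ s ≡ ℓ′ s) → X t (node ℓ L M) ≡ X t (node ℓ′ L M)
X-label zero    agree = refl
X-label (suc t) {L} {M} {ℓ} {ℓ′} agree
  rewrite X-label t {L} {M} {ℓ} {ℓ′} (λ s s<t → agree s (ℕ.m<n⇒m<1+n s<t)) | agree t ℕ.≤-refl = refl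

-- A folded root joins exactly if the cluster of its two neighbours, with the given limbs,
-- is excluded.
data Root : Set where
  rootSingle rootCluster folded : List Tree → Root
  win lose                      : Root

calm : Letter → Root → Root
calm quiet  r = r
calm vanish r = r
calm _      r = lose

join : (Tree → Letter) → List Tree → Root
join m []       = win
join m (p ∷ ls) = calm (m p) (join m ls)

wrap : State → Root
wrap (single ls)  = rootSingle ls
wrap (cluster ls) = rootCluster ls
wrap _            = lose

foldUp : State → Root
foldUp (cluster ls) = folded ls
foldUp dead         = win
foldUp _            = lose

both : Letter → Letter → Root → Root
both quiet quiet r = r
both _     _     r = lose

-- A root with two limbs folds. If both neighbours are unmerged with further limbs and neither acts
-- in this round, they form the cluster on which the root waits. If they cannot merge, the root
-- joins unless one of them acts against it.
duel : (Tree → Letter) → State → Letter → State → Letter → Root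
duel m (single (x ∷ xs)) l (single (y ∷ ys)) l′ = both l l′ (foldUp (clusterOf m ((x ∷ xs) ++ (y ∷ ys))))
duel m _                 l _                 l′ = calm l (calm l′ win)

rootStep : (Tree → State) → (Tree → Letter) → Coin → Root → Root
rootStep X m c    (rootSingle [])              = win
rootStep X m c    (rootSingle (e ∷ []))        = join m (e ∷ [])
rootStep X m fold (rootSingle (e ∷ f ∷ []))    = duel m (X e) (m e) (X f) (m f)
rootStep X m _    (rootSingle (e ∷ f ∷ []))    = wrap (singleOf m (e ∷ f ∷ []))
rootStep X m cut  (rootSingle (e ∷ f ∷ g ∷ ls)) = lose
rootStep X m _    (rootSingle (e ∷ f ∷ g ∷ ls)) = wrap (singleOf m (e ∷ f ∷ g ∷ ls))
rootStep X m c    (rootCluster [])             = win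
rootStep X m c    (rootCluster (e ∷ []))       = join m (e ∷ [])
rootStep X m c    (rootCluster (e ∷ f ∷ ls))   = wrap (clusterOf m (e ∷ f ∷ ls))
rootStep X m c    (folded [])                  = lose
rootStep X m c    (folded (e ∷ []))            = lose
rootStep X m c    (folded (e ∷ f ∷ ls))        = foldUp (clusterOf m (e ∷ f ∷ ls))
rootStep X m c    win                          = win
rootStep X m c    lose                         = lose

Y : ℕ → Label → List Tree → Root
Y zero    ℓ es = rootSingle es
Y (suc t) ℓ es = rootStep (X t) (letter t) (ℓ t) (Y t ℓ es)

Y-label : ∀ t {ℓ ℓ′} es → (∀ s → s ℕ.< t → ℓ s ≡ ℓ′ s) → Y t ℓ es ≡ Y t ℓ′ es
Y-label zero    es agree = refl
Y-label (suc t) es agree = cong₂ (rootStep (X t) (letter t)) (agree t ℕ.≤-refl) (Y-label t es (λ s s<t → agree s (ℕ.m<n⇒m<1+n s<t)))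

-- The recursion for the laws

pw : ℚ → ℕ → ℚ
pw q zero    = 1ℚ
pw q (suc k) = q * pw q k

0≤pw : ∀ {q} → 0ℚ ≤ q → ∀ k → 0ℚ ≤ pw q k
0≤pw 0≤q zero    = 0≤1
0≤pw 0≤q (suc k) = 0≤* 0≤q (0≤pw 0≤q k)

-- Lower bounds, in units of 1 / one, for the probabilities of the states; the k-th entry
-- of a list belongs to states with k live limbs.
record Law : Set where
  constructor law
  field
    singles clusters : List ℕ
    deads            : ℕ

open Law public

record Values : Set where
  constructor values
  field
    onSingle onCluster : ℕ → ℚ
    onDead             : ℚ

open Values public

record NonNeg (V : Values) : Set where
  constructor nonNeg
  field
    single≥0  : ∀ k → 0ℚ ≤ onSingle V k
    cluster≥0 : ∀ k → 0ℚ ≤ onCluster V k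
    dead≥0    : 0ℚ ≤ onDead V

open NonNeg public

record RootLaw : Set where
  constructor rootLaw
  field
    rootSingles rootClusters foldeds : List ℕ
    wins                             : ℕ

open RootLaw public

module Coefficients (one : ℕ) .{{_ : NonZero one}} where

  open FixedPoint one

  infixl 7 _⊡_ _⊙_
  infixl 6 _⊞_ _⊕_

  _⊡_ : ℕ → List ℕ → List ℕ
  k ⊡ xs = map (k ⊗_) xs

  _⊞_ : List ℕ → List ℕ → List ℕ
  []       ⊞ ys       = ys
  (x ∷ xs) ⊞ []       = x ∷ xs
  (x ∷ xs) ⊞ (y ∷ ys) = x ℕ.+ y ∷ xs ⊞ ys

  conv : List ℕ → List ℕ → List ℕ
  conv []       ys = []
  conv (x ∷ xs) ys = x ⊡ ys ⊞ (0 ∷ conv xs ys)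

  -- Horner's scheme for the polynomial with coefficients `xs`. A coefficient for `k` limbs is a
  -- density against the `k`-th power of the unnormalised limb measure, so evaluation at a bound `a`
  -- for the mass of that measure gives a probability.
  mass : ℕ → List ℕ → ℕ
  mass a []       = 0
  mass a (x ∷ xs) = x ℕ.+ a ⊗ mass a xs

  pow : ℕ → ℕ → ℕ
  pow a zero    = one
  pow a (suc k) = a ⊗ pow a k

  nth : List ℕ → ℕ → ℕ
  nth []       _       = 0
  nth (x ∷ xs) zero    = x
  nth (x ∷ xs) (suc k) = nth xs k

  _⊙_ : ℕ → Law → Law
  k ⊙ law s c z = law (k ⊡ s) (k ⊡ c) (k ⊗ z)

  _⊕_ : Law → Law → Law
  law s c z ⊕ law s′ c′ z′ = law (s ⊞ s′) (c ⊞ c′) (z ℕ.+ z′)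

  mix : List ℕ → (ℕ → Law) → Law
  mix []       L = law [] [] 0
  mix (x ∷ xs) L = x ⊙ L 0 ⊕ mix xs (L ∘ suc)

  dot : List ℕ → (ℕ → ℚ) → ℚ
  dot []       V = 0ℚ
  dot (x ∷ xs) V = num x * V 0 + dot xs (V ∘ suc)

  eval : Law → Values → ℚ
  eval (law s c z) V = dot s (onSingle V) + dot c (onCluster V) + num z * onDead V

  dot-≥0 : ∀ xs {V} → (∀ k → 0ℚ ≤ V k) → 0ℚ ≤ dot xs V
  dot-≥0 []       V≥0 = ≤-refl
  dot-≥0 (x ∷ xs) V≥0 = 0≤+ (0≤* (0≤num x) (V≥0 0)) (dot-≥0 xs (V≥0 ∘ suc))

  eval-≥0 : ∀ L {V} → NonNeg V → 0ℚ ≤ eval L V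
  eval-≥0 (law s c z) p = 0≤+ (0≤+ (dot-≥0 s (single≥0 p)) (dot-≥0 c (cluster≥0 p))) (0≤* (0≤num z) (dead≥0 p))

  dot-mono : ∀ xs {V W} → (∀ k → V k ≤ W k) → dot xs V ≤ dot xs W
  dot-mono []       le = ≤-refl
  dot-mono (x ∷ xs) le = +-mono-≤ (*-monoʳ (0≤num x) (le 0)) (dot-mono xs (le ∘ suc))

  dot-ext : ∀ xs {V W} → (∀ k → V k ≡ W k) → dot xs V ≡ dot xs W
  dot-ext []       eq = refl
  dot-ext (x ∷ xs) eq = cong₂ _+_ (cong (num x *_) (eq 0)) (dot-ext xs (eq ∘ suc))

  dot-scale : ∀ xs q V → dot xs (λ k → q * V k) ≡ q * dot xs V
  dot-scale []       q V = sym (*-zeroʳ q)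
  dot-scale (x ∷ xs) q V = trans (cong (num x * (q * V 0) +_) (dot-scale xs q (V ∘ suc)))
    (solve 4 (λ x q v d → x :* (q :* v) :+ q :* d := q :* (x :* v :+ d)) refl (num x) q (V 0) (dot xs (V ∘ suc)))
    where open +-*-Solver

  dot-add : ∀ xs V W → dot xs (λ k → V k + W k) ≡ dot xs V + dot xs W
  dot-add []       V W = refl
  dot-add (x ∷ xs) V W = trans (cong (num x * (V 0 + W 0) +_) (dot-add xs (V ∘ suc) (W ∘ suc)))
    (solve 5 (λ x v w d e → x :* (v :+ w) :+ (d :+ e) := x :* v :+ d :+ (x :* w :+ e)) refl
      (num x) (V 0) (W 0) (dot xs (V ∘ suc)) (dot xs (W ∘ suc)))
    where open +-*-Solver

  dot-⊞ : ∀ xs ys V → dot (xs ⊞ ys) V ≡ dot xs V + dot ys V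
  dot-⊞ []       ys       V = sym (+-identityˡ (dot ys V))
  dot-⊞ (x ∷ xs) []       V = sym (+-identityʳ (dot (x ∷ xs) V))
  dot-⊞ (x ∷ xs) (y ∷ ys) V = trans (cong₂ _+_ (cong (_* V 0) (num-+ x y)) (dot-⊞ xs ys (V ∘ suc)))
    (solve 5 (λ x y v d e → (x :+ y) :* v :+ (d :+ e) := x :* v :+ d :+ (y :* v :+ e)) refl
      (num x) (num y) (V 0) (dot xs (V ∘ suc)) (dot ys (V ∘ suc)))
    where open +-*-Solver

  dot-⊡ : ∀ k xs {V} → (∀ j → 0ℚ ≤ V j) → dot (k ⊡ xs) V ≤ num k * dot xs V
  dot-⊡ k []       V≥0 = ≤-reflexive (sym (*-zeroʳ (num k)))
  dot-⊡ k (x ∷ xs) {V} V≥0 = ≤-trans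
    (+-mono-≤ (*-monoˡ (V≥0 0) (num-⊗ k x)) (dot-⊡ k xs (V≥0 ∘ suc)))
    (≤-reflexive (solve 4 (λ k x v d → k :* x :* v :+ k :* d := k :* (x :* v :+ d)) refl (num k) (num x) (V 0) (dot xs (V ∘ suc))))
    where open +-*-Solver

  dot-shift : ∀ xs V → dot (0 ∷ xs) V ≡ dot xs (V ∘ suc)
  dot-shift xs V = trans (cong (_+ dot xs (V ∘ suc)) (trans (cong (_* V 0) num-zero) (*-zeroˡ (V 0)))) (+-identityˡ (dot xs (V ∘ suc)))

  dot-conv : ∀ xs ys {V} → (∀ j → 0ℚ ≤ V j) → dot (conv xs ys) V ≤ dot xs (λ m → dot ys (λ j → V (m ℕ.+ j)))
  dot-conv []       ys     V≥0 = ≤-refl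
  dot-conv (x ∷ xs) ys {V} V≥0 = begin
    dot (x ⊡ ys ⊞ (0 ∷ conv xs ys)) V                      ≡⟨ dot-⊞ (x ⊡ ys) (0 ∷ conv xs ys) V ⟩
    dot (x ⊡ ys) V + dot (0 ∷ conv xs ys) V                ≡⟨ cong (dot (x ⊡ ys) V +_) (dot-shift (conv xs ys) V) ⟩
    dot (x ⊡ ys) V + dot (conv xs ys) (V ∘ suc)            ≤⟨ +-mono-≤ (dot-⊡ x ys V≥0) (dot-conv xs ys (V≥0 ∘ suc)) ⟩
    num x * dot ys V + dot xs (λ m → dot ys (λ j → V (suc m ℕ.+ j))) ∎
    where open ≤-Reasoning

  dot-mass : ∀ {a q} xs → num a ≤ q → num (mass a xs) ≤ dot xs (pw q)
  dot-mass []       a≤q = ≤-reflexive num-zero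
  dot-mass {a} {q} (x ∷ xs) a≤q = ≤-trans
    (+-+ {x} {a ⊗ mass a xs} (≤-reflexive (sym (*-identityʳ (num x)))) (⊗-* {a} {mass a xs} a≤q (dot-mass xs a≤q)))
    (≤-reflexive (cong (num x * 1ℚ +_) (sym (dot-scale xs q (pw q)))))

  num-pow : ∀ {a q} k → num a ≤ q → num (pow a k) ≤ pw q k
  num-pow zero    a≤q = ≤-reflexive num-one
  num-pow {a} (suc k) a≤q = ⊗-* {a} {pow a k} a≤q (num-pow k a≤q)

  dot-split : ∀ xs V → dot xs V ≡ num (nth xs 0) * V 0 + dot (drop 1 xs) (V ∘ suc)
  dot-split []       V = sym (trans (+-identityʳ _) (trans (cong (_* V 0) num-zero) (*-zeroˡ (V 0))))
  dot-split (x ∷ xs) V = refl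

  dot-split₂ : ∀ xs V → dot xs V ≡ num (nth xs 0) * V 0 + (num (nth xs 1) * V 1 + dot (drop 2 xs) (λ k → V (2 ℕ.+ k)))
  dot-split₂ []           V = trans (dot-split [] V) (cong (num 0 * V 0 +_) (dot-split [] (V ∘ suc)))
  dot-split₂ (x ∷ [])     V = cong (num x * V 0 +_) (dot-split [] (V ∘ suc))
  dot-split₂ (x ∷ y ∷ xs) V = refl

  eval-⊕ : ∀ L M V → eval (L ⊕ M) V ≡ eval L V + eval M V
  eval-⊕ (law s c z) (law s′ c′ z′) V = trans
    (cong₂ _+_ (cong₂ _+_ (dot-⊞ s s′ (onSingle V)) (dot-⊞ c c′ (onCluster V))) (cong (_* onDead V) (num-+ z z′)))
    (solve 7 (λ a a′ b b′ z z′ v → a :+ a′ :+ (b :+ b′) :+ (z :+ z′) :* v := a :+ b :+ z :* v :+ (a′ :+ b′ :+ z′ :* v)) refl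
      (dot s (onSingle V)) (dot s′ (onSingle V)) (dot c (onCluster V)) (dot c′ (onCluster V)) (num z) (num z′) (onDead V))
    where open +-*-Solver

  eval-⊙ : ∀ k L {V} → NonNeg V → eval (k ⊙ L) V ≤ num k * eval L V
  eval-⊙ k (law s c z) {V} p = ≤-trans
    (+-mono-≤ (+-mono-≤ (dot-⊡ k s (single≥0 p)) (dot-⊡ k c (cluster≥0 p))) (*-monoˡ (dead≥0 p) (num-⊗ k z)))
    (≤-reflexive (solve 5 (λ k a b z v → k :* a :+ k :* b :+ k :* z :* v := k :* (a :+ b :+ z :* v)) refl
      (num k) (dot s (onSingle V)) (dot c (onCluster V)) (num z) (onDead V)))
    where open +-*-Solver

  eval-zero : ∀ V → eval (law [] [] 0) V ≡ 0ℚ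
  eval-zero V = trans (cong (λ q → 0ℚ + q * onDead V) num-zero) (trans (+-identityˡ _) (*-zeroˡ (onDead V)))

  eval-mix : ∀ xs L {V} → NonNeg V → eval (mix xs L) V ≤ dot xs (λ k → eval (L k) V)
  eval-mix []       L {V} p = ≤-reflexive (eval-zero V)
  eval-mix (x ∷ xs) L {V} p = ≤-trans (≤-reflexive (eval-⊕ (x ⊙ L 0) (mix xs (L ∘ suc)) V)) (+-mono-≤ (eval-⊙ x (L 0) p) (eval-mix xs (L ∘ suc) p))

  module Round (foldRate cutRate A : ℕ) (L : Law) where

    r r̄ ρ ρ̄ : ℕ
    r = foldRate
    r̄ = one ∸ foldRate
    ρ = cutRate
    ρ̄ = one ∸ cutRate

    s₀ s₁ c₀ : ℕ
    s₀ = nth (singles L) 0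
    s₁ = nth (singles L) 1
    c₀ = nth (clusters L) 0

    s₊ s₂₊ c₊ : List ℕ
    s₊  = drop 1 (singles L)
    s₂₊ = drop 2 (singles L)
    c₊  = drop 1 (clusters L)

    -- `still`, `dropped` and `killed` bound the chances that a limb is quiet, vanishes or kills in
    -- this round. `others` belongs to states of the far neighbour with which a fold cannot merge,
    -- so `r ⊗ s₁ ⊗ others` is the part of `killed` due to folding. Entry `k` of `fused` belongs to
    -- a fusion that hands over `k + 1` limbs.
    others dropped killed still cut-mass : ℕ
    others   = s₀ ℕ.+ mass A (clusters L) ℕ.+ deads L
    cut-mass = A ⊗ (A ⊗ mass A s₂₊)
    dropped  = deads L ℕ.+ ρ ⊗ cut-mass
    killed   = s₀ ℕ.+ c₀ ℕ.+ r ⊗ s₁ ⊗ others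
    still    = r̄ ⊗ s₁ ⊗ A ℕ.+ ρ̄ ⊗ cut-mass ℕ.+ A ⊗ mass A c₊

    fused : List ℕ
    fused = r ⊗ s₁ ⊡ s₊

    lost : ℕ
    lost = killed ℕ.+ A ⊗ mass A fused

    -- Adds one limb to `k` others. The cluster dies if the others have killed it and this limb is
    -- calm, or if this limb acts, whatever the others do: their mass is then `pow A k`.
    extendCluster : ℕ → Law → Law
    extendCluster k (law _ c z) = law [] ((0 ∷ c) ⊞ dropped ⊡ c) ((still ℕ.+ dropped) ⊗ z ℕ.+ lost ⊗ pow A k)

    clusterLaw : ℕ → Law
    clusterLaw zero    = law [] (one ∷ []) 0
    clusterLaw (suc k) = extendCluster k (clusterLaw k)

    -- A fusion succeeds when the limbs handed over leave a cluster and the own limbs leave an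
    -- unmerged vertex; the numbers of limbs add, hence the convolution. `fuseDead` collects the
    -- remaining outcomes, with `still` as the mass of each limb already carried into the next
    -- round.
    fuseClusters : List ℕ → (ℕ → Law) → List ℕ → List ℕ
    fuseClusters []       F s = []
    fuseClusters (x ∷ xs) F s = x ⊡ conv (clusters (F 0)) s ⊞ fuseClusters xs (F ∘ suc) s

    fuseDead : List ℕ → (ℕ → Law) → ℕ → ℕ → ℕ
    fuseDead []       F q k = 0
    fuseDead (x ∷ xs) F q k = x ⊗ (mass still (clusters (F 0)) ⊗ q ℕ.+ deads (F 0) ⊗ pow A k) ℕ.+ fuseDead xs (F ∘ suc) q k

    extendSingle : ℕ → Law → Law
    extendSingle k (law s c z) = law
      ((0 ∷ s) ⊞ dropped ⊡ s)
      ((0 ∷ c) ⊞ dropped ⊡ c ⊞ fuseClusters fused (clusterLaw ∘ suc) s)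
      ((still ℕ.+ dropped) ⊗ z ℕ.+ killed ⊗ pow A k ℕ.+ fuseDead fused (clusterLaw ∘ suc) (mass still c ℕ.+ z) k)

    singleLaw : ℕ → Law
    singleLaw zero    = law (one ∷ []) [] 0
    -- Each step reads the letter of one more limb, so `singleLaw k` is the law of an initially
    -- unmerged vertex after the letters of `k` limbs.
    singleLaw (suc k) = extendSingle k (singleLaw k)

    nextLaw : Law
    nextLaw = r̄ ⊗ s₁ ⊙ singleLaw 1 ⊕ ρ̄ ⊙ mix s₂₊ (λ k → singleLaw (2 ℕ.+ k)) ⊕ mix c₊ (λ k → clusterLaw (1 ℕ.+ k))

    -- `γ̂` is the chance that a neighbour is dead or belongs to a cluster with live limbs: it
    -- cannot be merged by a fold of the root, yet it does no harm to the root in this round.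
    calms γ̂ : ℕ
    calms = still ℕ.+ dropped
    γ̂     = A ⊗ mass A c₊ ℕ.+ deads L

    quiets : List ℕ
    quiets = r̄ ⊗ s₁ ∷ ρ̄ ⊡ s₂₊

    foldLaw : Law
    foldLaw = mix (conv quiets quiets) (λ k → clusterLaw (2 ℕ.+ k))

    duelWins : ℕ
    duelWins = γ̂ ⊗ (A ⊗ mass A quiets ℕ.+ calms)

    nextRoot : RootLaw → RootLaw
    nextRoot (rootLaw s c f w) = rootLaw (singles stay) (clusters stay) (clusters fall)
        (w ℕ.+ (nth s 0 ℕ.+ nth c 0 ℕ.+ (nth s 1 ℕ.+ nth c 1) ⊗ calms ℕ.+ r ⊗ nth s 2 ⊗ duelWins ℕ.+ deads fall))
      where
      stay fall : Law
      stay = r̄ ⊗ nth s 2 ⊙ singleLaw 2 ⊕ ρ̄ ⊙ mix (drop 3 s) (λ k → singleLaw (3 ℕ.+ k)) ⊕ mix (drop 2 c) (λ k → clusterLaw (2 ℕ.+ k))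
      fall = r ⊗ nth s 2 ⊙ foldLaw ⊕ mix (drop 2 f) (λ k → clusterLaw (2 ℕ.+ k))

-- Soundness of the recursion

live : State → ℚ → ℚ
live gone q = 0ℚ
live _    q = q

live-mono : ∀ x {p q} → p ≤ q → live x p ≤ live x q
live-mono (single _)  le = le
live-mono (cluster _) le = le
live-mono dead        le = le
live-mono gone        le = ≤-refl

live-add : ∀ x p q → live x (p + q) ≡ live x p + live x q
live-add (single _)  p q = refl
live-add (cluster _) p q = refl
live-add dead        p q = refl
live-add gone        p q = refl

live-scale : ∀ x k q → live x (k * q) ≡ k * live x q
live-scale (single _)  k q = refl
live-scale (cluster _) k q = refl
live-scale dead        k q = refl
live-scale gone        k q = sym (*-zeroʳ k)

live-≤ : ∀ x {q} → 0ℚ ≤ q → live x q ≤ q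
live-≤ (single _)  0≤q = ≤-refl
live-≤ (cluster _) 0≤q = ≤-refl
live-≤ dead        0≤q = ≤-refl
live-≤ gone        0≤q = 0≤q

live-≥0 : ∀ x {q} → 0ℚ ≤ q → 0ℚ ≤ live x q
live-≥0 (single _)  0≤q = 0≤q
live-≥0 (cluster _) 0≤q = 0≤q
live-≥0 dead        0≤q = 0≤q
live-≥0 gone        0≤q = ≤-refl

out : ℚ → (Letter → ℚ) → Letter → ℚ
out q φ quiet = q
out q φ m     = φ m

loud : (Letter → ℚ) → Letter → ℚ
loud = out 0ℚ

loud-≥0 : ∀ {φ} → (∀ m → 0ℚ ≤ φ m) → ∀ m → 0ℚ ≤ loud φ m
loud-≥0 φ≥0 quiet    = ≤-refl
loud-≥0 φ≥0 vanish   = φ≥0 vanish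
loud-≥0 φ≥0 kill     = φ≥0 kill
loud-≥0 φ≥0 (fuse _) = φ≥0 (fuse _)

loud-offer : ∀ φ x → loud φ (offer x) ≡ φ (offer x)
loud-offer φ (single [])      = refl
loud-offer φ (single (_ ∷ _)) = refl
loud-offer φ (cluster _)      = refl
loud-offer φ dead             = refl
loud-offer φ gone             = refl

-- A limb contributes either through its next state or through its letter, never through both: after
-- any action `next` is `gone`, and `loud` vanishes at `quiet`.
live-split : ∀ f m x {q φ} → 0ℚ ≤ q → live (next f m x) q + live x (loud φ m) ≤ live x (out q φ m)
live-split f quiet (single ls) {q} 0≤q  = ≤-trans (+-mono-≤ (live-≤ (singleOf f ls) 0≤q) ≤-refl) (≤-reflexive (+-identityʳ q))
live-split f quiet (cluster ls) {q} 0≤q = ≤-trans (+-mono-≤ (live-≤ (clusterOf f ls) 0≤q) ≤-refl) (≤-reflexive (+-identityʳ q))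
live-split f quiet dead 0≤q             = ≤-trans (≤-reflexive (+-identityˡ 0ℚ)) 0≤q
live-split f quiet gone 0≤q             = ≤-reflexive (+-identityˡ 0ℚ)
live-split f vanish x 0≤q               = ≤-reflexive (+-identityˡ _)
live-split f kill x 0≤q                 = ≤-reflexive (+-identityˡ _)
live-split f (fuse ps) x 0≤q            = ≤-reflexive (+-identityˡ _)

keep-alive : ∀ p r {q} → live r q ≡ q → live (keep p r) q ≡ q
keep-alive p (single _)  e = refl
keep-alive p (cluster _) e = refl
keep-alive p dead        e = refl
keep-alive p gone        e = e

attach-alive : ∀ a b {q} → live (attach a b) q ≡ q
attach-alive (cluster _) (single _)  = refl
attach-alive (cluster _) (cluster _) = refl
attach-alive (cluster _) dead        = refl
attach-alive (cluster _) gone        = refl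
attach-alive (single _)  b           = refl
attach-alive dead        b           = refl
attach-alive gone        b           = refl

clusterOf-alive : ∀ m ls {q} → live (clusterOf m ls) q ≡ q
clusterOf-alive m []       = refl
clusterOf-alive m (p ∷ ls) with m p
... | quiet  = keep-alive p (clusterOf m ls) (clusterOf-alive m ls)
... | vanish = clusterOf-alive m ls
... | kill   = refl
... | fuse _ = refl

singleOf-alive : ∀ m ls {q} → live (singleOf m ls) q ≡ q
singleOf-alive m []       = refl
singleOf-alive m (p ∷ ls) with m p
... | quiet   = keep-alive p (singleOf m ls) (singleOf-alive m ls)
... | vanish  = singleOf-alive m ls
... | kill    = refl
... | fuse ps = attach-alive (clusterOf m ps) (singleOf m ls)

module Rounds (one : ℕ) .{{_ : NonZero one}} (foldRate cutRate : ℕ → ℕ)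
              (valid : ∀ t → foldRate t ℕ.+ cutRate t ℕ.≤ one) (H : ℕ) where

  open FixedPoint one public
  open Coefficients one public hiding (module Round)
  open Sampling one foldRate cutRate valid public
  open Horizon H public

  -- Not normalised: only limbs still live in round t count.
  μ : ℕ → ℕ → Positive Tree
  ⟨ μ t R ⟩ f = ⟨ trees R ⟩ λ T → live (X t T) (f T)
  mono (μ t R) le = mono (trees R) λ T → live-mono (X t T) (le T)
  add (μ t R) f g = trans (ext (trees R) λ T → live-add (X t T) (f T) (g T)) (add (trees R) (λ T → live (X t T) (f T)) (λ T → live (X t T) (g T)))
  scale (μ t R) k f = trans (ext (trees R) λ T → live-scale (X t T) k (f T)) (scale (trees R) k (λ T → live (X t T) (f T)))

  nest : ℕ → List ℕ → Positive (List Tree)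
  ⟨ nest t [] ⟩ f = f []
  mono (nest t []) le = le []
  add (nest t []) f g = refl
  scale (nest t []) k f = refl
  ⟨ nest t (R ∷ Rs) ⟩ f = ⟨ μ t R ⟩ λ p → ⟨ nest t Rs ⟩ λ ls → f (p ∷ ls)
  mono (nest t (R ∷ Rs)) le = mono (μ t R) λ p → mono (nest t Rs) λ ls → le (p ∷ ls)
  add (nest t (R ∷ Rs)) f g = trans (ext (μ t R) λ p → add (nest t Rs) (λ ls → f (p ∷ ls)) (λ ls → g (p ∷ ls))) (add (μ t R) _ _)
  scale (nest t (R ∷ Rs)) k f = trans (ext (μ t R) λ p → scale (nest t Rs) k (λ ls → f (p ∷ ls))) (scale (μ t R) k _)

  nest-++ : ∀ t Rs Rs′ f → ⟨ nest t (Rs ++ Rs′) ⟩ f ≡ ⟨ nest t Rs ⟩ λ ls → ⟨ nest t Rs′ ⟩ λ ms → f (ls ++ ms)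
  nest-++ t []       Rs′ f = refl
  nest-++ t (R ∷ Rs) Rs′ f = ext (μ t R) λ p → nest-++ t Rs Rs′ (λ ls → f (p ∷ ls))

  -- Conditional independence enters here: `V` has to bound `Ψ` only on average over limbs drawn
  -- independently from `μ t`, for each number of limbs, not for each individual list.
  record Fits {Γ} (C : Positive Γ) (t s : ℕ) (Ψ : Γ → State → ℚ) (V : Values) : Set where
    constructor fits
    field
      fit-single  : ∀ Rs → All (s ℕ.≤_) Rs → onSingle V (length Rs) ≤ ⟨ C ⊠ nest t Rs ⟩ λ (γ , ls) → Ψ γ (single ls)
      fit-cluster : ∀ Rs → All (s ℕ.≤_) Rs → onCluster V (length Rs) ≤ ⟨ C ⊠ nest t Rs ⟩ λ (γ , ls) → Ψ γ (cluster ls)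
      fit-dead    : onDead V ≤ ⟨ C ⟩ λ γ → Ψ γ dead

  open Fits public

  -- The context C lets the claim be applied underneath expectations over other limbs,
  -- and the depth bound D s only has to leave depth s for the limbs stored in the state.
  Claim : ℕ → (ℕ → ℕ) → Law → Set₁
  Claim t D L = ∀ {Γ} (C : Positive Γ) s Ψ V → NonNeg V → (∀ γ x → 0ℚ ≤ Ψ γ x) → Fits C t s Ψ V →
                ∀ R → D s ℕ.≤ R → eval L V ≤ ⟨ C ⊠ μ t R ⟩ λ (γ , T) → Ψ γ (X t T)

  ≤-coin : ∀ t {f} → (∀ c → 0ℚ ≤ f c) →
           (num (foldRate t) * f fold ≤ ⟨ coin t ⟩ f) × (num (cutRate t) * f cut ≤ ⟨ coin t ⟩ f)
  ≤-coin t {f} f≥0 = subst (λ q → (num (foldRate t) * f fold ≤ q) × (num (cutRate t) * f cut ≤ q)) (sym (coin-split t f))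
    ( ≤-trans (p≤p+q (w cut {cutRate t})) (q≤p+q (w idle {idleRate t}))
    , ≤-trans (q≤p+q (w fold {foldRate t})) (q≤p+q (w idle {idleRate t})) )
    where
    w : ∀ c {n} → 0ℚ ≤ num n * f c
    w c {n} = 0≤* (0≤num n) (f≥0 c)

  ≤-coin-not-fold : ∀ t {f q} → 0ℚ ≤ q → (∀ c → 0ℚ ≤ f c) → q ≤ f idle → q ≤ f cut → num (one ∸ foldRate t) * q ≤ ⟨ coin t ⟩ f
  ≤-coin-not-fold t {f} {q} 0≤q f≥0 i c = begin
    num (one ∸ foldRate t) * q                          ≤⟨ *-monoˡ 0≤q (num-mono le) ⟩
    num (idleRate t ℕ.+ cutRate t) * q                  ≡⟨ cong (_* q) (num-+ (idleRate t) (cutRate t)) ⟩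
    (num (idleRate t) + num (cutRate t)) * q            ≡⟨ solve 3 (λ a b q → (a :+ b) :* q := a :* q :+ (con 0ℚ :+ b :* q)) refl (num (idleRate t)) (num (cutRate t)) q ⟩
    num (idleRate t) * q + (0ℚ + num (cutRate t) * q)   ≤⟨ +-mono-≤ (*-monoʳ (0≤num _) i) (+-mono-≤ (0≤* (0≤num _) (f≥0 fold)) (*-monoʳ (0≤num _) c)) ⟩
    num (idleRate t) * f idle + (num (foldRate t) * f fold + num (cutRate t) * f cut) ≡⟨ sym (coin-split t f) ⟩
    ⟨ coin t ⟩ f ∎
    where
    open ≤-Reasoning
    open +-*-Solver
    le : one ∸ foldRate t ℕ.≤ idleRate t ℕ.+ cutRate t
    le = ℕ.≤-trans (ℕ.m≤n+m∸n _ (cutRate t))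
      (ℕ.≤-reflexive (trans (cong (cutRate t ℕ.+_) (ℕ.∸-+-assoc one (foldRate t) (cutRate t))) (ℕ.+-comm (cutRate t) (idleRate t))))

  ≤-coin-not-cut : ∀ t {f q} → 0ℚ ≤ q → (∀ c → 0ℚ ≤ f c) → q ≤ f idle → q ≤ f fold → num (one ∸ cutRate t) * q ≤ ⟨ coin t ⟩ f
  ≤-coin-not-cut t {f} {q} 0≤q f≥0 i c = begin
    num (one ∸ cutRate t) * q                           ≤⟨ *-monoˡ 0≤q (num-mono le) ⟩
    num (idleRate t ℕ.+ foldRate t) * q                 ≡⟨ cong (_* q) (num-+ (idleRate t) (foldRate t)) ⟩
    (num (idleRate t) + num (foldRate t)) * q           ≡⟨ solve 3 (λ a b q → (a :+ b) :* q := a :* q :+ (b :* q :+ con 0ℚ)) refl (num (idleRate t)) (num (foldRate t)) q ⟩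
    num (idleRate t) * q + (num (foldRate t) * q + 0ℚ)  ≤⟨ +-mono-≤ (*-monoʳ (0≤num _) i) (+-mono-≤ (*-monoʳ (0≤num _) c) (0≤* (0≤num _) (f≥0 cut))) ⟩
    num (idleRate t) * f idle + (num (foldRate t) * f fold + num (cutRate t) * f cut) ≡⟨ sym (coin-split t f) ⟩
    ⟨ coin t ⟩ f ∎
    where
    open ≤-Reasoning
    open +-*-Solver
    le : one ∸ cutRate t ℕ.≤ idleRate t ℕ.+ foldRate t
    le = ℕ.≤-trans (ℕ.m≤n+m∸n _ (foldRate t))
      (ℕ.≤-reflexive (trans (cong (foldRate t ℕ.+_) (trans (ℕ.∸-+-assoc one (cutRate t) (foldRate t)) (cong (one ∸_) (ℕ.+-comm (cutRate t) (foldRate t))))) (ℕ.+-comm (foldRate t) (idleRate t))))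

  live-coin : ∀ t x f → live x (⟨ coin t ⟩ f) ≡ ⟨ coin t ⟩ (λ c → live x (f c))
  live-coin t (single _)  f = refl
  live-coin t (cluster _) f = refl
  live-coin t dead        f = refl
  live-coin t gone        f = sym (null (coin t))

  -- The state at time `t` reads earlier coins of the top vertex only (`X-label`), so its current
  -- coin may be redrawn. `R` is at least one because a tree of depth zero has no random top label.
  fresh-coin : ∀ {t R} → t ℕ.< H → 1 ℕ.≤ R → (Ψ : State → Coin → ℚ) →
               ⟨ μ t R ⟩ (λ T → Ψ (X t T) (label T t)) ≡ ⟨ μ t R ⟩ (λ T → ⟨ coin t ⟩ (Ψ (X t T)))
  fresh-coin {t} {suc R} t<H _ Ψ = begin
    ⟨ labels 0 H ⟩ (λ ℓ → h ℓ (ℓ t))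
      ≡⟨ resample 0 H t<H refl h (λ ℓ ℓ′ agree c → ext (trees R) λ L → ext (trees R) λ M →
           cong (λ x → live x (Ψ x c)) (X-label t agree)) ⟩
    ⟨ labels 0 H ⟩ (λ ℓ → ⟨ coin t ⟩ (h ℓ))
      ≡⟨ ext (labels 0 H) (λ ℓ → trans
           (sym (coin-swap (trees R) t (λ L c → ⟨ trees R ⟩ (λ M → live (X t (node ℓ L M)) (Ψ (X t (node ℓ L M)) c)))))
           (ext (trees R) λ L → trans
             (sym (coin-swap (trees R) t (λ M c → live (X t (node ℓ L M)) (Ψ (X t (node ℓ L M)) c))))
             (ext (trees R) λ M → sym (live-coin t (X t (node ℓ L M)) (Ψ (X t (node ℓ L M))))))) ⟩
    ⟨ labels 0 H ⟩ (λ ℓ → ⟨ trees R ⟩ λ L → ⟨ trees R ⟩ λ M → live (X t (node ℓ L M)) (⟨ coin t ⟩ (Ψ (X t (node ℓ L M))))) ∎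
    where
    open ≡-Reasoning
    h : Label → Coin → ℚ
    h ℓ c = ⟨ trees R ⟩ λ L → ⟨ trees R ⟩ λ M → live (X t (node ℓ L M)) (Ψ (X t (node ℓ L M)) c)

-- One round in the limbs

module Steps (one : ℕ) .{{_ : NonZero one}} (foldRate cutRate : ℕ → ℕ)
              (valid : ∀ t → foldRate t ℕ.+ cutRate t ℕ.≤ one) (H : ℕ) where
  open Rounds one foldRate cutRate valid H

  MassBound : ℕ → ℕ → ℕ → Set
  MassBound t N a = ∀ R → N ℕ.≤ R → num a ≤ ⟨ μ t R ⟩ (λ _ → 1ℚ)

  nest-mass : ∀ {t N a} → MassBound t N a → ∀ Rs → All (N ℕ.≤_) Rs → pw (num a) (length Rs) ≤ ⟨ nest t Rs ⟩ (λ _ → 1ℚ)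
  nest-mass bound []       []          = ≤-refl
  nest-mass {t} {a = a} bound (R ∷ Rs) (le ∷ les) = begin
    num a * pw (num a) (length Rs)                   ≤⟨ *-mono (0≤num a) (pos (nest t Rs) (λ _ → 0≤1)) (bound R le) (nest-mass bound Rs les) ⟩
    ⟨ μ t R ⟩ (λ _ → 1ℚ) * ⟨ nest t Rs ⟩ (λ _ → 1ℚ)  ≡⟨ *-comm (⟨ μ t R ⟩ (λ _ → 1ℚ)) _ ⟩
    ⟨ nest t Rs ⟩ (λ _ → 1ℚ) * ⟨ μ t R ⟩ (λ _ → 1ℚ)  ≡⟨ sym (const (μ t R) (⟨ nest t Rs ⟩ (λ _ → 1ℚ))) ⟩
    ⟨ μ t R ⟩ (λ _ → ⟨ nest t Rs ⟩ (λ _ → 1ℚ))       ∎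
    where open ≤-Reasoning

  -- Even a quantity blind to some limbs pays for them, by one factor of mass per limb, since `μ` is
  -- not normalised.
  below-nest : ∀ {Γ} (C : Positive Γ) {t N a φ v} → MassBound t N a → (∀ γ → 0ℚ ≤ φ γ) → v ≤ ⟨ C ⟩ φ →
               ∀ Rs → All (N ℕ.≤_) Rs → pw (num a) (length Rs) * v ≤ ⟨ C ⊠ nest t Rs ⟩ λ (γ , _) → φ γ
  below-nest C {t} {N} {a} {φ} {v} bound φ≥0 v≤ Rs les = begin
    pw (num a) (length Rs) * v        ≤⟨ *-monoʳ (0≤pw (0≤num a) (length Rs)) v≤ ⟩
    pw (num a) (length Rs) * ⟨ C ⟩ φ  ≡⟨ sym (scale C (pw (num a) (length Rs)) φ) ⟩
    ⟨ C ⟩ (λ γ → pw (num a) (length Rs) * φ γ) ≤⟨ mono C (λ γ → ≤-trans (*-monoˡ (φ≥0 γ) (nest-mass bound Rs les))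
                                                    (≤-reflexive (trans (*-comm _ (φ γ)) (sym (const (nest t Rs) (φ γ)))))) ⟩
    ⟨ C ⟩ (λ γ → ⟨ nest t Rs ⟩ (λ _ → φ γ)) ∎
    where open ≤-Reasoning

  module OneRound {t} (t<H : t ℕ.< H) {A : ℕ} {L : Law} {D : ℕ → ℕ} (D≥1 : ∀ s → 1 ℕ.≤ D s) (D≥ : ∀ s → s ℕ.≤ D s)
              (D-mono : ∀ {s s′} → s ℕ.≤ s′ → D s ℕ.≤ D s′) (bound : MassBound t (D 0) A) (claim : Claim t D L) where

    open Coefficients.Round one (foldRate t) (cutRate t) A L

    α : ℚ
    α = num A

    0≤α : ∀ k → 0ℚ ≤ pw α k
    0≤α = 0≤pw (0≤num A)

    raise : ∀ {s s′ Rs} → s ℕ.≤ s′ → All (s′ ℕ.≤_) Rs → All (s ℕ.≤_) Rs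
    raise le = All.map (ℕ.≤-trans le)

    coin-≥0 : ∀ {f} → (∀ c → 0ℚ ≤ f c) → 0ℚ ≤ ⟨ coin t ⟩ f
    coin-≥0 = pos (coin t)

    claim-coin : ∀ {Γ} (C : Positive Γ) s (Ψ : Γ → State → Coin → ℚ) V → NonNeg V → (∀ γ x c → 0ℚ ≤ Ψ γ x c) →
                 Fits C t s (λ γ x → ⟨ coin t ⟩ (Ψ γ x)) V → ∀ R → D s ℕ.≤ R →
                 eval L V ≤ ⟨ C ⊠ μ t R ⟩ λ (γ , T) → Ψ γ (X t T) (label T t)
    claim-coin C s Ψ V V≥0 Ψ≥0 f R le = ≤-trans
      (claim C s (λ γ x → ⟨ coin t ⟩ (Ψ γ x)) V V≥0 (λ γ x → coin-≥0 (Ψ≥0 γ x)) f R le)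
      (≤-reflexive (ext C λ γ → sym (fresh-coin t<H (ℕ.≤-trans (D≥1 s) le) (Ψ γ))))

    eval-split : ∀ V → eval L V ≡
      num s₀ * onSingle V 0 + (num s₁ * onSingle V 1 + dot s₂₊ (λ k → onSingle V (2 ℕ.+ k))) +
      (num c₀ * onCluster V 0 + dot c₊ (λ k → onCluster V (1 ℕ.+ k))) + num (deads L) * onDead V
    eval-split V = cong (_+ num (deads L) * onDead V) (cong₂ _+_ (dot-split₂ (singles L) (onSingle V)) (dot-split (clusters L) (onCluster V)))

    nest-power : ∀ {xs} (V : ℚ) → 0ℚ ≤ V → num (A ⊗ (A ⊗ mass A xs)) * V ≤ dot xs (λ k → pw α (2 ℕ.+ k) * V)
    nest-power {xs} V 0≤V = begin
      num (A ⊗ (A ⊗ mass A xs)) * V           ≤⟨ *-monoˡ 0≤V (⊗-* {A} {A ⊗ mass A xs} ≤-refl (⊗-* {A} {mass A xs} ≤-refl (dot-mass xs ≤-refl))) ⟩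
      α * (α * dot xs (pw α)) * V             ≡⟨ cong (_* V) (trans (cong (α *_) (sym (dot-scale xs α (pw α)))) (sym (dot-scale xs α (λ k → α * pw α k)))) ⟩
      dot xs (λ k → pw α (2 ℕ.+ k)) * V       ≡⟨ trans (*-comm _ V) (sym (dot-scale xs V _)) ⟩
      dot xs (λ k → V * pw α (2 ℕ.+ k))       ≡⟨ dot-ext xs (λ k → *-comm V _) ⟩
      dot xs (λ k → pw α (2 ℕ.+ k) * V)       ∎
      where open ≤-Reasoning

    mass-≤ : ∀ xs V → 0ℚ ≤ V → num (mass A xs) * V ≤ dot xs (λ k → pw α k * V)
    mass-≤ xs V 0≤V = ≤-trans (*-monoˡ 0≤V (dot-mass xs ≤-refl))
      (≤-reflexive (trans (*-comm _ V) (trans (sym (dot-scale xs V _)) (dot-ext xs (λ k → *-comm V _)))))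

    module _ {Γ} (C : Positive Γ) (g : Γ → Tree → ℚ) (Φ : Γ → Letter → ℚ) (g≥0 : ∀ γ p → 0ℚ ≤ g γ p) (Φ≥0 : ∀ γ l → 0ℚ ≤ Φ γ l)
             {s} (D0≤s : D 0 ℕ.≤ s) {bV bK : ℚ} {bF : ℕ → ℚ} (bV≥0 : 0ℚ ≤ bV) (bK≥0 : 0ℚ ≤ bK) (bF≥0 : ∀ k → 0ℚ ≤ bF k)
             (hV : bV ≤ ⟨ C ⟩ λ γ → Φ γ vanish) (hK : bK ≤ ⟨ C ⟩ λ γ → Φ γ kill)
             (hF : ∀ R Rs → All (s ℕ.≤_) (R ∷ Rs) → bF (length Rs) ≤ ⟨ C ⊠ nest t (R ∷ Rs) ⟩ λ (γ , ps) → Φ γ (fuse ps)) where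

      private
        V₁ : Values
        V₁ = values (λ { zero → bK ; (suc k) → bF k }) (λ k → pw α k * bK) bK

        V₁≥0 : NonNeg V₁
        V₁≥0 = nonNeg (λ { zero → bK≥0 ; (suc k) → bF≥0 k }) (λ k → 0≤* (0≤α k) bK≥0) bK≥0

        offers : ∀ R → D s ℕ.≤ R → eval L V₁ ≤ ⟨ C ⊠ μ t R ⟩ λ (γ , T) → Φ γ (offer (X t T))
        offers = claim C s (λ γ x → Φ γ (offer x)) V₁ V₁≥0 (λ γ x → Φ≥0 γ (offer x))
          (fits (λ { [] _ → hK ; (R ∷ Rs) les → ≤-trans (hF R Rs les) (mono C λ γ → mono (μ t R) λ p → mono (nest t Rs) λ ls → ≤-refl) })
                (λ Rs les → below-nest C {t = t} bound (λ γ → Φ≥0 γ kill) hK Rs (raise D0≤s les))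
                hK)

        V : Values
        -- With one limb the vertex folds at rate `r` and passes on what the top of that limb
        -- offers, whose expectation is bounded by the claim applied to that limb. With more limbs
        -- it can only be cut.
        V = values (λ { 0 → bK ; 1 → num r * eval L V₁ ; (suc (suc k)) → num ρ * (pw α (2 ℕ.+ k) * bV) })
                   (λ { 0 → bK ; (suc k) → 0ℚ }) bV

        V≥0 : NonNeg V
        V≥0 = nonNeg (λ { 0 → bK≥0 ; 1 → 0≤* (0≤num r) (eval-≥0 L V₁≥0) ; (suc (suc k)) → 0≤* (0≤num ρ) (0≤* (0≤α (2 ℕ.+ k)) bV≥0) })
                     (λ { 0 → bK≥0 ; (suc k) → ≤-refl }) bV≥0

        Ψ : Γ → State → Coin → ℚ
        Ψ γ x c = loud (Φ γ) (act (X t) x c)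

        Ψ≥0 : ∀ γ x c → 0ℚ ≤ Ψ γ x c
        Ψ≥0 γ x c = loud-≥0 (Φ≥0 γ) (act (X t) x c)

        fit : Fits C t (D s) (λ γ x → ⟨ coin t ⟩ (Ψ γ x)) V
        fit-single fit [] _ = ≤-trans hK (≤-reflexive (ext C λ γ → sym (const₁ (coin t) (coin-normalised t) (Φ γ kill))))
        fit-single fit (R ∷ []) (le ∷ []) = begin
          num r * eval L V₁                                                  ≤⟨ *-monoʳ (0≤num r) (offers R le) ⟩
          num r * ⟨ C ⊠ μ t R ⟩ (λ (γ , T) → Φ γ (offer (X t T)))            ≡⟨ sym (scale (C ⊠ μ t R) (num r) (λ (γ , T) → Φ γ (offer (X t T)))) ⟩
          ⟨ C ⊠ μ t R ⟩ (λ (γ , T) → num r * Φ γ (offer (X t T)))            ≤⟨ mono (C ⊠ μ t R) (λ (γ , T) → ≤-trans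
                                                                                 (≤-reflexive (cong (num r *_) (sym (loud-offer (Φ γ) (X t T)))))
                                                                                 (proj₁ (≤-coin t (Ψ≥0 γ (single (T ∷ [])))))) ⟩
          ⟨ C ⊠ μ t R ⟩ (λ (γ , T) → ⟨ coin t ⟩ (Ψ γ (single (T ∷ []))))     ∎
          where open ≤-Reasoning
        fit-single fit Rs@(R ∷ R′ ∷ Rs′) les = begin
          num ρ * (pw α (length Rs) * bV)                                    ≤⟨ *-monoʳ (0≤num ρ) (below-nest C {t = t} bound (λ γ → Φ≥0 γ vanish) hV Rs (raise (ℕ.≤-trans D0≤s (D≥ s)) les)) ⟩
          num ρ * ⟨ C ⊠ nest t Rs ⟩ (λ (γ , _) → Φ γ vanish)                 ≡⟨ sym (scale (C ⊠ nest t Rs) (num ρ) (λ (γ , _) → Φ γ vanish)) ⟩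
          ⟨ C ⊠ nest t Rs ⟩ (λ (γ , _) → num ρ * Φ γ vanish)                 ≤⟨ mono C (λ γ → mono (μ t R) λ p → mono (μ t R′) λ p′ → mono (nest t Rs′) λ ls →
                                                                                 proj₂ (≤-coin t (Ψ≥0 γ (single (p ∷ p′ ∷ ls))))) ⟩
          ⟨ C ⊠ nest t Rs ⟩ (λ (γ , ls) → ⟨ coin t ⟩ (Ψ γ (single ls)))      ∎
          where open ≤-Reasoning
        fit-cluster fit [] _ = ≤-trans hK (≤-reflexive (ext C λ γ → sym (const₁ (coin t) (coin-normalised t) (Φ γ kill))))
        fit-cluster fit (R ∷ Rs) _ = pos (C ⊠ nest t (R ∷ Rs)) (λ (γ , ls) → coin-≥0 (Ψ≥0 γ (cluster ls)))
        fit-dead fit = ≤-trans hV (≤-reflexive (ext C λ γ → sym (const₁ (coin t) (coin-normalised t) (Φ γ vanish))))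

        numeric : num dropped * bV + num killed * bK + dot fused bF ≤ eval L V
        numeric = begin
          num dropped * bV + num killed * bK + dot fused bF
            ≤⟨ +-mono-≤ (+-mono-≤ drops kills) (dot-⊡ (r ⊗ s₁) s₊ bF≥0) ⟩
          num z * bV + dot s₂₊ P + (num s₀ * bK + num c₀ * bK + q * (num others * bK)) + q * dot s₊ bF
            ≤⟨ +-mono-≤ (+-monoʳ-≤ (num z * bV + dot s₂₊ P) (+-monoʳ-≤ (num s₀ * bK + num c₀ * bK) (*-monoʳ (0≤num (r ⊗ s₁)) rest))) ≤-refl ⟩
          num z * bV + dot s₂₊ P + (num s₀ * bK + num c₀ * bK + q * (num s₀ * bK + dot (clusters L) (onCluster V₁) + num z * bK)) + q * dot s₊ bF
            ≡⟨ solve 8 (λ v p s c q d e k → v :+ p :+ (s :+ c :+ q :* (s :+ d :+ k)) :+ q :* e := s :+ (q :* (s :+ e :+ d :+ k) :+ p) :+ c :+ v) refl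
                 (num z * bV) (dot s₂₊ P) (num s₀ * bK) (num c₀ * bK) q (dot (clusters L) (onCluster V₁)) (dot s₊ bF) (num z * bK) ⟩
          num s₀ * bK + (q * (num s₀ * bK + dot s₊ bF + dot (clusters L) (onCluster V₁) + num z * bK) + dot s₂₊ P) + num c₀ * bK + num z * bV
            ≡⟨ cong (λ e → num s₀ * bK + (q * (e + dot (clusters L) (onCluster V₁) + num z * bK) + dot s₂₊ P) + num c₀ * bK + num z * bV)
                 (sym (dot-split (singles L) (onSingle V₁))) ⟩
          num s₀ * bK + (q * eval L V₁ + dot s₂₊ P) + num c₀ * bK + num z * bV
            ≤⟨ +-monoˡ-≤ (num z * bV) (+-mono-≤ (+-monoʳ-≤ (num s₀ * bK) (+-monoˡ-≤ (dot s₂₊ P) q≤)) (p≤p+q (dot-≥0 c₊ (λ _ → ≤-refl)))) ⟩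
          num s₀ * bK + (num s₁ * (num r * eval L V₁) + dot s₂₊ P) + (num c₀ * bK + dot c₊ (λ _ → 0ℚ)) + num z * bV
            ≡⟨ sym (eval-split V) ⟩
          eval L V ∎
          where
          open ≤-Reasoning
          open +-*-Solver
          z = deads L
          q = num (r ⊗ s₁)
          P : ℕ → ℚ
          P k = num ρ * (pw α (2 ℕ.+ k) * bV)
          q≤ : q * eval L V₁ ≤ num s₁ * (num r * eval L V₁)
          q≤ = ≤-trans (*-monoˡ (eval-≥0 L V₁≥0) (num-⊗ r s₁))
            (≤-reflexive (solve 3 (λ r s e → r :* s :* e := s :* (r :* e)) refl (num r) (num s₁) (eval L V₁)))
          rest : num others * bK ≤ num s₀ * bK + dot (clusters L) (onCluster V₁) + num z * bK
          rest = begin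
            num others * bK ≡⟨ cong (_* bK) (trans (num-+ (s₀ ℕ.+ mass A (clusters L)) z) (cong (_+ num z) (num-+ s₀ (mass A (clusters L))))) ⟩
            (num s₀ + num (mass A (clusters L)) + num z) * bK
              ≡⟨ solve 4 (λ a b c k → (a :+ b :+ c) :* k := a :* k :+ b :* k :+ c :* k) refl (num s₀) (num (mass A (clusters L))) (num z) bK ⟩
            num s₀ * bK + num (mass A (clusters L)) * bK + num z * bK
              ≤⟨ +-monoˡ-≤ (num z * bK) (+-monoʳ-≤ (num s₀ * bK) (mass-≤ (clusters L) bK bK≥0)) ⟩
            num s₀ * bK + dot (clusters L) (onCluster V₁) + num z * bK ∎
          drops : num dropped * bV ≤ num z * bV + dot s₂₊ P
          drops = begin
            num dropped * bV ≡⟨ cong (_* bV) (num-+ z (ρ ⊗ cut-mass)) ⟩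
            (num z + num (ρ ⊗ cut-mass)) * bV ≡⟨ *-distribʳ-+ bV (num z) (num (ρ ⊗ cut-mass)) ⟩
            num z * bV + num (ρ ⊗ cut-mass) * bV ≤⟨ +-monoʳ-≤ (num z * bV) (*-monoˡ bV≥0 (num-⊗ ρ cut-mass)) ⟩
            num z * bV + num ρ * num cut-mass * bV ≡⟨ cong (num z * bV +_) (*-assoc (num ρ) (num cut-mass) bV) ⟩
            num z * bV + num ρ * (num cut-mass * bV) ≤⟨ +-monoʳ-≤ (num z * bV) (*-monoʳ (0≤num ρ) (nest-power {s₂₊} bV bV≥0)) ⟩
            num z * bV + num ρ * dot s₂₊ (λ k → pw α (2 ℕ.+ k) * bV) ≡⟨ cong (num z * bV +_) (sym (dot-scale s₂₊ (num ρ) (λ k → pw α (2 ℕ.+ k) * bV))) ⟩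
            num z * bV + dot s₂₊ P ∎
          kills : num killed * bK ≤ num s₀ * bK + num c₀ * bK + q * (num others * bK)
          kills = begin
            num killed * bK ≡⟨ cong (_* bK) (trans (num-+ (s₀ ℕ.+ c₀) (r ⊗ s₁ ⊗ others)) (cong (_+ num (r ⊗ s₁ ⊗ others)) (num-+ s₀ c₀))) ⟩
            (num s₀ + num c₀ + num (r ⊗ s₁ ⊗ others)) * bK ≤⟨ *-monoˡ bK≥0 (+-monoʳ-≤ (num s₀ + num c₀) (num-⊗ (r ⊗ s₁) others)) ⟩
            (num s₀ + num c₀ + q * num others) * bK
              ≡⟨ solve 5 (λ a b q o k → (a :+ b :+ q :* o) :* k := a :* k :+ b :* k :+ q :* (o :* k)) refl (num s₀) (num c₀) q (num others) bK ⟩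
            num s₀ * bK + num c₀ * bK + q * (num others * bK) ∎

      -- Splits the expectation over one limb by its letter. A quiet limb is read again as a limb
      -- live in the next round; `bV`, `bK` and `bF` bound the values after the other letters. The
      -- double depth pays for two uses of the claim: at the top of the limb and, if that vertex
      -- folds, at the neighbour behind it.
      letters : ∀ R → D (D s) ℕ.≤ R →
                ⟨ C ⊠ μ (suc t) R ⟩ (λ (γ , p) → g γ p) + (num dropped * bV + num killed * bK + dot fused bF) ≤
                ⟨ C ⊠ μ t R ⟩ λ (γ , p) → out (g γ p) (Φ γ) (letter t p)
      letters R le = begin
        ⟨ C ⊠ μ (suc t) R ⟩ (λ (γ , p) → g γ p) + (num dropped * bV + num killed * bK + dot fused bF)
          ≤⟨ +-monoʳ-≤ (⟨ C ⊠ μ (suc t) R ⟩ (λ (γ , p) → g γ p)) (≤-trans numeric (claim-coin C (D s) Ψ V V≥0 Ψ≥0 fit R le)) ⟩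
        ⟨ C ⊠ trees R ⟩ (λ (γ , p) → live (X (suc t) p) (g γ p)) + ⟨ C ⊠ trees R ⟩ (λ (γ , p) → live (X t p) (loud (Φ γ) (letter t p)))
          ≡⟨ sym (add (C ⊠ trees R) (λ (γ , p) → live (X (suc t) p) (g γ p)) (λ (γ , p) → live (X t p) (loud (Φ γ) (letter t p)))) ⟩
        ⟨ C ⊠ trees R ⟩ (λ (γ , p) → live (X (suc t) p) (g γ p) + live (X t p) (loud (Φ γ) (letter t p)))
          ≤⟨ mono (C ⊠ trees R) (λ (γ , p) → live-split (letter t) (letter t p) (X t p) (g≥0 γ p)) ⟩
        ⟨ C ⊠ trees R ⟩ (λ (γ , p) → live (X t p) (out (g γ p) (Φ γ) (letter t p))) ∎
        where open ≤-Reasoning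

    m : Tree → Letter
    m = letter t

    -- A vertex that acts leaves `μ (suc t)`, so those states receive the value zero. What remains
    -- are one-limb vertices that do not fold, larger ones that are not cut, and clusters with a
    -- limb; `vS` and `vC` bound the value after their limbs' letters have been read.
    advance : ∀ {Γ} (C : Positive Γ) (Ψ : Γ → State → ℚ) (Ψ≥0 : ∀ γ x → 0ℚ ≤ Ψ γ x) s {vS vC : ℕ → ℚ} →
              (∀ k → 0ℚ ≤ vS k) → (∀ k → 0ℚ ≤ vC k) →
              (∀ Rs → All (s ℕ.≤_) Rs → vS (length Rs) ≤ ⟨ C ⊠ nest t Rs ⟩ λ (γ , ls) → Ψ γ (singleOf m ls)) →
              (∀ Rs → All (s ℕ.≤_) Rs → vC (length Rs) ≤ ⟨ C ⊠ nest t Rs ⟩ λ (γ , ls) → Ψ γ (clusterOf m ls)) →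
              ∀ R → D s ℕ.≤ R →
              num s₁ * (num r̄ * vS 1) + num ρ̄ * dot s₂₊ (λ k → vS (2 ℕ.+ k)) + dot c₊ (λ k → vC (1 ℕ.+ k)) ≤
              ⟨ C ⊠ μ (suc t) R ⟩ λ (γ , T) → Ψ γ (X (suc t) T)
    advance {Γ} C Ψ Ψ≥0 s {vS} {vC} vS≥0 vC≥0 hS hC R le = begin
      num s₁ * (num r̄ * vS 1) + num ρ̄ * dot s₂₊ (λ k → vS (2 ℕ.+ k)) + dot c₊ (λ k → vC (1 ℕ.+ k))
        ≡⟨ cong (λ e → num s₁ * (num r̄ * vS 1) + e + dot c₊ (λ k → vC (1 ℕ.+ k))) (sym (dot-scale s₂₊ (num ρ̄) (λ k → vS (2 ℕ.+ k)))) ⟩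
      num s₁ * (num r̄ * vS 1) + dot s₂₊ (λ k → num ρ̄ * vS (2 ℕ.+ k)) + dot c₊ (λ k → vC (1 ℕ.+ k))
        ≡⟨ solve 6 (λ a b c s z d → a :+ b :+ c := s :* con 0ℚ :+ (a :+ b) :+ (d :* con 0ℚ :+ c) :+ z :* con 0ℚ) refl
             (num s₁ * (num r̄ * vS 1)) (dot s₂₊ (λ k → num ρ̄ * vS (2 ℕ.+ k))) (dot c₊ (λ k → vC (1 ℕ.+ k))) (num s₀) (num (deads L)) (num c₀) ⟩
      num s₀ * 0ℚ + (num s₁ * (num r̄ * vS 1) + dot s₂₊ (λ k → num ρ̄ * vS (2 ℕ.+ k))) + (num c₀ * 0ℚ + dot c₊ (λ k → vC (1 ℕ.+ k))) + num (deads L) * 0ℚ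
        ≡⟨ sym (eval-split V) ⟩
      eval L V
        ≤⟨ claim-coin C s Ψ⁺ V V≥0 Ψ⁺≥0 fit R le ⟩
      ⟨ C ⊠ μ t R ⟩ (λ (γ , T) → Ψ⁺ γ (X t T) (label T t))
        ≤⟨ mono (C ⊠ trees R) (λ (γ , T) → live-≤ (X t T) (Ψ⁺≥0 γ (X t T) (label T t))) ⟩
      ⟨ C ⊠ μ (suc t) R ⟩ (λ (γ , T) → Ψ γ (X (suc t) T)) ∎
      where
      open ≤-Reasoning
      open +-*-Solver
      V : Values
      V = values (λ { 0 → 0ℚ ; 1 → num r̄ * vS 1 ; (suc (suc k)) → num ρ̄ * vS (2 ℕ.+ k) }) (λ { 0 → 0ℚ ; (suc k) → vC (1 ℕ.+ k) }) 0ℚ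
      V≥0 : NonNeg V
      V≥0 = nonNeg (λ { 0 → ≤-refl ; 1 → 0≤* (0≤num r̄) (vS≥0 1) ; (suc (suc k)) → 0≤* (0≤num ρ̄) (vS≥0 (2 ℕ.+ k)) })
                   (λ { 0 → ≤-refl ; (suc k) → vC≥0 (1 ℕ.+ k) }) ≤-refl
      Ψ⁺ : Γ → State → Coin → ℚ
      Ψ⁺ γ x c = live (next m (act (X t) x c) x) (Ψ γ (next m (act (X t) x c) x))
      Ψ⁺≥0 : ∀ γ x c → 0ℚ ≤ Ψ⁺ γ x c
      Ψ⁺≥0 γ x c = live-≥0 (next m (act (X t) x c) x) (Ψ≥0 γ _)
      fit : Fits C t s (λ γ x → ⟨ coin t ⟩ (Ψ⁺ γ x)) V
      fit-single fit [] _ = pos C (λ γ → coin-≥0 (Ψ⁺≥0 γ (single [])))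
      fit-single fit (R ∷ []) les = begin
        num r̄ * vS 1                                                               ≤⟨ *-monoʳ (0≤num r̄) (hS (R ∷ []) les) ⟩
        num r̄ * ⟨ C ⊠ μ t R ⟩ (λ (γ , p) → Ψ γ (singleOf m (p ∷ [])))              ≡⟨ sym (scale (C ⊠ μ t R) (num r̄) (λ (γ , p) → Ψ γ (singleOf m (p ∷ [])))) ⟩
        ⟨ C ⊠ μ t R ⟩ (λ (γ , p) → num r̄ * Ψ γ (singleOf m (p ∷ [])))              ≤⟨ mono (C ⊠ μ t R) (λ (γ , p) →
                                                                                       ≤-coin-not-fold t (Ψ≥0 γ _) (Ψ⁺≥0 γ (single (p ∷ [])))
                                                                                         (≤-reflexive (sym (singleOf-alive m (p ∷ [])))) (≤-reflexive (sym (singleOf-alive m (p ∷ []))))) ⟩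
        ⟨ C ⊠ μ t R ⟩ (λ (γ , p) → ⟨ coin t ⟩ (Ψ⁺ γ (single (p ∷ []))))            ∎
      fit-single fit Rs@(R ∷ R′ ∷ Rs′) les = begin
        num ρ̄ * vS (length Rs)                                                     ≤⟨ *-monoʳ (0≤num ρ̄) (hS Rs les) ⟩
        num ρ̄ * ⟨ C ⊠ nest t Rs ⟩ (λ (γ , ls) → Ψ γ (singleOf m ls))               ≡⟨ sym (scale (C ⊠ nest t Rs) (num ρ̄) (λ (γ , ls) → Ψ γ (singleOf m ls))) ⟩
        ⟨ C ⊠ nest t Rs ⟩ (λ (γ , ls) → num ρ̄ * Ψ γ (singleOf m ls))               ≤⟨ mono C (λ γ → mono (μ t R) λ p → mono (μ t R′) λ p′ → mono (nest t Rs′) λ ls →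
                                                                                       ≤-coin-not-cut t (Ψ≥0 γ _) (Ψ⁺≥0 γ (single (p ∷ p′ ∷ ls)))
                                                                                         (≤-reflexive (sym (singleOf-alive m (p ∷ p′ ∷ ls)))) (≤-reflexive (sym (singleOf-alive m (p ∷ p′ ∷ ls))))) ⟩
        ⟨ C ⊠ nest t Rs ⟩ (λ (γ , ls) → ⟨ coin t ⟩ (Ψ⁺ γ (single ls)))             ∎
      fit-cluster fit [] _ = pos C (λ γ → coin-≥0 (Ψ⁺≥0 γ (cluster [])))
      fit-cluster fit Rs@(R ∷ Rs′) les = ≤-trans (hC Rs les) (mono C λ γ → mono (μ t R) λ p → mono (nest t Rs′) λ ls →
        ≤-reflexive (trans (sym (clusterOf-alive m (p ∷ ls))) (sym (const₁ (coin t) (coin-normalised t) _))))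
      fit-dead fit = pos C (λ γ → coin-≥0 (Ψ⁺≥0 γ dead))

    -- The case of the constant function one in `advance`: `still` becomes the survival bound `A` of
    -- the next round.
    still-bound : MassBound (suc t) (D (D 0)) still
    still-bound R le = begin
      num still
        ≤⟨ numeric ⟩
      num s₁ * (num r̄ * pw α 1) + num ρ̄ * dot s₂₊ (λ k → pw α (2 ℕ.+ k)) + dot c₊ (λ k → pw α (1 ℕ.+ k))
        ≤⟨ advance dirac (λ _ _ → 1ℚ) (λ _ _ → 0≤1) (D 0) 0≤α 0≤α (nest-mass bound) (nest-mass bound) R le ⟩
      ⟨ μ (suc t) R ⟩ (λ _ → 1ℚ) ∎
      where
      open ≤-Reasoning
      numeric : num still ≤ num s₁ * (num r̄ * pw α 1) + num ρ̄ * dot s₂₊ (λ k → pw α (2 ℕ.+ k)) + dot c₊ (λ k → pw α (1 ℕ.+ k))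
      numeric = ≤-trans (≤-reflexive (trans (num-+ (r̄ ⊗ s₁ ⊗ A ℕ.+ ρ̄ ⊗ cut-mass) (A ⊗ mass A c₊)) (cong (_+ num (A ⊗ mass A c₊)) (num-+ (r̄ ⊗ s₁ ⊗ A) (ρ̄ ⊗ cut-mass)))))
        (+-mono-≤ (+-mono-≤
          (≤-trans (⊗-* {r̄ ⊗ s₁} {A} (num-⊗ r̄ s₁) ≤-refl) (≤-reflexive (trans (cong (_* α) (*-comm (num r̄) (num s₁)))
            (trans (*-assoc (num s₁) (num r̄) α) (cong (λ e → num s₁ * (num r̄ * e)) (sym (*-identityʳ α)))))))
          (⊗-* {ρ̄} {cut-mass} ≤-refl (≤-trans (≤-reflexive (sym (*-identityʳ (num cut-mass)))) (≤-trans (nest-power {s₂₊} 1ℚ 0≤1)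
            (≤-reflexive (dot-ext s₂₊ (λ k → *-identityʳ _)))))))
          (≤-trans (⊗-* {A} {mass A c₊} ≤-refl (dot-mass c₊ ≤-refl)) (≤-reflexive (sym (dot-scale c₊ α (pw α))))))

    ν : ℚ
    ν = num still

    0≤ν : ∀ k → 0ℚ ≤ pw ν k
    0≤ν = 0≤pw (0≤num still)

    -- Depth budgets: `DD` for one letter, `Dc` for the limbs of a cluster, `Ds` for those of an
    -- unmerged vertex, where a letter may hand over limbs that must themselves be deep enough for
    -- `Dc`.
    DD Dc Ds : ℕ → ℕ
    DD s = D (D s)
    Dc s = DD (D s)
    Ds s = DD (Dc s)

    DD≥ : ∀ s → s ℕ.≤ DD s
    DD≥ s = ℕ.≤-trans (D≥ s) (D≥ (D s))

    D0≤DD : ∀ s → D 0 ℕ.≤ DD s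
    D0≤DD s = ℕ.≤-trans (D-mono ℕ.z≤n) (D≥ (D s))

    -- The values left when one quiet limb has moved into the context. It counts as a further limb
    -- of a living state, whereas in a dead state it is forgotten and contributes its mass `ν`.
    shift : Values → Values
    shift V = values (onSingle V ∘ suc) (onCluster V ∘ suc) (ν * onDead V)

    shift≥0 : ∀ {V} → NonNeg V → NonNeg (shift V)
    shift≥0 p = nonNeg (single≥0 p ∘ suc) (cluster≥0 p ∘ suc) (0≤* (0≤num still) (dead≥0 p))

    fits-shift : ∀ {Γ} (C : Positive Γ) {s Ψ V} → NonNeg V → (∀ γ x → 0ℚ ≤ Ψ γ x) → Fits C (suc t) s Ψ V → ∀ {R} → s ℕ.≤ R → DD 0 ℕ.≤ R →
                 Fits (C ⊠ μ (suc t) R) (suc t) s (λ (γ , p) x → Ψ γ (keep p x)) (shift V)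
    fit-single  (fits-shift C V≥0 Ψ≥0 f le le₀) Rs les = fit-single f (_ ∷ Rs) (le ∷ les)
    fit-cluster (fits-shift C V≥0 Ψ≥0 f le le₀) Rs les = fit-cluster f (_ ∷ Rs) (le ∷ les)
    fit-dead    (fits-shift C {Ψ = Ψ} {V} V≥0 Ψ≥0 f {R} le le₀) = ≤-trans
      (≤-reflexive (cong (_* onDead V) (sym (*-identityʳ ν))))
      (below-nest C {t = suc t} {φ = λ γ → Ψ γ dead} still-bound (λ γ → Ψ≥0 γ dead) (fit-dead f) (R ∷ []) (le₀ ∷ []))

    -- The right-hand side is what `letters` yields for the added limb: the quiet case first, then
    -- vanishing, killing and fusing.
    extendCluster-≤ : ∀ k M {V} → NonNeg V →
      eval (extendCluster k M) V ≤
      eval M (shift V) + (num dropped * eval M V + num killed * (pw α k * onDead V) + dot fused (λ j → pw α (suc j) * (pw α k * onDead V)))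
    extendCluster-≤ k (law s c z) {V} V≥0 = begin
      0ℚ + dot ((0 ∷ c) ⊞ dropped ⊡ c) VC + num ((still ℕ.+ dropped) ⊗ z ℕ.+ lost ⊗ pow A k) * VZ
        ≤⟨ +-mono-≤ (+-monoʳ-≤ 0ℚ clustersPart) deadPart ⟩
      0ℚ + (dot c (VC ∘ suc) + d * dot c VC) + ((ν + d) * num z * VZ + (num killed * (pw α k * VZ) + F))
        ≤⟨ ≤-trans (p≤p+q (0≤+ (dot-≥0 s (single≥0 V≥0 ∘ suc)) (0≤* (0≤num dropped) (dot-≥0 s (single≥0 V≥0)))))
             (≤-reflexive (solve 10 (λ c1 d c0 n z v k f s1 s0 → con 0ℚ :+ (c1 :+ d :* c0) :+ ((n :+ d) :* z :* v :+ (k :+ f)) :+ (s1 :+ d :* s0) :=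
                 s1 :+ c1 :+ z :* (n :* v) :+ (d :* (s0 :+ c0 :+ z :* v) :+ k :+ f)) refl
               (dot c (VC ∘ suc)) d (dot c VC) ν (num z) VZ (num killed * (pw α k * VZ)) F (dot s (onSingle V ∘ suc)) (dot s (onSingle V)))) ⟩
      eval (law s c z) (shift V) + (d * eval (law s c z) V + num killed * (pw α k * VZ) + F) ∎
      where
      open ≤-Reasoning
      open +-*-Solver
      VC = onCluster V
      VZ = onDead V
      d = num dropped
      F = dot fused (λ j → pw α (suc j) * (pw α k * VZ))
      clustersPart : dot ((0 ∷ c) ⊞ dropped ⊡ c) VC ≤ dot c (VC ∘ suc) + d * dot c VC
      clustersPart = ≤-trans (≤-reflexive (trans (dot-⊞ (0 ∷ c) (dropped ⊡ c) VC) (cong (_+ dot (dropped ⊡ c) VC) (dot-shift c VC))))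
        (+-monoʳ-≤ (dot c (VC ∘ suc)) (dot-⊡ dropped c (cluster≥0 V≥0)))
      lostPart : num lost * (pw α k * VZ) ≤ num killed * (pw α k * VZ) + F
      lostPart = begin
        num lost * (pw α k * VZ) ≡⟨ trans (cong (_* (pw α k * VZ)) (num-+ killed (A ⊗ mass A fused))) (*-distribʳ-+ (pw α k * VZ) (num killed) (num (A ⊗ mass A fused))) ⟩
        num killed * (pw α k * VZ) + num (A ⊗ mass A fused) * (pw α k * VZ)
          ≤⟨ +-monoʳ-≤ (num killed * (pw α k * VZ)) (≤-trans (*-monoˡ Q≥0 (num-⊗ A (mass A fused)))
               (≤-trans (≤-reflexive (*-assoc α (num (mass A fused)) (pw α k * VZ))) (*-monoʳ (0≤num A) (mass-≤ fused (pw α k * VZ) Q≥0)))) ⟩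
        num killed * (pw α k * VZ) + α * dot fused (λ j → pw α j * (pw α k * VZ))
          ≡⟨ cong (num killed * (pw α k * VZ) +_) (trans (sym (dot-scale fused α _)) (dot-ext fused (λ j → sym (*-assoc α (pw α j) (pw α k * VZ))))) ⟩
        num killed * (pw α k * VZ) + F ∎
        where
        Q≥0 : 0ℚ ≤ pw α k * VZ
        Q≥0 = 0≤* (0≤α k) (dead≥0 V≥0)
      deadPart : num ((still ℕ.+ dropped) ⊗ z ℕ.+ lost ⊗ pow A k) * VZ ≤ (ν + d) * num z * VZ + (num killed * (pw α k * VZ) + F)
      deadPart = begin
        num ((still ℕ.+ dropped) ⊗ z ℕ.+ lost ⊗ pow A k) * VZ
          ≡⟨ trans (cong (_* VZ) (num-+ ((still ℕ.+ dropped) ⊗ z) (lost ⊗ pow A k))) (*-distribʳ-+ VZ (num ((still ℕ.+ dropped) ⊗ z)) (num (lost ⊗ pow A k))) ⟩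
        num ((still ℕ.+ dropped) ⊗ z) * VZ + num (lost ⊗ pow A k) * VZ
          ≤⟨ +-mono-≤ (*-monoˡ (dead≥0 V≥0) (⊗-* {still ℕ.+ dropped} {z} (≤-reflexive (num-+ still dropped)) ≤-refl))
                      (*-monoˡ (dead≥0 V≥0) (⊗-* {lost} {pow A k} ≤-refl (num-pow k ≤-refl))) ⟩
        (ν + d) * num z * VZ + num lost * pw α k * VZ
          ≡⟨ cong ((ν + d) * num z * VZ +_) (*-assoc (num lost) (pw α k) VZ) ⟩
        (ν + d) * num z * VZ + num lost * (pw α k * VZ)
          ≤⟨ +-monoʳ-≤ ((ν + d) * num z * VZ) lostPart ⟩
        (ν + d) * num z * VZ + (num killed * (pw α k * VZ) + F) ∎

    -- Induction on the limbs. If the first one is quiet it moves into the context as a limb of the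
    -- next round, and the induction hypothesis is applied there; the other letters are handled in
    -- the old context.
    clusters-claim : ∀ {Γ} (C : Positive Γ) s Ψ V → NonNeg V → (∀ γ x → 0ℚ ≤ Ψ γ x) → Fits C (suc t) s Ψ V →
                     ∀ Rs → All (Dc s ℕ.≤_) Rs → eval (clusterLaw (length Rs)) V ≤ ⟨ C ⊠ nest t Rs ⟩ λ (γ , ls) → Ψ γ (clusterOf m ls)
    clusters-claim C s Ψ V V≥0 Ψ≥0 f [] [] = ≤-trans
      (≤-reflexive (trans (cong₂ (λ a b → 0ℚ + (a * onCluster V 0 + 0ℚ) + b * onDead V) num-one num-zero)
        (solve 2 (λ c z → con 0ℚ :+ (con 1ℚ :* c :+ con 0ℚ) :+ con 0ℚ :* z := c) refl (onCluster V 0) (onDead V))))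
      (fit-cluster f [] [])
      where open +-*-Solver
    clusters-claim {Γ} C s Ψ V V≥0 Ψ≥0 f (R ∷ Rs) (le ∷ les) = begin
      eval (clusterLaw (suc k)) V
        ≤⟨ extendCluster-≤ k (clusterLaw k) V≥0 ⟩
      eval (clusterLaw k) (shift V) + (num dropped * eval (clusterLaw k) V + num killed * (pw α k * VZ) + dot fused (λ j → pw α (suc j) * (pw α k * VZ)))
        ≤⟨ +-monoˡ-≤ _ (clusters-claim (C ⊠ μ (suc t) R) s (λ (γ , p) x → Ψ γ (keep p x)) (shift V) (shift≥0 V≥0) (λ (γ , p) x → Ψ≥0 γ (keep p x))
             (fits-shift C V≥0 Ψ≥0 f (ℕ.≤-trans (ℕ.≤-trans (D≥ s) (DD≥ (D s))) le) (ℕ.≤-trans (D-mono (D-mono ℕ.z≤n)) le)) Rs les) ⟩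
      ⟨ C ⊠ μ (suc t) R ⟩ (λ (γ , p) → g γ p) + (num dropped * eval (clusterLaw k) V + num killed * (pw α k * VZ) + dot fused (λ j → pw α (suc j) * (pw α k * VZ)))
        ≤⟨ letters C g Φ (λ γ p → pos (nest t Rs) (λ ls → Ψ≥0 γ _)) (λ γ l → pos (nest t Rs) (λ ls → Ψ≥0 γ _)) {D s} (D-mono ℕ.z≤n)
             (eval-≥0 (clusterLaw k) V≥0) Q≥0 (λ j → 0≤* (0≤α (suc j)) Q≥0)
             (clusters-claim C s Ψ V V≥0 Ψ≥0 f Rs les) killing
             (λ R′ Rs′ les′ → below-nest C {t = t} bound (λ γ → pos (nest t Rs) (λ ls → Ψ≥0 γ dead)) killing (R′ ∷ Rs′) (raise (D-mono ℕ.z≤n) les′))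
             R le ⟩
      ⟨ C ⊠ μ t R ⟩ (λ (γ , p) → out (g γ p) (Φ γ) (m p))
        ≡⟨ ext (C ⊠ μ t R) (λ (γ , p) → branch γ p (m p)) ⟩
      ⟨ C ⊠ nest t (R ∷ Rs) ⟩ (λ (γ , ls) → Ψ γ (clusterOf m ls)) ∎
      where
      open ≤-Reasoning
      k = length Rs
      VZ = onDead V
      Q≥0 : 0ℚ ≤ pw α k * VZ
      Q≥0 = 0≤* (0≤α k) (dead≥0 V≥0)
      g : Γ → Tree → ℚ
      g γ p = ⟨ nest t Rs ⟩ λ ls → Ψ γ (keep p (clusterOf m ls))
      Φ : Γ → Letter → ℚ
      -- Only a quiet letter stores the tree, and `out` overrides that case, so the placeholder is
      -- never read.
      Φ γ l = ⟨ nest t Rs ⟩ λ ls → Ψ γ (tryCluster l blank (clusterOf m ls))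
      killing : pw α k * VZ ≤ ⟨ C ⟩ λ γ → Φ γ kill
      killing = below-nest C {t = t} bound (λ γ → Ψ≥0 γ dead) (fit-dead f) Rs (raise (ℕ.≤-trans (D-mono ℕ.z≤n) (DD≥ (D s))) les)
      branch : ∀ γ p l → out (g γ p) (Φ γ) l ≡ ⟨ nest t Rs ⟩ λ ls → Ψ γ (tryCluster l p (clusterOf m ls))
      branch γ p quiet    = refl
      branch γ p vanish   = refl
      branch γ p kill     = refl
      branch γ p (fuse _) = refl

    pw-+ : ∀ q i j → pw q (i ℕ.+ j) ≡ pw q i * pw q j
    pw-+ q zero    j = sym (*-identityˡ (pw q j))
    pw-+ q (suc i) j = trans (cong (q *_) (pw-+ q i j)) (sym (*-assoc q (pw q i) (pw q j)))

    -- Values, as functions of the state of the remaining limbs, of a cluster with i kept members.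
    joined : Values → ℕ → Values
    joined V i = values (λ j → onCluster V (i ℕ.+ j)) (λ j → pw ν (i ℕ.+ j) * onDead V) (pw ν i * onDead V)

    joined≥0 : ∀ {V} → NonNeg V → ∀ i → NonNeg (joined V i)
    joined≥0 p i = nonNeg (λ j → cluster≥0 p (i ℕ.+ j)) (λ j → 0≤* (0≤ν (i ℕ.+ j)) (dead≥0 p)) (0≤* (0≤ν i) (dead≥0 p))

    -- Values as functions of what the limbs handed over by a fusion become. A cluster with `i`
    -- members still awaits the own limbs, distributed by `M`; a dead one settles the outcome and
    -- leaves `k` limbs to integrate out.
    fusing : Law → ℕ → Values → Values
    fusing M k V = values (λ _ → 0ℚ) (λ i → eval M (joined V i)) (pw α k * onDead V)

    fusing≥0 : ∀ M k {V} → NonNeg V → NonNeg (fusing M k V)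
    fusing≥0 M k p = nonNeg (λ _ → ≤-refl) (λ i → eval-≥0 M (joined≥0 p i)) (0≤* (0≤α k) (dead≥0 p))

    fuse-≤ : ∀ xs F s c z k {V} → NonNeg V →
      dot (fuseClusters xs F s) (onCluster V) + num (fuseDead xs F (mass still c ℕ.+ z) k) * onDead V ≤
      dot xs (λ j → eval (F j) (fusing (law s c z) k V))
    fuse-≤ []       F s c z k {V} V≥0 = ≤-reflexive (trans (+-identityˡ _) (trans (cong (_* onDead V) num-zero) (*-zeroˡ (onDead V))))
    fuse-≤ (x ∷ xs) F s c z k {V} V≥0 = begin
      dot (x ⊡ conv c′ s ⊞ fuseClusters xs (F ∘ suc) s) VC + num (x ⊗ (mass still c′ ⊗ q ℕ.+ z′ ⊗ pow A k) ℕ.+ rest) * VZ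
        ≡⟨ cong₂ _+_ (dot-⊞ (x ⊡ conv c′ s) (fuseClusters xs (F ∘ suc) s) VC)
             (trans (cong (_* VZ) (num-+ (x ⊗ (mass still c′ ⊗ q ℕ.+ z′ ⊗ pow A k)) rest)) (*-distribʳ-+ VZ (num (x ⊗ (mass still c′ ⊗ q ℕ.+ z′ ⊗ pow A k))) (num rest))) ⟩
      dot (x ⊡ conv c′ s) VC + dot (fuseClusters xs (F ∘ suc) s) VC + (num (x ⊗ (mass still c′ ⊗ q ℕ.+ z′ ⊗ pow A k)) * VZ + num rest * VZ)
        ≡⟨ solve 4 (λ a b c d → a :+ b :+ (c :+ d) := a :+ c :+ (b :+ d)) refl (dot (x ⊡ conv c′ s) VC) (dot (fuseClusters xs (F ∘ suc) s) VC)
             (num (x ⊗ (mass still c′ ⊗ q ℕ.+ z′ ⊗ pow A k)) * VZ) (num rest * VZ) ⟩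
      dot (x ⊡ conv c′ s) VC + num (x ⊗ (mass still c′ ⊗ q ℕ.+ z′ ⊗ pow A k)) * VZ + (dot (fuseClusters xs (F ∘ suc) s) VC + num rest * VZ)
        ≤⟨ +-mono-≤ (+-mono-≤ first second) (fuse-≤ xs (F ∘ suc) s c z k V≥0) ⟩
      num x * dot c′ (λ i → dot s (λ j → VC (i ℕ.+ j))) + num x * (Q * VZ * dot c′ (pw ν) + num z′ * (pw α k * VZ)) + dot xs (λ j → eval (F (suc j)) W)
        ≤⟨ +-monoˡ-≤ (dot xs (λ j → eval (F (suc j)) W)) head ⟩
      num x * eval (F 0) W + dot xs (λ j → eval (F (suc j)) W) ∎
      where
      open ≤-Reasoning
      open +-*-Solver
      VC = onCluster V
      VZ = onDead V
      W = fusing (law s c z) k V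
      q = mass still c ℕ.+ z
      c′ = clusters (F 0)
      z′ = deads (F 0)
      rest = fuseDead xs (F ∘ suc) q k
      Q : ℚ
      Q = dot c (pw ν) + num z
      q≤Q : num q ≤ Q
      q≤Q = +-+ {mass still c} {z} (dot-mass c ≤-refl) ≤-refl
      first : dot (x ⊡ conv c′ s) VC ≤ num x * dot c′ (λ i → dot s (λ j → VC (i ℕ.+ j)))
      first = ≤-trans (dot-⊡ x (conv c′ s) (cluster≥0 V≥0)) (*-monoʳ (0≤num x) (dot-conv c′ s (cluster≥0 V≥0)))
      second : num (x ⊗ (mass still c′ ⊗ q ℕ.+ z′ ⊗ pow A k)) * VZ ≤ num x * (Q * VZ * dot c′ (pw ν) + num z′ * (pw α k * VZ))
      second = ≤-trans
        (*-monoˡ (dead≥0 V≥0) (⊗-* {x} {mass still c′ ⊗ q ℕ.+ z′ ⊗ pow A k} ≤-refl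
          (+-+ {mass still c′ ⊗ q} {z′ ⊗ pow A k} (⊗-* {mass still c′} {q} (dot-mass c′ ≤-refl) q≤Q) (⊗-* {z′} {pow A k} ≤-refl (num-pow k ≤-refl)))))
        (≤-reflexive (solve 6 (λ x d q z a v → x :* (d :* q :+ z :* a) :* v := x :* (q :* v :* d :+ z :* (a :* v))) refl
          (num x) (dot c′ (pw ν)) Q (num z′) (pw α k) VZ))
      expand : ∀ i → dot s (λ j → VC (i ℕ.+ j)) + Q * VZ * pw ν i ≡ eval (law s c z) (joined V i)
      expand i = trans
        (solve 5 (λ a d z v p → a :+ (d :+ z) :* v :* p := a :+ (p :* v) :* d :+ z :* (p :* v)) refl
          (dot s (λ j → VC (i ℕ.+ j))) (dot c (pw ν)) (num z) VZ (pw ν i))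
        (cong (λ e → dot s (λ j → VC (i ℕ.+ j)) + e + num z * (pw ν i * VZ))
          (trans (sym (dot-scale c (pw ν i * VZ) (pw ν))) (dot-ext c (λ j →
            trans (solve 3 (λ a v b → a :* v :* b := a :* b :* v) refl (pw ν i) VZ (pw ν j)) (cong (_* VZ) (sym (pw-+ ν i j)))))))
      head : num x * dot c′ (λ i → dot s (λ j → VC (i ℕ.+ j))) + num x * (Q * VZ * dot c′ (pw ν) + num z′ * (pw α k * VZ)) ≤ num x * eval (F 0) W
      head = ≤-trans (≤-reflexive (sym (*-distribˡ-+ (num x) _ _))) (*-monoʳ (0≤num x) (begin
        dot c′ (λ i → dot s (λ j → VC (i ℕ.+ j))) + (Q * VZ * dot c′ (pw ν) + num z′ * (pw α k * VZ))
          ≡⟨ sym (+-assoc (dot c′ (λ i → dot s (λ j → VC (i ℕ.+ j)))) _ _) ⟩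
        dot c′ (λ i → dot s (λ j → VC (i ℕ.+ j))) + Q * VZ * dot c′ (pw ν) + num z′ * (pw α k * VZ)
          ≡⟨ cong (_+ num z′ * (pw α k * VZ)) (trans
               (cong (dot c′ (λ i → dot s (λ j → VC (i ℕ.+ j))) +_) (sym (dot-scale c′ (Q * VZ) (pw ν))))
               (trans (sym (dot-add c′ _ _)) (dot-ext c′ expand))) ⟩
        dot c′ (λ i → eval (law s c z) (joined V i)) + num z′ * (pw α k * VZ)
          ≤⟨ +-monoˡ-≤ (num z′ * (pw α k * VZ)) (q≤p+q (dot-≥0 (singles (F 0)) (λ _ → ≤-refl))) ⟩
        eval (F 0) W ∎))

    -- As for clusters, except that a fusion no longer kills: its value is the law of the received
    -- limbs evaluated at `fusing`.
    extendSingle-≤ : ∀ k M {V} → NonNeg V →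
      eval (extendSingle k M) V ≤
      eval M (shift V) + (num dropped * eval M V + num killed * (pw α k * onDead V) + dot fused (λ j → eval (clusterLaw (suc j)) (fusing M k V)))
    extendSingle-≤ k M@(law s c z) {V} V≥0 = begin
      dot ((0 ∷ s) ⊞ dropped ⊡ s) VS + dot ((0 ∷ c) ⊞ dropped ⊡ c ⊞ fc) VC + num ((still ℕ.+ dropped) ⊗ z ℕ.+ killed ⊗ pow A k ℕ.+ fd) * VZ
        ≤⟨ +-mono-≤ (+-mono-≤ (part s (single≥0 V≥0))
             (≤-trans (≤-reflexive (dot-⊞ ((0 ∷ c) ⊞ dropped ⊡ c) fc VC)) (+-monoˡ-≤ (dot fc VC) (part c (cluster≥0 V≥0))))) deadPart ⟩
      dot s (VS ∘ suc) + d * dot s VS + (dot c (VC ∘ suc) + d * dot c VC + dot fc VC) + ((ν + d) * num z * VZ + num killed * (pw α k * VZ) + num fd * VZ)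
        ≡⟨ solve 11 (λ s1 d s0 c1 c0 f n z v k e → s1 :+ d :* s0 :+ (c1 :+ d :* c0 :+ f) :+ ((n :+ d) :* z :* v :+ k :+ e) :=
                s1 :+ c1 :+ z :* (n :* v) :+ (d :* (s0 :+ c0 :+ z :* v) :+ k :+ (f :+ e))) refl
             (dot s (VS ∘ suc)) d (dot s VS) (dot c (VC ∘ suc)) (dot c VC) (dot fc VC) ν (num z) VZ (num killed * (pw α k * VZ)) (num fd * VZ) ⟩
      eval M (shift V) + (d * eval M V + num killed * (pw α k * VZ) + (dot fc VC + num fd * VZ))
        ≤⟨ +-monoʳ-≤ (eval M (shift V)) (+-monoʳ-≤ (d * eval M V + num killed * (pw α k * VZ)) (fuse-≤ fused (clusterLaw ∘ suc) s c z k V≥0)) ⟩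
      eval M (shift V) + (d * eval M V + num killed * (pw α k * VZ) + dot fused (λ j → eval (clusterLaw (suc j)) (fusing M k V))) ∎
      where
      open ≤-Reasoning
      open +-*-Solver
      VS = onSingle V
      VC = onCluster V
      VZ = onDead V
      d = num dropped
      fc = fuseClusters fused (clusterLaw ∘ suc) s
      fd = fuseDead fused (clusterLaw ∘ suc) (mass still c ℕ.+ z) k
      part : ∀ xs {U} → (∀ j → 0ℚ ≤ U j) → dot ((0 ∷ xs) ⊞ dropped ⊡ xs) U ≤ dot xs (U ∘ suc) + d * dot xs U
      part xs {U} U≥0 = ≤-trans (≤-reflexive (trans (dot-⊞ (0 ∷ xs) (dropped ⊡ xs) U) (cong (_+ dot (dropped ⊡ xs) U) (dot-shift xs U))))
        (+-monoʳ-≤ (dot xs (U ∘ suc)) (dot-⊡ dropped xs U≥0))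
      deadPart : num ((still ℕ.+ dropped) ⊗ z ℕ.+ killed ⊗ pow A k ℕ.+ fd) * VZ ≤ (ν + d) * num z * VZ + num killed * (pw α k * VZ) + num fd * VZ
      deadPart = begin
        num ((still ℕ.+ dropped) ⊗ z ℕ.+ killed ⊗ pow A k ℕ.+ fd) * VZ
          ≡⟨ trans (cong (_* VZ) (num-+ ((still ℕ.+ dropped) ⊗ z ℕ.+ killed ⊗ pow A k) fd)) (*-distribʳ-+ VZ (num ((still ℕ.+ dropped) ⊗ z ℕ.+ killed ⊗ pow A k)) (num fd)) ⟩
        num ((still ℕ.+ dropped) ⊗ z ℕ.+ killed ⊗ pow A k) * VZ + num fd * VZ
          ≤⟨ +-monoˡ-≤ (num fd * VZ) (*-monoˡ (dead≥0 V≥0) (+-+ {(still ℕ.+ dropped) ⊗ z} {killed ⊗ pow A k}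
               (⊗-* {still ℕ.+ dropped} {z} (≤-reflexive (num-+ still dropped)) ≤-refl) (⊗-* {killed} {pow A k} ≤-refl (num-pow k ≤-refl)))) ⟩
        ((ν + d) * num z + num killed * pw α k) * VZ + num fd * VZ
          ≡⟨ cong (_+ num fd * VZ) (trans (*-distribʳ-+ VZ ((ν + d) * num z) (num killed * pw α k)) (cong ((ν + d) * num z * VZ +_) (*-assoc (num killed) (pw α k) VZ))) ⟩
        (ν + d) * num z * VZ + num killed * (pw α k * VZ) + num fd * VZ ∎

    -- Induction as in `clusters-claim`. A fusion is resolved in two nested steps: `clusters-claim`
    -- for the limbs received and, with their survivors in the context, the induction hypothesis for
    -- the own remaining limbs.
    singles-claim : ∀ {Γ} (C : Positive Γ) s Ψ V → DD 0 ℕ.≤ s → NonNeg V → (∀ γ x → 0ℚ ≤ Ψ γ x) → Fits C (suc t) s Ψ V →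
                    ∀ Rs → All (Ds s ℕ.≤_) Rs → eval (singleLaw (length Rs)) V ≤ ⟨ C ⊠ nest t Rs ⟩ λ (γ , ls) → Ψ γ (singleOf m ls)
    singles-claim C s Ψ V _ V≥0 Ψ≥0 f [] [] = ≤-trans
      (≤-reflexive (trans (cong₂ (λ a b → a * onSingle V 0 + 0ℚ + 0ℚ + b * onDead V) num-one num-zero)
        (solve 2 (λ c z → con 1ℚ :* c :+ con 0ℚ :+ con 0ℚ :+ con 0ℚ :* z := c) refl (onSingle V 0) (onDead V))))
      (fit-single f [] [])
      where open +-*-Solver
    singles-claim {Γ} C s Ψ V s≥ V≥0 Ψ≥0 f (R ∷ Rs) (le ∷ les) = begin
      eval (singleLaw (suc k)) V
        ≤⟨ extendSingle-≤ k M V≥0 ⟩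
      eval M (shift V) + (num dropped * eval M V + num killed * (pw α k * VZ) + dot fused bF)
        ≤⟨ +-monoˡ-≤ _ (singles-claim (C ⊠ μ (suc t) R) s (λ (γ , p) x → Ψ γ (keep p x)) (shift V) s≥ (shift≥0 V≥0) (λ (γ , p) x → Ψ≥0 γ (keep p x))
             (fits-shift C V≥0 Ψ≥0 f (ℕ.≤-trans (ℕ.≤-trans (D≥ s) (ℕ.≤-trans (DD≥ (D s)) (DD≥ (Dc s)))) le)
               (ℕ.≤-trans (D-mono (D-mono ℕ.z≤n)) le)) Rs les) ⟩
      ⟨ C ⊠ μ (suc t) R ⟩ (λ (γ , p) → g γ p) + (num dropped * eval M V + num killed * (pw α k * VZ) + dot fused bF)
        ≤⟨ letters C g Φ (λ γ p → pos (nest t Rs) (λ ls → Ψ≥0 γ _)) (λ γ l → pos (nest t Rs) (λ ls → Ψ≥0 γ _)) {Dc s} (ℕ.≤-trans (D-mono ℕ.z≤n) (DD≥ (D s)))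
             (eval-≥0 M V≥0) (0≤* (0≤α k) (dead≥0 V≥0)) (λ j → eval-≥0 (clusterLaw (suc j)) (fusing≥0 M k V≥0))
             (singles-claim C s Ψ V s≥ V≥0 Ψ≥0 f Rs les) (deadly C (λ γ → Ψ γ dead) (λ γ → Ψ≥0 γ dead) (fit-dead f)) fusion
             R le ⟩
      ⟨ C ⊠ μ t R ⟩ (λ (γ , p) → out (g γ p) (Φ γ) (m p))
        ≡⟨ ext (C ⊠ μ t R) (λ (γ , p) → branch γ p (m p)) ⟩
      ⟨ C ⊠ nest t (R ∷ Rs) ⟩ (λ (γ , ls) → Ψ γ (singleOf m ls)) ∎
      where
      open ≤-Reasoning
      k = length Rs
      M = singleLaw k
      VZ = onDead V
      bF : ℕ → ℚ
      bF j = eval (clusterLaw (suc j)) (fusing M k V)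
      g : Γ → Tree → ℚ
      g γ p = ⟨ nest t Rs ⟩ λ ls → Ψ γ (keep p (singleOf m ls))
      Φ : Γ → Letter → ℚ
      Φ γ l = ⟨ nest t Rs ⟩ λ ls → Ψ γ (trySingle m l blank (singleOf m ls))
      deadly : ∀ {Δ} (C′ : Positive Δ) φ → (∀ γ → 0ℚ ≤ φ γ) → ∀ {v} → v ≤ ⟨ C′ ⟩ φ → pw α k * v ≤ ⟨ C′ ⊠ nest t Rs ⟩ λ (γ , _) → φ γ
      deadly C′ φ φ≥0 le′ = below-nest C′ {t = t} bound φ≥0 le′ Rs
        (raise (ℕ.≤-trans (ℕ.≤-trans (D-mono ℕ.z≤n) (DD≥ (D s))) (DD≥ (Dc s))) les)
      fused-fits : Fits C (suc t) s (λ γ x → ⟨ nest t Rs ⟩ λ ls → Ψ γ (attach x (singleOf m ls))) (fusing M k V)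
      fit-single fused-fits Qs _ = pos (C ⊠ nest (suc t) Qs) (λ (γ , qs) → pos (nest t Rs) (λ ls → Ψ≥0 γ _))
      -- The surviving received limbs `qs` join the context, so the induction still runs over the
      -- own limbs `Rs`.
      fit-cluster fused-fits Qs qles = singles-claim (C ⊠ nest (suc t) Qs) s (λ (γ , qs) x → Ψ γ (attach (cluster qs) x)) (joined V (length Qs)) s≥
        (joined≥0 V≥0 (length Qs)) (λ (γ , qs) x → Ψ≥0 γ (attach (cluster qs) x)) inner Rs les
        where
        appended : ∀ Ss (ψ : Γ → List Tree → ℚ) →
          ⟨ C ⊠ nest (suc t) (Qs ++ Ss) ⟩ (λ (γ , ls) → ψ γ ls) ≡ ⟨ (C ⊠ nest (suc t) Qs) ⊠ nest (suc t) Ss ⟩ λ ((γ , qs) , ls) → ψ γ (qs ++ ls)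
        appended Ss ψ = ext C λ γ → nest-++ (suc t) Qs Ss (ψ γ)
        inner : Fits (C ⊠ nest (suc t) Qs) (suc t) s (λ (γ , qs) x → Ψ γ (attach (cluster qs) x)) (joined V (length Qs))
        fit-single inner Ss sles = subst₂ _≤_ (cong (onCluster V) (length-++ Qs)) (appended Ss (λ γ ls → Ψ γ (cluster ls)))
          (fit-cluster f (Qs ++ Ss) (++⁺ qles sles))
        fit-cluster inner Ss sles = subst₂ _≤_ (cong (λ i → pw ν i * VZ) (length-++ Qs)) (appended Ss (λ γ _ → Ψ γ dead))
          (below-nest C {t = suc t} still-bound (λ γ → Ψ≥0 γ dead) (fit-dead f) (Qs ++ Ss) (raise s≥ (++⁺ qles sles)))
        fit-dead inner = below-nest C {t = suc t} still-bound (λ γ → Ψ≥0 γ dead) (fit-dead f) Qs (raise s≥ qles)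
      fit-dead fused-fits = deadly C (λ γ → Ψ γ dead) (λ γ → Ψ≥0 γ dead) (fit-dead f)
      fusion : ∀ R′ Rs′ → All (Dc s ℕ.≤_) (R′ ∷ Rs′) → bF (length Rs′) ≤ ⟨ C ⊠ nest t (R′ ∷ Rs′) ⟩ λ (γ , ps) → Φ γ (fuse ps)
      fusion R′ Rs′ les′ = clusters-claim C s (λ γ x → ⟨ nest t Rs ⟩ λ ls → Ψ γ (attach x (singleOf m ls))) (fusing M k V) (fusing≥0 M k V≥0)
        (λ γ x → pos (nest t Rs) (λ ls → Ψ≥0 γ _)) fused-fits (R′ ∷ Rs′) les′
      branch : ∀ γ p l → out (g γ p) (Φ γ) l ≡ ⟨ nest t Rs ⟩ λ ls → Ψ γ (trySingle m l p (singleOf m ls))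
      branch γ p quiet     = refl
      branch γ p vanish    = refl
      branch γ p kill      = refl
      branch γ p (fuse ps) = refl

    -- The maximum with `DD 0` keeps stored limbs deep enough for `still-bound`.
    D⁺ : ℕ → ℕ
    D⁺ s = D (Ds (s ℕ.⊔ DD 0))

    Dc≤Ds : ∀ {s} → Dc s ℕ.≤ Ds s
    Dc≤Ds {s} = DD≥ (Dc s)

    next-claim : Claim (suc t) D⁺ nextLaw
    next-claim C s Ψ V V≥0 Ψ≥0 f R le = ≤-trans numeric
      (advance C Ψ Ψ≥0 (Ds s⁺) (λ k → eval-≥0 (singleLaw k) V≥0) (λ k → eval-≥0 (clusterLaw k) V≥0)
        (singles-claim C s⁺ Ψ V (ℕ.m≤n⊔m s (DD 0)) V≥0 Ψ≥0 f⁺)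
        (λ Rs les → clusters-claim C s⁺ Ψ V V≥0 Ψ≥0 f⁺ Rs (raise Dc≤Ds les)) R le)
      where
      s⁺ = s ℕ.⊔ DD 0
      weaken : ∀ {Rs} → All (s⁺ ℕ.≤_) Rs → All (s ℕ.≤_) Rs
      weaken = raise (ℕ.m≤m⊔n s (DD 0))
      f⁺ : Fits C (suc t) s⁺ Ψ V
      f⁺ = fits (λ Rs les → fit-single f Rs (weaken les)) (λ Rs les → fit-cluster f Rs (weaken les)) (fit-dead f)
      numeric : eval nextLaw V ≤ num s₁ * (num r̄ * eval (singleLaw 1) V) + num ρ̄ * dot s₂₊ (λ k → eval (singleLaw (2 ℕ.+ k)) V) + dot c₊ (λ k → eval (clusterLaw (1 ℕ.+ k)) V)
      numeric = ≤-trans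
        (≤-reflexive (trans (eval-⊕ (r̄ ⊗ s₁ ⊙ singleLaw 1 ⊕ ρ̄ ⊙ mix s₂₊ (λ k → singleLaw (2 ℕ.+ k))) (mix c₊ (λ k → clusterLaw (1 ℕ.+ k))) V)
          (cong (_+ eval (mix c₊ (λ k → clusterLaw (1 ℕ.+ k))) V) (eval-⊕ (r̄ ⊗ s₁ ⊙ singleLaw 1) (ρ̄ ⊙ mix s₂₊ (λ k → singleLaw (2 ℕ.+ k))) V))))
        (+-mono-≤ (+-mono-≤
          (≤-trans (eval-⊙ (r̄ ⊗ s₁) (singleLaw 1) V≥0) (≤-trans (*-monoˡ (eval-≥0 (singleLaw 1) V≥0) (num-⊗ r̄ s₁))
            (≤-reflexive (trans (cong (_* eval (singleLaw 1) V) (*-comm (num r̄) (num s₁))) (*-assoc (num s₁) (num r̄) (eval (singleLaw 1) V))))))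
          (≤-trans (eval-⊙ ρ̄ (mix s₂₊ (λ k → singleLaw (2 ℕ.+ k))) V≥0) (*-monoʳ (0≤num ρ̄) (eval-mix s₂₊ (λ k → singleLaw (2 ℕ.+ k)) V≥0))))
          (eval-mix c₊ (λ k → clusterLaw (1 ℕ.+ k)) V≥0))

-- One round at the root

record RootValues : Set where
  constructor rootValues
  field
    onRootSingle onRootCluster onFolded : ℕ → ℚ
    onWin                               : ℚ

open RootValues public

record RootNonNeg (V : RootValues) : Set where
  constructor rootNonNeg
  field
    rootSingle≥0  : ∀ k → 0ℚ ≤ onRootSingle V k
    rootCluster≥0 : ∀ k → 0ℚ ≤ onRootCluster V k
    folded≥0      : ∀ k → 0ℚ ≤ onFolded V k
    win≥0         : 0ℚ ≤ onWin V

open RootNonNeg public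

module RootSteps (one : ℕ) .{{_ : NonZero one}} (foldRate cutRate : ℕ → ℕ)
              (valid : ∀ t → foldRate t ℕ.+ cutRate t ℕ.≤ one) (H : ℕ) where
  open Rounds one foldRate cutRate valid H
  open Steps one foldRate cutRate valid H

  evalRoot : RootLaw → RootValues → ℚ
  evalRoot (rootLaw s c f w) V = dot s (onRootSingle V) + dot c (onRootCluster V) + dot f (onFolded V) + num w * onWin V

  record RootFits (t s : ℕ) (Ψ : Root → ℚ) (V : RootValues) : Set where
    constructor rootFits
    field
      fit-rootSingle  : ∀ Rs → All (s ℕ.≤_) Rs → onRootSingle V (length Rs) ≤ ⟨ nest t Rs ⟩ (Ψ ∘ rootSingle)
      fit-rootCluster : ∀ Rs → All (s ℕ.≤_) Rs → onRootCluster V (length Rs) ≤ ⟨ nest t Rs ⟩ (Ψ ∘ rootCluster)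
      fit-folded      : ∀ Rs → All (s ℕ.≤_) Rs → onFolded V (length Rs) ≤ ⟨ nest t Rs ⟩ (Ψ ∘ folded)
      fit-win         : onWin V ≤ Ψ win

  open RootFits public

  rootTrees : ℕ → Positive (Label × List Tree)
  rootTrees R = labels 0 H ⊠ nest 0 (R ∷ R ∷ R ∷ [])

  RootClaim : ℕ → (ℕ → ℕ) → RootLaw → Set
  RootClaim t D M = ∀ s Ψ V → RootNonNeg V → (∀ x → 0ℚ ≤ Ψ x) → RootFits t s Ψ V →
                    ∀ R → D s ℕ.≤ R → evalRoot M V ≤ ⟨ rootTrees R ⟩ λ (ℓ , es) → Ψ (Y t ℓ es)

  fresh-root-coin : ∀ {t} R → t ℕ.< H → (Ψ : Root → Coin → ℚ) →
                    ⟨ rootTrees R ⟩ (λ (ℓ , es) → Ψ (Y t ℓ es) (ℓ t)) ≡ ⟨ rootTrees R ⟩ (λ (ℓ , es) → ⟨ coin t ⟩ (Ψ (Y t ℓ es)))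
  fresh-root-coin {t} R t<H Ψ = trans
    (resample 0 H t<H refl (λ ℓ c → ⟨ N ⟩ λ es → Ψ (Y t ℓ es) c) (λ ℓ ℓ′ agree c → ext N λ es → cong (λ x → Ψ x c) (Y-label t es agree)))
    (ext (labels 0 H) λ ℓ → sym (coin-swap N t (λ es c → Ψ (Y t ℓ es) c)))
    where N = nest 0 (R ∷ R ∷ R ∷ [])

  ≤-coin-fold-or : ∀ t {f p q} → 0ℚ ≤ q → p ≤ f fold → q ≤ f idle → q ≤ f cut →
                   num (foldRate t) * p + num (one ∸ foldRate t) * q ≤ ⟨ coin t ⟩ f
  ≤-coin-fold-or t {f} {p} {q} 0≤q h i c = begin
    num (foldRate t) * p + num (one ∸ foldRate t) * q      ≤⟨ +-monoʳ-≤ (num (foldRate t) * p) (*-monoˡ 0≤q (num-mono le)) ⟩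
    num (foldRate t) * p + num (idleRate t ℕ.+ cutRate t) * q  ≡⟨ cong (λ e → num (foldRate t) * p + e * q) (num-+ (idleRate t) (cutRate t)) ⟩
    num (foldRate t) * p + (num (idleRate t) + num (cutRate t)) * q
      ≡⟨ solve 5 (λ r p a b q → r :* p :+ (a :+ b) :* q := a :* q :+ (r :* p :+ b :* q)) refl (num (foldRate t)) p (num (idleRate t)) (num (cutRate t)) q ⟩
    num (idleRate t) * q + (num (foldRate t) * p + num (cutRate t) * q)
      ≤⟨ +-mono-≤ (*-monoʳ (0≤num _) i) (+-mono-≤ (*-monoʳ (0≤num _) h) (*-monoʳ (0≤num _) c)) ⟩
    num (idleRate t) * f idle + (num (foldRate t) * f fold + num (cutRate t) * f cut) ≡⟨ sym (coin-split t f) ⟩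
    ⟨ coin t ⟩ f ∎
    where
    open ≤-Reasoning
    open +-*-Solver
    le : one ∸ foldRate t ℕ.≤ idleRate t ℕ.+ cutRate t
    le = ℕ.≤-trans (ℕ.m≤n+m∸n _ (cutRate t))
      (ℕ.≤-reflexive (trans (cong (cutRate t ℕ.+_) (ℕ.∸-+-assoc one (foldRate t) (cutRate t))) (ℕ.+-comm (cutRate t) (idleRate t))))

  module OneRootRound {t} (t<H : t ℕ.< H) {A : ℕ} {L : Law} {D : ℕ → ℕ} (D≥1 : ∀ s → 1 ℕ.≤ D s) (D≥ : ∀ s → s ℕ.≤ D s)
              (D-mono : ∀ {s s′} → s ℕ.≤ s′ → D s ℕ.≤ D s′) (bound : MassBound t (D 0) A) (claim : Claim t D L) where

    open Coefficients.Round one (foldRate t) (cutRate t) A L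
    open OneRound t<H {A} {L} {D} D≥1 D≥ D-mono bound claim

    module _ {Γ} (C : Positive Γ) (Φ : Γ → State → Letter → ℚ) (Φ≥0 : ∀ γ x l → 0ℚ ≤ Φ γ x l) {s} (D0≤s : D 0 ℕ.≤ s)
             {vS vC : ℕ → ℚ} {vZ : ℚ} (vS≥0 : ∀ k → 0ℚ ≤ vS k) (vC≥0 : ∀ k → 0ℚ ≤ vC k) (vZ≥0 : 0ℚ ≤ vZ)
             (hS : ∀ R Rs → All (s ℕ.≤_) (R ∷ Rs) → vS (length Rs) ≤ ⟨ C ⊠ nest t (R ∷ Rs) ⟩ λ (γ , ls) → Φ γ (single ls) quiet)
             (hC : ∀ R Rs → All (s ℕ.≤_) (R ∷ Rs) → vC (length Rs) ≤ ⟨ C ⊠ nest t (R ∷ Rs) ⟩ λ (γ , ls) → Φ γ (cluster ls) quiet)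
             (hZ : vZ ≤ ⟨ C ⟩ λ γ → Φ γ dead vanish) where

      -- Keeps only quiet states and dead ones, and gives all others the value zero. `vS k` and
      -- `vC k` belong to `k + 1` limbs, since without limbs the vertex acts.
      quiet-states : ∀ R → D s ℕ.≤ R →
                     dot quiets vS + (dot c₊ vC + num (deads L) * vZ) ≤ ⟨ C ⊠ μ t R ⟩ λ (γ , T) → Φ γ (X t T) (letter t T)
      quiet-states R le = ≤-trans numeric (claim-coin C s Ψ V V≥0 (λ γ x c → Φ≥0 γ x _) fit R le)
        where
        V : Values
        V = values (λ { 0 → 0ℚ ; 1 → num r̄ * vS 0 ; (suc (suc k)) → num ρ̄ * vS (suc k) }) (λ { 0 → 0ℚ ; (suc k) → vC k }) vZ
        V≥0 : NonNeg V
        V≥0 = nonNeg (λ { 0 → ≤-refl ; 1 → 0≤* (0≤num r̄) (vS≥0 0) ; (suc (suc k)) → 0≤* (0≤num ρ̄) (vS≥0 (suc k)) })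
                     (λ { 0 → ≤-refl ; (suc k) → vC≥0 k }) vZ≥0
        Ψ : Γ → State → Coin → ℚ
        Ψ γ x c = Φ γ x (act (X t) x c)
        fit : Fits C t s (λ γ x → ⟨ coin t ⟩ (Ψ γ x)) V
        fit-single fit [] _ = pos C (λ γ → coin-≥0 (λ c → Φ≥0 γ _ _))
        fit-single fit (R ∷ []) les = ≤-trans (*-monoʳ (0≤num r̄) (hS R [] les))
          (≤-trans (≤-reflexive (sym (scale (C ⊠ μ t R) (num r̄) (λ (γ , p) → Φ γ (single (p ∷ [])) quiet))))
            (mono (C ⊠ μ t R) (λ (γ , p) → ≤-coin-not-fold t (Φ≥0 γ _ _) (λ c → Φ≥0 γ _ _) ≤-refl ≤-refl)))
        fit-single fit Rs@(R ∷ R′ ∷ Rs′) les = ≤-trans (*-monoʳ (0≤num ρ̄) (hS R (R′ ∷ Rs′) les))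
          (≤-trans (≤-reflexive (sym (scale (C ⊠ nest t Rs) (num ρ̄) (λ (γ , ls) → Φ γ (single ls) quiet))))
            (mono C λ γ → mono (μ t R) λ p → mono (μ t R′) λ p′ → mono (nest t Rs′) λ ls →
              ≤-coin-not-cut t (Φ≥0 γ _ _) (λ c → Φ≥0 γ _ _) ≤-refl ≤-refl))
        fit-cluster fit [] _ = pos C (λ γ → coin-≥0 (λ c → Φ≥0 γ _ _))
        fit-cluster fit (R ∷ Rs) les = ≤-trans (hC R Rs les) (mono C λ γ → mono (μ t R) λ p → mono (nest t Rs) λ ls →
          ≤-reflexive (sym (const₁ (coin t) (coin-normalised t) _)))
        fit-dead fit = ≤-trans hZ (mono C λ γ → ≤-reflexive (sym (const₁ (coin t) (coin-normalised t) _)))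
        numeric : dot quiets vS + (dot c₊ vC + num (deads L) * vZ) ≤ eval L V
        numeric = begin
          num (r̄ ⊗ s₁) * vS 0 + dot (ρ̄ ⊡ s₂₊) (vS ∘ suc) + (dot c₊ vC + num (deads L) * vZ)
            ≤⟨ +-monoˡ-≤ _ (+-mono-≤ (≤-trans (*-monoˡ (vS≥0 0) (num-⊗ r̄ s₁)) (≤-reflexive (trans (cong (_* vS 0) (*-comm (num r̄) (num s₁))) (*-assoc (num s₁) (num r̄) (vS 0)))))
                 (≤-trans (dot-⊡ ρ̄ s₂₊ (vS≥0 ∘ suc)) (≤-reflexive (sym (dot-scale s₂₊ (num ρ̄) (vS ∘ suc)))))) ⟩
          num s₁ * (num r̄ * vS 0) + dot s₂₊ (λ k → num ρ̄ * vS (suc k)) + (dot c₊ vC + num (deads L) * vZ)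
            ≡⟨ solve 6 (λ a b c z s d → a :+ b :+ (c :+ z) := s :* con 0ℚ :+ (a :+ b) :+ (d :* con 0ℚ :+ c) :+ z) refl
                 (num s₁ * (num r̄ * vS 0)) (dot s₂₊ (λ k → num ρ̄ * vS (suc k))) (dot c₊ vC) (num (deads L) * vZ) (num s₀) (num c₀) ⟩
          num s₀ * 0ℚ + (num s₁ * (num r̄ * vS 0) + dot s₂₊ (λ k → num ρ̄ * vS (suc k))) + (num c₀ * 0ℚ + dot c₊ vC) + num (deads L) * vZ
            ≡⟨ sym (eval-split V) ⟩
          eval L V ∎
          where
          open ≤-Reasoning
          open +-*-Solver

    module _ (Ψ : Root → ℚ) (Ψ≥0 : ∀ x → 0ℚ ≤ Ψ x) {s} (s≥ : DD 0 ℕ.≤ s) (V : RootValues) (V≥0 : RootNonNeg V) (f : RootFits (suc t) s Ψ V) where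

      private
        VW : ℚ
        VW = onWin V

        VW≥0 : 0ℚ ≤ VW
        VW≥0 = win≥0 V≥0

        okay : ℚ
        okay = (ν + num dropped) * VW

        okay≥0 : 0ℚ ≤ okay
        okay≥0 = 0≤* (0≤+ (0≤num still) (0≤num dropped)) VW≥0

        stayV fallV : Values
        stayV = values (onRootSingle V) (onRootCluster V) 0ℚ
        fallV = values (λ _ → 0ℚ) (onFolded V) VW

        stayV≥0 : NonNeg stayV
        stayV≥0 = nonNeg (rootSingle≥0 V≥0) (rootCluster≥0 V≥0) ≤-refl

        fallV≥0 : NonNeg fallV
        fallV≥0 = nonNeg (λ _ → ≤-refl) (folded≥0 V≥0) VW≥0

        stay-fits : Fits dirac (suc t) s (λ _ x → Ψ (wrap x)) stayV
        stay-fits = fits (λ Rs les → fit-rootSingle f Rs les) (λ Rs les → fit-rootCluster f Rs les) (Ψ≥0 lose)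

        fall-fits : Fits dirac (suc t) s (λ _ x → Ψ (foldUp x)) fallV
        fall-fits = fits (λ Rs les → pos (nest (suc t) Rs) (λ ls → Ψ≥0 lose)) (λ Rs les → fit-folded f Rs les) (fit-win f)

        depth : ℕ
        depth = Ds s

        D0≤depth : D 0 ℕ.≤ depth
        D0≤depth = D0≤DD (Dc s)

        calm-≤ : ∀ R → DD (D 0) ℕ.≤ R → okay ≤ ⟨ μ t R ⟩ λ e → Ψ (calm (m e) win)
        calm-≤ R le = begin
          (ν + num dropped) * VW
            ≡⟨ solve 5 (λ n d w k f → (n :+ d) :* w := n :* con 1ℚ :* w :+ (d :* w :+ k :* con 0ℚ :+ con 0ℚ)) refl ν (num dropped) VW (num killed) VW ⟩
          ν * 1ℚ * VW + (num dropped * VW + num killed * 0ℚ + 0ℚ)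
            ≡⟨ cong (λ e → ν * 1ℚ * VW + (num dropped * VW + num killed * 0ℚ + e)) (sym (trans (dot-scale fused 0ℚ (λ _ → 0ℚ)) (*-zeroˡ (dot fused (λ _ → 0ℚ))))) ⟩
          ν * 1ℚ * VW + (num dropped * VW + num killed * 0ℚ + dot fused (λ _ → 0ℚ * 0ℚ))
            ≤⟨ +-monoˡ-≤ _ (below-nest dirac {t = suc t} {φ = λ _ → Ψ win} still-bound (λ _ → Ψ≥0 win) (fit-win f) (R ∷ []) (ℕ.≤-trans (D-mono (D-mono ℕ.z≤n)) le ∷ [])) ⟩
          ⟨ μ (suc t) R ⟩ (λ _ → Ψ win) + (num dropped * VW + num killed * 0ℚ + dot fused (λ _ → 0ℚ * 0ℚ))
            ≤⟨ letters dirac (λ _ _ → Ψ win) (λ _ l → Ψ (calm l win)) (λ _ _ → Ψ≥0 win) (λ _ l → Ψ≥0 _) {D 0} ℕ.≤-refl VW≥0 ≤-refl (λ _ → ≤-refl)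
                 (fit-win f) (Ψ≥0 lose) (λ R′ Rs′ _ → pos (nest t (R′ ∷ Rs′)) (λ _ → Ψ≥0 lose)) R le ⟩
          ⟨ μ t R ⟩ (λ e → out (Ψ win) (λ l → Ψ (calm l win)) (m e))
            ≡⟨ ext (μ t R) (λ e → quieten (m e)) ⟩
          ⟨ μ t R ⟩ (λ e → Ψ (calm (m e) win)) ∎
          where
          open ≤-Reasoning
          open +-*-Solver
          quieten : ∀ l → out (Ψ win) (λ l → Ψ (calm l win)) l ≡ Ψ (calm l win)
          quieten quiet    = refl
          quieten vanish   = refl
          quieten kill     = refl
          quieten (fuse _) = refl

        Γ′ : ℚ
        Γ′ = dot c₊ (λ k → pw α (suc k)) + num (deads L)

        γ̂-≤ : num γ̂ ≤ Γ′
        γ̂-≤ = +-+ {A ⊗ mass A c₊} {deads L} (≤-trans (⊗-* {A} {mass A c₊} ≤-refl (dot-mass c₊ ≤-refl)) (≤-reflexive (sym (dot-scale c₊ α (pw α))))) ≤-refl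

        Γ-scale : ∀ q → dot c₊ (λ k → pw α (suc k) * q) + num (deads L) * q ≡ Γ′ * q
        Γ-scale q = trans (cong (_+ num (deads L) * q) (trans (dot-ext c₊ (λ k → *-comm (pw α (suc k)) q)) (trans (dot-scale c₊ q _) (*-comm q _))))
          (sym (*-distribʳ-+ q (dot c₊ (λ k → pw α (suc k))) (num (deads L))))

        -- The value of a fold when the first neighbour is quiet and unmerged with `i + 1` limbs,
        -- averaged over the second: either both merge, or the second one is of the kind counted by
        -- `Γ′` and the root wins.
        second : ℕ → ℚ
        second i = dot quiets (λ k → eval (clusterLaw (2 ℕ.+ (i ℕ.+ k))) fallV) + Γ′ * (pw α (suc i) * VW)

        second≥0 : ∀ i → 0ℚ ≤ second i
        second≥0 i = 0≤+ (dot-≥0 quiets (λ k → eval-≥0 (clusterLaw (2 ℕ.+ (i ℕ.+ k))) fallV≥0))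
          (0≤* (0≤+ (dot-≥0 c₊ (0≤α ∘ suc)) (0≤num (deads L))) (0≤* (0≤α (suc i)) VW≥0))

        mass-win : ∀ Rs → All (depth ℕ.≤_) Rs → pw α (length Rs) * VW ≤ ⟨ nest t Rs ⟩ (λ _ → Ψ win)
        mass-win Rs les = below-nest dirac {t = t} {φ = λ _ → Ψ win} bound (λ _ → Ψ≥0 win) (fit-win f) Rs (raise D0≤depth les)

        opponent : ∀ Q Qs R → All (depth ℕ.≤_) (Q ∷ Qs) → D depth ℕ.≤ R →
                   second (length Qs) ≤ ⟨ nest t (Q ∷ Qs) ⟩ λ xs → ⟨ μ t R ⟩ λ e → Ψ (duel m (single xs) quiet (X t e) (m e))
        opponent Q Qs R qles le = ≤-trans
          (≤-reflexive (cong (dot quiets (λ k → eval (clusterLaw (2 ℕ.+ (i ℕ.+ k))) fallV) +_) (sym (Γ-scale (pw α (suc i) * VW)))))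
          (quiet-states (nest t (Q ∷ Qs)) (λ xs y l → Ψ (duel m (single xs) quiet y l)) (λ _ _ _ → Ψ≥0 _) {depth} D0≤depth
            (λ k → eval-≥0 (clusterLaw (2 ℕ.+ (i ℕ.+ k))) fallV≥0) (λ k → 0≤* (0≤α (suc k)) (0≤* (0≤α (suc i)) VW≥0)) (0≤* (0≤α (suc i)) VW≥0)
            (λ S Ss sles → subst₂ _≤_
              (cong (λ k → eval (clusterLaw k) fallV) (trans (length-++ (Q ∷ Qs)) (cong suc (ℕ.+-suc i (length Ss)))))
              (nest-++ t (Q ∷ Qs) (S ∷ Ss) (λ ls → Ψ (foldUp (clusterOf m ls))))
              (clusters-claim dirac s (λ _ x → Ψ (foldUp x)) fallV fallV≥0 (λ _ x → Ψ≥0 _) fall-fits ((Q ∷ Qs) ++ (S ∷ Ss)) (raise Dc≤Ds (++⁺ qles sles))))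
            (λ S Ss sles → below-nest (nest t (Q ∷ Qs)) {t = t} {φ = λ _ → Ψ win} bound (λ _ → Ψ≥0 win) (mass-win (Q ∷ Qs) qles) (S ∷ Ss) (raise D0≤depth sles))
            (mass-win (Q ∷ Qs) qles) R le)
          where i = length Qs

        -- The two neighbours are averaged one after the other by `quiet-states`. A win in which the
        -- first neighbour is cut is dropped, which only lowers the bound.
        duel-≤ : ∀ R R′ → D depth ℕ.≤ R → D depth ℕ.≤ R′ →
                 dot quiets second + Γ′ * okay ≤ ⟨ μ t R ⟩ λ e → ⟨ μ t R′ ⟩ λ e′ → Ψ (duel m (X t e) (m e) (X t e′) (m e′))
        duel-≤ R R′ le le′ = ≤-trans
          (≤-reflexive (cong (dot quiets second +_) (sym (Γ-scale okay))))
          (quiet-states dirac (λ _ x l → ⟨ μ t R′ ⟩ λ e′ → Ψ (duel m x l (X t e′) (m e′))) (λ _ x l → pos (μ t R′) (λ _ → Ψ≥0 _)) {depth} D0≤depth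
            second≥0 (λ k → 0≤* (0≤α (suc k)) okay≥0) okay≥0
            (λ S Ss sles → opponent S Ss R′ sles le′)
            (λ S Ss sles → below-nest dirac {t = t} {φ = λ _ → ⟨ μ t R′ ⟩ λ e → Ψ (calm (m e) win)} bound (λ _ → pos (μ t R′) (λ _ → Ψ≥0 _)) calm′ (S ∷ Ss) (raise D0≤depth sles))
            calm′ R le)
          where
          calm′ : okay ≤ ⟨ μ t R′ ⟩ λ e → Ψ (calm (m e) win)
          calm′ = calm-≤ R′ (ℕ.≤-trans (ℕ.≤-trans (D-mono (D-mono (D-mono ℕ.z≤n))) (ℕ.≤-trans (DD≥ (Dc s)) (D≥ depth))) le′)

        W : RootValues
        W = rootValues
          (λ { 0 → VW ; 1 → okay ; 2 → num r * (dot quiets second + Γ′ * okay) + num r̄ * eval (singleLaw 2) stayV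
             ; (suc (suc (suc k))) → num ρ̄ * eval (singleLaw (3 ℕ.+ k)) stayV })
          (λ { 0 → VW ; 1 → okay ; (suc (suc k)) → eval (clusterLaw (2 ℕ.+ k)) stayV })
          (λ { 0 → 0ℚ ; 1 → 0ℚ ; (suc (suc k)) → eval (clusterLaw (2 ℕ.+ k)) fallV })
          VW

        Γ≥0 : 0ℚ ≤ Γ′
        Γ≥0 = 0≤+ (dot-≥0 c₊ (0≤α ∘ suc)) (0≤num (deads L))

        W≥0 : RootNonNeg W
        W≥0 = rootNonNeg
          (λ { 0 → VW≥0 ; 1 → okay≥0
             ; 2 → 0≤+ (0≤* (0≤num r) (0≤+ (dot-≥0 quiets second≥0) (0≤* Γ≥0 okay≥0))) (0≤* (0≤num r̄) (eval-≥0 (singleLaw 2) stayV≥0))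
             ; (suc (suc (suc k))) → 0≤* (0≤num ρ̄) (eval-≥0 (singleLaw (3 ℕ.+ k)) stayV≥0) })
          (λ { 0 → VW≥0 ; 1 → okay≥0 ; (suc (suc k)) → eval-≥0 (clusterLaw (2 ℕ.+ k)) stayV≥0 })
          (λ { 0 → ≤-refl ; 1 → ≤-refl ; (suc (suc k)) → eval-≥0 (clusterLaw (2 ℕ.+ k)) fallV≥0 })
          VW≥0

        steady : ∀ {x y} → (∀ c → rootStep (X t) m c x ≡ y) → ∀ {v} → v ≤ Ψ y → v ≤ ⟨ coin t ⟩ (λ c → Ψ (rootStep (X t) m c x))
        steady {x} {y} e le = ≤-trans le (≤-reflexive (sym (trans (ext (coin t) (λ c → cong Ψ (e c))) (const₁ (coin t) (coin-normalised t) (Ψ y)))))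

        Ψ′ : Root → ℚ
        Ψ′ x = ⟨ coin t ⟩ λ c → Ψ (rootStep (X t) m c x)

        Ψ′≥0 : ∀ x → 0ℚ ≤ Ψ′ x
        Ψ′≥0 x = coin-≥0 (λ c → Ψ≥0 _)

        DDD0≤ : ∀ {R} → D depth ℕ.≤ R → DD (D 0) ℕ.≤ R
        DDD0≤ = ℕ.≤-trans (ℕ.≤-trans (D-mono (D-mono (D-mono ℕ.z≤n))) (ℕ.≤-trans (DD≥ (Dc s)) (D≥ depth)))

        stays : ∀ Rs → All (D depth ℕ.≤_) Rs → eval (singleLaw (length Rs)) stayV ≤ ⟨ nest t Rs ⟩ λ ls → Ψ (wrap (singleOf m ls))
        stays Rs les = singles-claim dirac s (λ _ x → Ψ (wrap x)) stayV s≥ stayV≥0 (λ _ x → Ψ≥0 _) stay-fits Rs (raise (D≥ depth) les)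

        fits′ : RootFits t (D depth) Ψ′ W
        fit-rootSingle fits′ [] _ = steady {rootSingle []} (λ c → refl) (fit-win f)
        fit-rootSingle fits′ (R ∷ []) (le ∷ []) = ≤-trans (calm-≤ R (DDD0≤ le)) (mono (μ t R) λ e → steady {rootSingle (e ∷ [])} (λ c → refl) ≤-refl)
        fit-rootSingle fits′ (R ∷ R′ ∷ []) (le ∷ le′ ∷ []) = begin
          num r * (dot quiets second + Γ′ * okay) + num r̄ * eval (singleLaw 2) stayV
            ≤⟨ +-mono-≤ (*-monoʳ (0≤num r) (duel-≤ R R′ le le′)) (*-monoʳ (0≤num r̄) (stays (R ∷ R′ ∷ []) (le ∷ le′ ∷ []))) ⟩
          num r * ⟨ N ⟩ (λ (e , e′) → Ψ (duel m (X t e) (m e) (X t e′) (m e′))) + num r̄ * ⟨ N ⟩ (λ (e , e′) → Ψ (wrap (singleOf m (e ∷ e′ ∷ []))))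
            ≡⟨ sym (trans (add N _ _) (cong₂ _+_ (scale N (num r) (λ (e , e′) → Ψ (duel m (X t e) (m e) (X t e′) (m e′)))) (scale N (num r̄) (λ (e , e′) → Ψ (wrap (singleOf m (e ∷ e′ ∷ []))))))) ⟩
          ⟨ N ⟩ (λ (e , e′) → num r * Ψ (duel m (X t e) (m e) (X t e′) (m e′)) + num r̄ * Ψ (wrap (singleOf m (e ∷ e′ ∷ []))))
            ≤⟨ mono N (λ (e , e′) → ≤-coin-fold-or t (Ψ≥0 _) ≤-refl ≤-refl ≤-refl) ⟩
          ⟨ N ⟩ (λ (e , e′) → Ψ′ (rootSingle (e ∷ e′ ∷ []))) ∎
          where
          open ≤-Reasoning
          N = μ t R ⊠ μ t R′
        fit-rootSingle fits′ Rs@(R ∷ R′ ∷ R″ ∷ Rs′) les = ≤-trans (*-monoʳ (0≤num ρ̄) (stays Rs les))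
          (≤-trans (≤-reflexive (sym (scale (nest t Rs) (num ρ̄) (λ ls → Ψ (wrap (singleOf m ls))))))
            (mono (μ t R) λ p → mono (μ t R′) λ p′ → mono (μ t R″) λ p″ → mono (nest t Rs′) λ ls → ≤-coin-not-cut t (Ψ≥0 _) (λ c → Ψ≥0 _) ≤-refl ≤-refl))
        fit-rootCluster fits′ [] _ = steady {rootCluster []} (λ c → refl) (fit-win f)
        fit-rootCluster fits′ (R ∷ []) (le ∷ []) = ≤-trans (calm-≤ R (DDD0≤ le)) (mono (μ t R) λ e → steady {rootCluster (e ∷ [])} (λ c → refl) ≤-refl)
        fit-rootCluster fits′ Rs@(R ∷ R′ ∷ Rs′) les = ≤-trans
          (clusters-claim dirac s (λ _ x → Ψ (wrap x)) stayV stayV≥0 (λ _ x → Ψ≥0 _) stay-fits Rs (raise (ℕ.≤-trans Dc≤Ds (D≥ depth)) les))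
          (mono (μ t R) λ p → mono (μ t R′) λ p′ → mono (nest t Rs′) λ ls → steady {rootCluster (p ∷ p′ ∷ ls)} (λ c → refl) ≤-refl)
        fit-folded fits′ [] _ = Ψ′≥0 (folded [])
        fit-folded fits′ (R ∷ []) _ = pos (μ t R) (λ e → Ψ′≥0 (folded (e ∷ [])))
        fit-folded fits′ Rs@(R ∷ R′ ∷ Rs′) les = ≤-trans
          (clusters-claim dirac s (λ _ x → Ψ (foldUp x)) fallV fallV≥0 (λ _ x → Ψ≥0 _) fall-fits Rs (raise (ℕ.≤-trans Dc≤Ds (D≥ depth)) les))
          (mono (μ t R) λ p → mono (μ t R′) λ p′ → mono (nest t Rs′) λ ls → steady {folded (p ∷ p′ ∷ ls)} (λ c → refl) ≤-refl)
        fit-win fits′ = steady {win} (λ c → refl) (fit-win f)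

        fold-≤ : eval foldLaw fallV + num duelWins * VW ≤ dot quiets second + Γ′ * okay
        fold-≤ = begin
          eval foldLaw fallV + num duelWins * VW
            ≤⟨ +-mono-≤ (≤-trans (eval-mix (conv quiets quiets) (λ k → clusterLaw (2 ℕ.+ k)) fallV≥0)
                 (dot-conv quiets quiets (λ k → eval-≥0 (clusterLaw (2 ℕ.+ k)) fallV≥0)))
                 (*-monoˡ VW≥0 (⊗-* {γ̂} {A ⊗ mass A quiets ℕ.+ calms} γ̂-≤
                   (+-+ {A ⊗ mass A quiets} {calms} (⊗-* {A} {mass A quiets} ≤-refl (dot-mass quiets ≤-refl)) (≤-reflexive (num-+ still dropped))))) ⟩
          Q + Γ′ * (α * dot quiets (pw α) + (ν + num dropped)) * VW
            ≡⟨ solve 5 (λ q g x o v → q :+ g :* (x :+ o) :* v := q :+ g :* v :* x :+ g :* (o :* v)) refl Q Γ′ (α * dot quiets (pw α)) (ν + num dropped) VW ⟩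
          Q + Γ′ * VW * (α * dot quiets (pw α)) + Γ′ * okay
            ≡⟨ cong (λ e → Q + e + Γ′ * okay) (trans (cong (Γ′ * VW *_) (sym (dot-scale quiets α (pw α)))) (trans (sym (dot-scale quiets (Γ′ * VW) (pw α ∘ suc)))
                 (dot-ext quiets (λ i → solve 3 (λ g v p → g :* v :* p := g :* (p :* v)) refl Γ′ VW (pw α (suc i)))))) ⟩
          Q + dot quiets (λ i → Γ′ * (pw α (suc i) * VW)) + Γ′ * okay
            ≡⟨ cong (_+ Γ′ * okay) (sym (dot-add quiets (λ i → dot quiets (λ k → eval (clusterLaw (2 ℕ.+ (i ℕ.+ k))) fallV)) (λ i → Γ′ * (pw α (suc i) * VW)))) ⟩
          dot quiets second + Γ′ * okay ∎
          where
          open ≤-Reasoning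
          open +-*-Solver
          Q = dot quiets (λ i → dot quiets (λ k → eval (clusterLaw (2 ℕ.+ (i ℕ.+ k))) fallV))

        -- Duality: pushing the law forward by one round and evaluating at `V` is bounded by
        -- evaluating the old law at the values `W` pulled back through the round.
        root-numeric : ∀ M → evalRoot (nextRoot M) V ≤ evalRoot M W
        root-numeric (rootLaw a c g w) = begin
          dot (singles stay) (onRootSingle V) + dot (clusters stay) (onRootCluster V) + dot (clusters fall) (onFolded V) + num (w ℕ.+ (a₀ ℕ.+ c₀′ ℕ.+ (a₁ ℕ.+ c₁) ⊗ calms ℕ.+ r ⊗ a₂ ⊗ duelWins ℕ.+ deads fall)) * VW
            ≤⟨ +-mono-≤ (+-monoˡ-≤ (dot (clusters fall) (onFolded V)) (p≤p+q {dot (singles stay) (onRootSingle V) + dot (clusters stay) (onRootCluster V)} (≤-reflexive (sym (*-zeroʳ (num (deads stay))))))) wins-≤ ⟩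
          eval stay stayV + dot (clusters fall) (onFolded V) + ((num w + (num a₀ + num c₀′ + (num a₁ + num c₁) * (ν + num dropped) + num r * num a₂ * num duelWins)) * VW + num (deads fall) * VW)
            ≡⟨ solve 4 (λ s x y z → s :+ x :+ (y :+ z) := s :+ (x :+ z) :+ y) refl (eval stay stayV) (dot (clusters fall) (onFolded V))
                 ((num w + (num a₀ + num c₀′ + (num a₁ + num c₁) * (ν + num dropped) + num r * num a₂ * num duelWins)) * VW) (num (deads fall) * VW) ⟩
          eval stay stayV + (dot (clusters fall) (onFolded V) + num (deads fall) * VW) + (num w + (num a₀ + num c₀′ + (num a₁ + num c₁) * (ν + num dropped) + num r * num a₂ * num duelWins)) * VW
            ≤⟨ +-monoˡ-≤ _ (+-mono-≤ stay-≤ fall-≤) ⟩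
          num r̄ * num a₂ * S₂ + num ρ̄ * S₃ + Cs + (num r * num a₂ * eval foldLaw fallV + Fs) + (num w + (num a₀ + num c₀′ + (num a₁ + num c₁) * (ν + num dropped) + num r * num a₂ * num duelWins)) * VW
            ≡⟨ solve 18 (λ r̄ a₂ S₂ ρ̄ S₃ C r e F w a₀ c₀ a₁ c₁ n d u v →
                 r̄ :* a₂ :* S₂ :+ ρ̄ :* S₃ :+ C :+ (r :* a₂ :* e :+ F) :+ (w :+ (a₀ :+ c₀ :+ (a₁ :+ c₁) :* (n :+ d) :+ r :* a₂ :* u)) :* v :=
                 a₀ :* v :+ (a₁ :* ((n :+ d) :* v) :+ (a₂ :* (r :* (e :+ u :* v) :+ r̄ :* S₂) :+ ρ̄ :* S₃)) :+ (c₀ :* v :+ (c₁ :* ((n :+ d) :* v) :+ C)) :+ F :+ w :* v) refl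
                 (num r̄) (num a₂) S₂ (num ρ̄) S₃ Cs (num r) (eval foldLaw fallV) Fs (num w) (num a₀) (num c₀′) (num a₁) (num c₁) ν (num dropped) (num duelWins) VW ⟩
          num a₀ * VW + (num a₁ * okay + (num a₂ * (num r * (eval foldLaw fallV + num duelWins * VW) + num r̄ * S₂) + num ρ̄ * S₃)) + (num c₀′ * VW + (num c₁ * okay + Cs)) + Fs + num w * VW
            ≤⟨ +-monoˡ-≤ (num w * VW) (+-monoˡ-≤ Fs (+-monoˡ-≤ (num c₀′ * VW + (num c₁ * okay + Cs)) (+-monoʳ-≤ (num a₀ * VW) (+-monoʳ-≤ (num a₁ * okay)
                 (+-mono-≤ (*-monoʳ (0≤num a₂) (+-monoˡ-≤ (num r̄ * S₂) (*-monoʳ (0≤num r) fold-≤))) (≤-reflexive (sym (dot-scale (drop 3 a) (num ρ̄) _)))))))) ⟩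
          num a₀ * VW + (num a₁ * okay + (num a₂ * onRootSingle W 2 + dot (drop 3 a) (λ k → onRootSingle W (3 ℕ.+ k)))) + (num c₀′ * VW + (num c₁ * okay + Cs)) + Fs + num w * VW
            ≡⟨ sym (cong (_+ num w * VW) (cong₂ _+_ (cong₂ _+_ (split₃ a) (dot-split₂ c (onRootCluster W))) folds)) ⟩
          evalRoot (rootLaw a c g w) W ∎
          where
          open ≤-Reasoning
          open +-*-Solver
          a₀ = nth a 0
          a₁ = nth a 1
          a₂ = nth a 2
          c₀′ = nth c 0
          c₁ = nth c 1
          stay = r̄ ⊗ a₂ ⊙ singleLaw 2 ⊕ ρ̄ ⊙ mix (drop 3 a) (λ k → singleLaw (3 ℕ.+ k)) ⊕ mix (drop 2 c) (λ k → clusterLaw (2 ℕ.+ k))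
          fall = r ⊗ a₂ ⊙ foldLaw ⊕ mix (drop 2 g) (λ k → clusterLaw (2 ℕ.+ k))
          S₂ = eval (singleLaw 2) stayV
          S₃ = dot (drop 3 a) (λ k → eval (singleLaw (3 ℕ.+ k)) stayV)
          Cs = dot (drop 2 c) (λ k → eval (clusterLaw (2 ℕ.+ k)) stayV)
          Fs = dot (drop 2 g) (λ k → eval (clusterLaw (2 ℕ.+ k)) fallV)
          split₃ : ∀ xs → dot xs (onRootSingle W) ≡ num (nth xs 0) * VW + (num (nth xs 1) * okay + (num (nth xs 2) * onRootSingle W 2 + dot (drop 3 xs) (λ k → onRootSingle W (3 ℕ.+ k))))
          split₃ []           = trans (dot-split₂ [] (onRootSingle W)) (cong (λ e → num 0 * VW + (num 0 * okay + e)) (dot-split [] (λ k → onRootSingle W (2 ℕ.+ k))))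
          split₃ (x ∷ [])     = trans (dot-split₂ (x ∷ []) (onRootSingle W)) (cong (λ e → num x * VW + (num 0 * okay + e)) (dot-split [] (λ k → onRootSingle W (2 ℕ.+ k))))
          split₃ (x ∷ y ∷ xs) = cong (λ e → num x * VW + (num y * okay + e)) (dot-split xs (λ k → onRootSingle W (2 ℕ.+ k)))
          folds : dot g (onFolded W) ≡ Fs
          folds = trans (dot-split₂ g (onFolded W)) (solve 3 (λ x y z → x :* con 0ℚ :+ (y :* con 0ℚ :+ z) := z) refl (num (nth g 0)) (num (nth g 1)) Fs)
          stay-≤ : eval stay stayV ≤ num r̄ * num a₂ * S₂ + num ρ̄ * S₃ + Cs
          stay-≤ = ≤-trans
            (≤-reflexive (trans (eval-⊕ (r̄ ⊗ a₂ ⊙ singleLaw 2 ⊕ ρ̄ ⊙ mix (drop 3 a) (λ k → singleLaw (3 ℕ.+ k))) (mix (drop 2 c) (λ k → clusterLaw (2 ℕ.+ k))) stayV)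
              (cong (_+ eval (mix (drop 2 c) (λ k → clusterLaw (2 ℕ.+ k))) stayV) (eval-⊕ (r̄ ⊗ a₂ ⊙ singleLaw 2) (ρ̄ ⊙ mix (drop 3 a) (λ k → singleLaw (3 ℕ.+ k))) stayV))))
            (+-mono-≤ (+-mono-≤ (≤-trans (eval-⊙ (r̄ ⊗ a₂) (singleLaw 2) stayV≥0) (*-monoˡ (eval-≥0 (singleLaw 2) stayV≥0) (num-⊗ r̄ a₂)))
              (≤-trans (eval-⊙ ρ̄ (mix (drop 3 a) (λ k → singleLaw (3 ℕ.+ k))) stayV≥0) (*-monoʳ (0≤num ρ̄) (eval-mix (drop 3 a) (λ k → singleLaw (3 ℕ.+ k)) stayV≥0))))
              (eval-mix (drop 2 c) (λ k → clusterLaw (2 ℕ.+ k)) stayV≥0))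
          fall-≤ : dot (clusters fall) (onFolded V) + num (deads fall) * VW ≤ num r * num a₂ * eval foldLaw fallV + Fs
          fall-≤ = ≤-trans (+-monoˡ-≤ (num (deads fall) * VW) (q≤p+q (dot-≥0 (singles fall) (λ _ → ≤-refl))))
            (≤-trans (≤-reflexive (eval-⊕ (r ⊗ a₂ ⊙ foldLaw) (mix (drop 2 g) (λ k → clusterLaw (2 ℕ.+ k))) fallV))
              (+-mono-≤ (≤-trans (eval-⊙ (r ⊗ a₂) foldLaw fallV≥0) (*-monoˡ (eval-≥0 foldLaw fallV≥0) (num-⊗ r a₂))) (eval-mix (drop 2 g) (λ k → clusterLaw (2 ℕ.+ k)) fallV≥0)))
          wins-≤ : num (w ℕ.+ (a₀ ℕ.+ c₀′ ℕ.+ (a₁ ℕ.+ c₁) ⊗ calms ℕ.+ r ⊗ a₂ ⊗ duelWins ℕ.+ deads fall)) * VW ≤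
                   (num w + (num a₀ + num c₀′ + (num a₁ + num c₁) * (ν + num dropped) + num r * num a₂ * num duelWins)) * VW + num (deads fall) * VW
          wins-≤ = ≤-trans (*-monoˡ VW≥0 (+-+ {w} {a₀ ℕ.+ c₀′ ℕ.+ (a₁ ℕ.+ c₁) ⊗ calms ℕ.+ r ⊗ a₂ ⊗ duelWins ℕ.+ deads fall} ≤-refl
            (+-+ {a₀ ℕ.+ c₀′ ℕ.+ (a₁ ℕ.+ c₁) ⊗ calms ℕ.+ r ⊗ a₂ ⊗ duelWins} {deads fall}
              (+-+ {a₀ ℕ.+ c₀′ ℕ.+ (a₁ ℕ.+ c₁) ⊗ calms} {r ⊗ a₂ ⊗ duelWins}
                (+-+ {a₀ ℕ.+ c₀′} {(a₁ ℕ.+ c₁) ⊗ calms} (≤-reflexive (num-+ a₀ c₀′)) (⊗-* {a₁ ℕ.+ c₁} {calms} (≤-reflexive (num-+ a₁ c₁)) (≤-reflexive (num-+ still dropped))))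
                (⊗-* {r ⊗ a₂} {duelWins} (num-⊗ r a₂) ≤-refl)) ≤-refl)))
            (≤-reflexive (solve 4 (λ w x d v → (w :+ (x :+ d)) :* v := (w :+ x) :* v :+ d :* v) refl (num w)
              (num a₀ + num c₀′ + (num a₁ + num c₁) * (ν + num dropped) + num r * num a₂ * num duelWins) (num (deads fall)) VW))

      root-advance : ∀ {Dᵣ} M → RootClaim t Dᵣ M → ∀ R → Dᵣ (D (Ds s)) ℕ.≤ R → evalRoot (nextRoot M) V ≤ ⟨ rootTrees R ⟩ λ (ℓ , es) → Ψ (Y (suc t) ℓ es)
      root-advance M rc R le = ≤-trans (root-numeric M) (≤-trans (rc (D depth) Ψ′ W W≥0 Ψ′≥0 fits′ R le)
        (≤-reflexive (sym (fresh-root-coin R t<H (λ x c → Ψ (rootStep (X t) m c x))))))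

    next-root-claim : ∀ {Dᵣ} M → RootClaim t Dᵣ M → RootClaim (suc t) (λ s → Dᵣ (D (Ds (s ℕ.⊔ DD 0)))) (nextRoot M)
    next-root-claim M rc s Ψ V V≥0 Ψ≥0 f = root-advance Ψ Ψ≥0 (ℕ.m≤n⊔m s (DD 0)) V V≥0 f⁺ M rc
      where
      weaken : ∀ {Rs} → All (s ℕ.⊔ DD 0 ℕ.≤_) Rs → All (s ℕ.≤_) Rs
      weaken = raise (ℕ.m≤m⊔n s (DD 0))
      f⁺ : RootFits (suc t) (s ℕ.⊔ DD 0) Ψ V
      f⁺ = rootFits (λ Rs les → fit-rootSingle f Rs (weaken les)) (λ Rs les → fit-rootCluster f Rs (weaken les))
                    (λ Rs les → fit-folded f Rs (weaken les)) (fit-win f)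

-- Iterating the rounds

isWin : Root → ℚ
isWin win = 1ℚ
isWin _   = 0ℚ

isWin≥0 : ∀ x → 0ℚ ≤ isWin x
isWin≥0 (rootSingle _)  = ≤-refl
isWin≥0 (rootCluster _) = ≤-refl
isWin≥0 (folded _)      = ≤-refl
isWin≥0 win             = 0≤1
isWin≥0 lose            = ≤-refl

record Bounds : Set where
  constructor bounds
  field
    survival : ℕ
    limbLaw  : Law
    atRoot   : RootLaw

open Bounds public

module Iteration (one : ℕ) .{{_ : NonZero one}} (foldRate cutRate : ℕ → ℕ) where

  advanceBounds : ℕ → Bounds → Bounds
  advanceBounds t (bounds A L M) = bounds still nextLaw (nextRoot M)
    where open Coefficients.Round one (foldRate t) (cutRate t) A L

  after : ℕ → Bounds
  after zero    = bounds one (law (0 ∷ 0 ∷ one ∷ []) [] 0) (rootLaw (0 ∷ 0 ∷ 0 ∷ one ∷ []) [] [] 0)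
  after (suc t) = advanceBounds t (after t)

  module Correct (valid : ∀ t → foldRate t ℕ.+ cutRate t ℕ.≤ one) (H : ℕ) where

    open Rounds one foldRate cutRate valid H
    open Steps one foldRate cutRate valid H
    open RootSteps one foldRate cutRate valid H

    record Stage (t : ℕ) (b : Bounds) : Set₁ where
      field
        D       : ℕ → ℕ
        D≥1     : ∀ s → 1 ℕ.≤ D s
        D≥      : ∀ s → s ℕ.≤ D s
        D-mono  : ∀ {s s′} → s ℕ.≤ s′ → D s ℕ.≤ D s′
        bound   : MassBound t (D 0) (survival b)
        claim   : Claim t D (limbLaw b)
        Dᵣ      : ℕ → ℕ
        atRoots : RootClaim t Dᵣ (atRoot b)

    start : Stage 0 (after 0)
    start = record
      { D = suc
      ; D≥1 = λ s → ℕ.s≤s ℕ.z≤n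
      ; D≥ = ℕ.n≤1+n
      ; D-mono = ℕ.s≤s
      ; bound = λ R _ → ≤-reflexive (trans num-one (sym (trees-normalised R)))
      ; claim = λ { C s Ψ V V≥0 Ψ≥0 f (suc R) (ℕ.s≤s le) → ≤-trans
          (≤-reflexive (trans (cong₂ (λ z o → z * onSingle V 0 + (z * onSingle V 1 + (o * onSingle V 2 + 0ℚ)) + 0ℚ + z * onDead V) num-zero num-one)
            (solve 4 (λ a b c d → con 0ℚ :* a :+ (con 0ℚ :* b :+ (con 1ℚ :* c :+ con 0ℚ)) :+ con 0ℚ :+ con 0ℚ :* d := c) refl
              (onSingle V 0) (onSingle V 1) (onSingle V 2) (onDead V))))
          (≤-trans (fit-single f (R ∷ R ∷ []) (le ∷ le ∷ []))
            (≤-reflexive (ext C λ γ → sym (const₁ (labels 0 H) (labels-normalised 0 H) _)))) }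
      ; Dᵣ = λ s → s
      ; atRoots = λ s Ψ V V≥0 Ψ≥0 f R le → ≤-trans
          (≤-reflexive (trans (cong₂ (λ z o → z * onRootSingle V 0 + (z * onRootSingle V 1 + (z * onRootSingle V 2 + (o * onRootSingle V 3 + 0ℚ))) + 0ℚ + 0ℚ + z * onWin V) num-zero num-one)
            (solve 5 (λ a b c d e → con 0ℚ :* a :+ (con 0ℚ :* b :+ (con 0ℚ :* c :+ (con 1ℚ :* d :+ con 0ℚ))) :+ con 0ℚ :+ con 0ℚ :+ con 0ℚ :* e := d) refl
              (onRootSingle V 0) (onRootSingle V 1) (onRootSingle V 2) (onRootSingle V 3) (onWin V))))
          (≤-trans (fit-rootSingle f (R ∷ R ∷ R ∷ []) (le ∷ le ∷ le ∷ []))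
            (≤-reflexive (sym (const₁ (labels 0 H) (labels-normalised 0 H) _))))
      }
      where open +-*-Solver

    proceed : ∀ {t} b → t ℕ.< H → Stage t b → Stage (suc t) (advanceBounds t b)
    proceed {t} (bounds A L M) t<H st = record
      { D = D⁺
      ; D≥1 = λ s → D≥1 _
      ; D≥ = λ s → ℕ.≤-trans (ℕ.m≤m⊔n s (DD 0)) (ℕ.≤-trans (D≥ _) (ℕ.≤-trans (DD≥ _) (ℕ.≤-trans (DD≥ _) (D≥ _))))
      ; D-mono = λ le → D-mono (D-mono (D-mono (D-mono (D-mono (D-mono (ℕ.⊔-monoˡ-≤ (DD 0) le))))))
      ; bound = λ R le → still-bound R (ℕ.≤-trans (ℕ.≤-trans (ℕ.m≤n⊔m 0 (DD 0)) (ℕ.≤-trans (D≥ _) (ℕ.≤-trans (DD≥ _) (ℕ.≤-trans (DD≥ _) (D≥ _))))) le)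
      ; claim = next-claim
      ; Dᵣ = λ s → Dᵣ (D (Ds (s ℕ.⊔ DD 0)))
      ; atRoots = next-root-claim M atRoots
      }
      where
      open Stage st
      open OneRound t<H {A} {L} {D} D≥1 D≥ D-mono bound claim
      open OneRootRound t<H {A} {L} {D} D≥1 D≥ D-mono bound claim

    stage : ∀ t → t ℕ.≤ H → Stage t (after t)
    stage zero    _   = start
    stage (suc t) t<H = proceed (after t) t<H (stage t (ℕ.<⇒≤ t<H))

    -- The root claim at the indicator of `win`. All other states have value zero, so stored limbs
    -- no longer matter and the depth demanded of them is zero.
    win-probability : Σ ℕ λ N → ∀ R → N ℕ.≤ R → num (wins (atRoot (after H))) ≤ ⟨ rootTrees R ⟩ λ (ℓ , es) → isWin (Y H ℓ es)
    win-probability = Stage.Dᵣ st 0 , λ R le → ≤-trans (only-wins (atRoot (after H)))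
      (Stage.atRoots st 0 isWin V (rootNonNeg (λ _ → ≤-refl) (λ _ → ≤-refl) (λ _ → ≤-refl) 0≤1) isWin≥0
        (rootFits (λ Rs _ → pos (nest H Rs) (λ _ → ≤-refl)) (λ Rs _ → pos (nest H Rs) (λ _ → ≤-refl)) (λ Rs _ → pos (nest H Rs) (λ _ → ≤-refl)) ≤-refl) R le)
      where
      st = stage H ℕ.≤-refl
      V : RootValues
      V = rootValues (λ _ → 0ℚ) (λ _ → 0ℚ) (λ _ → 0ℚ) 1ℚ
      only-wins : ∀ M → num (wins M) ≤ evalRoot M V
      only-wins (rootLaw s c f w) = ≤-trans (≤-reflexive (sym (*-identityʳ (num w))))
        (q≤p+q (0≤+ (0≤+ (dot-≥0 s (λ _ → ≤-refl)) (dot-≥0 c (λ _ → ≤-refl))) (dot-≥0 f (λ _ → ≤-refl))))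

-- Locality

Close : ℕ → Tree → Tree → Set
Close r T T′ = ∀ p → length p ℕ.< r → T p ≡ T′ p

data Near (r : ℕ) : State → State → Set where
  single  : ∀ {ls ls′} → Pointwise (Close r) ls ls′ → Near r (single ls) (single ls′)
  cluster : ∀ {ls ls′} → Pointwise (Close r) ls ls′ → Near r (cluster ls) (cluster ls′)
  dead    : Near r dead dead
  gone    : Near r gone gone

data NearLetter (r : ℕ) : Letter → Letter → Set where
  quiet  : NearLetter r quiet quiet
  vanish : NearLetter r vanish vanish
  kill   : NearLetter r kill kill
  fuse   : ∀ {ls ls′} → Pointwise (Close r) ls ls′ → NearLetter r (fuse ls) (fuse ls′)

data NearRoot (r : ℕ) : Root → Root → Set where
  rootSingle  : ∀ {ls ls′} → Pointwise (Close r) ls ls′ → NearRoot r (rootSingle ls) (rootSingle ls′)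
  rootCluster : ∀ {ls ls′} → Pointwise (Close r) ls ls′ → NearRoot r (rootCluster ls) (rootCluster ls′)
  folded      : ∀ {ls ls′} → Pointwise (Close r) ls ls′ → NearRoot r (folded ls) (folded ls′)
  win         : NearRoot r win win
  lose        : NearRoot r lose lose

Close-≤ : ∀ {r r′ T T′} → r ℕ.≤ r′ → Close r′ T T′ → Close r T T′
Close-≤ le c p p<r = c p (ℕ.≤-trans p<r le)

offer-near : ∀ {r x y} → Near r x y → NearLetter r (offer x) (offer y)
offer-near (single [])       = kill
offer-near (single (c ∷ cs)) = fuse (c ∷ cs)
offer-near (cluster _)       = kill
offer-near dead              = kill
offer-near gone              = kill

act-near : ∀ {r r′ X} → (∀ {T T′} → Close r′ T T′ → Near r (X T) (X T′)) →
           ∀ {x y} c → Near r′ x y → NearLetter r (act X x c) (act X y c)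
act-near h c    (single [])            = kill
act-near h fold (single (e ∷ []))      = offer-near (h e)
act-near h idle (single (e ∷ []))      = quiet
act-near h cut  (single (e ∷ []))      = quiet
act-near h fold (single (_ ∷ _ ∷ _))   = quiet
act-near h idle (single (_ ∷ _ ∷ _))   = quiet
act-near h cut  (single (_ ∷ _ ∷ _))   = vanish
act-near h c    (cluster [])           = kill
act-near h c    (cluster (_ ∷ _))      = quiet
act-near h c    dead                   = vanish
act-near h c    gone                   = quiet

keep-near : ∀ {r p p′ x y} → Close r p p′ → Near r x y → Near r (keep p x) (keep p′ y)
keep-near c (single cs)  = single (c ∷ cs)
keep-near c (cluster cs) = cluster (c ∷ cs)
keep-near c dead         = dead
keep-near c gone         = gone

attach-near : ∀ {r x x′ y y′} → Near r x x′ → Near r y y′ → Near r (attach x y) (attach x′ y′)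
attach-near (cluster cs) (single ds)  = cluster (PW.++⁺ cs ds)
attach-near (cluster cs) (cluster ds) = dead
attach-near (cluster cs) dead         = dead
attach-near (cluster cs) gone         = dead
attach-near (single _)   _            = dead
attach-near dead         _            = dead
attach-near gone         _            = dead

module _ {r r′ : ℕ} (r≤r′ : r ℕ.≤ r′) {m : Tree → Letter} (h : ∀ {T T′} → Close r′ T T′ → NearLetter r (m T) (m T′)) where

  clusterOf-near : ∀ {ls ls′} → Pointwise (Close r′) ls ls′ → Near r (clusterOf m ls) (clusterOf m ls′)
  clusterOf-near []                         = cluster []
  clusterOf-near {p ∷ _} {p′ ∷ _} (c ∷ cs) with m p | m p′ | h c
  ... | _ | _ | quiet  = keep-near (Close-≤ r≤r′ c) (clusterOf-near cs)
  ... | _ | _ | vanish = clusterOf-near cs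
  ... | _ | _ | kill   = dead
  ... | _ | _ | fuse _ = dead

module _ {r r′ r″ : ℕ} (r≤r′ : r ℕ.≤ r′) (r′≤r″ : r′ ℕ.≤ r″) {m : Tree → Letter} (h : ∀ {T T′} → Close r′ T T′ → NearLetter r (m T) (m T′))
         (h′ : ∀ {T T′} → Close r″ T T′ → NearLetter r′ (m T) (m T′)) where

  singleOf-near : ∀ {ls ls′} → Pointwise (Close r″) ls ls′ → Near r (singleOf m ls) (singleOf m ls′)
  singleOf-near []                         = single []
  singleOf-near {p ∷ _} {p′ ∷ _} (c ∷ cs) with m p | m p′ | h′ c
  ... | _ | _ | quiet   = keep-near (Close-≤ (ℕ.≤-trans r≤r′ r′≤r″) c) (singleOf-near cs)
  ... | _ | _ | vanish  = singleOf-near cs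
  ... | _ | _ | kill    = dead
  ... | _ | _ | fuse ds = attach-near (clusterOf-near r≤r′ h ds) (singleOf-near cs)

-- The depth to which trees must agree so that the limbs stored in their states agree to depth `r`.
-- A letter doubles this, as a folding vertex also reads its neighbour's state. A round reads three
-- layers of letters: the vertex's own, those of its limbs, and those of limbs received by fusion.
reach reach₂ : ℕ → ℕ → ℕ
reach zero    r = suc r
reach (suc t) r = reach₂ t (reach₂ t (reach₂ t r))
reach₂ t r = reach t (reach t r)

reach≥  : ∀ t r → suc r ℕ.≤ reach t r
reach₂≥ : ∀ t r → r ℕ.≤ reach₂ t r
reach≥ zero    r = ℕ.≤-refl
reach≥ (suc t) r = ℕ.≤-trans (s≤s (ℕ.≤-trans (reach₂≥ t r) (reach₂≥ t _))) (ℕ.≤-trans (s≤s (ℕ.<⇒≤ (reach≥ t _))) (reach≥ t _))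
reach₂≥ t r = ℕ.≤-trans (ℕ.<⇒≤ (reach≥ t r)) (ℕ.<⇒≤ (reach≥ t (reach t r)))

X-near      : ∀ t r {T T′} → Close (reach t r) T T′ → Near r (X t T) (X t T′)
letter-near : ∀ t r {T T′} → Close (reach₂ t r) T T′ → NearLetter r (letter t T) (letter t T′)

X-near zero    r c = single ((λ p p<r → c (false ∷ p) (s≤s p<r)) ∷ (λ p p<r → c (true ∷ p) (s≤s p<r)) ∷ [])
X-near (suc t) r c = next-near (letter-near t (reach₂ t (reach₂ t r)) c) (X-near t (reach₂ t (reach₂ t r)) (Close-≤ (ℕ.<⇒≤ (reach≥ t _)) c))
  where
  next-near : ∀ {r′ l l′ x y} → NearLetter r′ l l′ → Near (reach₂ t (reach₂ t r)) x y → Near r (next (letter t) l x) (next (letter t) l′ y)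
  next-near quiet    (single cs)  = singleOf-near (reach₂≥ t r) (reach₂≥ t _) (letter-near t r) (letter-near t (reach₂ t r)) cs
  next-near quiet    (cluster cs) = clusterOf-near (reach₂≥ t r) (letter-near t r) (PW.map (Close-≤ (reach₂≥ t _)) cs)
  next-near quiet    dead         = gone
  next-near quiet    gone         = gone
  next-near vanish   _            = gone
  next-near kill     _            = gone
  next-near (fuse _) _            = gone
letter-near t r {T} {T′} c rewrite c [] (ℕ.≤-trans (s≤s z≤n) (reach≥ t (reach t r))) =
  act-near (X-near t r) (label T′ t) (X-near t (reach t r) c)

calm-near : ∀ {r r′ l l′ x y} → NearLetter r′ l l′ → NearRoot r x y → NearRoot r (calm l x) (calm l′ y)
calm-near quiet    n = n
calm-near vanish   n = n
calm-near kill     n = lose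
calm-near (fuse _) n = lose

wrap-near : ∀ {r x y} → Near r x y → NearRoot r (wrap x) (wrap y)
wrap-near (single cs)  = rootSingle cs
wrap-near (cluster cs) = rootCluster cs
wrap-near dead         = lose
wrap-near gone         = lose

foldUp-near : ∀ {r x y} → Near r x y → NearRoot r (foldUp x) (foldUp y)
foldUp-near (single cs)  = lose
foldUp-near (cluster cs) = folded cs
foldUp-near dead         = win
foldUp-near gone         = lose

both-near : ∀ {r r′ l l′ k k′ x y} → NearLetter r′ l l′ → NearLetter r′ k k′ → NearRoot r x y → NearRoot r (both l k x) (both l′ k′ y)
both-near quiet    quiet    n = n
both-near quiet    vanish   n = lose
both-near quiet    kill     n = lose
both-near quiet    (fuse _) n = lose
both-near vanish   _        n = lose
both-near kill     _        n = lose
both-near (fuse _) _        n = lose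

duel-near : ∀ {r r′ r″ m} → (∀ {ls ls′} → Pointwise (Close r′) ls ls′ → Near r (clusterOf m ls) (clusterOf m ls′)) →
            ∀ {x x′ y y′ l l′ k k′} → Near r′ x x′ → NearLetter r″ l l′ → Near r′ y y′ → NearLetter r″ k k′ →
            NearRoot r (duel m x l y k) (duel m x′ l′ y′ k′)
duel-near h (single (c ∷ cs)) a (single (d ∷ ds)) b = both-near a b (foldUp-near (h (c ∷ PW.++⁺ cs (d ∷ ds))))
duel-near h (single (c ∷ cs)) a (single [])       b = calm-near a (calm-near b win)
duel-near h (single (c ∷ cs)) a (cluster _)       b = calm-near a (calm-near b win)
duel-near h (single (c ∷ cs)) a dead              b = calm-near a (calm-near b win)
duel-near h (single (c ∷ cs)) a gone              b = calm-near a (calm-near b win)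
duel-near h (single [])       a _                 b = calm-near a (calm-near b win)
duel-near h (cluster _)       a _                 b = calm-near a (calm-near b win)
duel-near h dead              a _                 b = calm-near a (calm-near b win)
duel-near h gone              a _                 b = calm-near a (calm-near b win)

rootStep-near : ∀ t r c {x y} → NearRoot (reach₂ t (reach₂ t r)) x y →
                NearRoot r (rootStep (X t) (letter t) c x) (rootStep (X t) (letter t) c y)
rootStep-near t r = go
  where
  far = reach₂ t (reach₂ t r)
  letters-near : ∀ {T T′} → Close far T T′ → NearLetter (reach₂ t r) (letter t T) (letter t T′)
  letters-near = letter-near t (reach₂ t r)
  clusters-near : ∀ {ls ls′} → Pointwise (Close (reach₂ t r)) ls ls′ → Near r (clusterOf (letter t) ls) (clusterOf (letter t) ls′)
  clusters-near = clusterOf-near (reach₂≥ t r) (letter-near t r)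
  wide : ∀ {ls ls′} → Pointwise (Close far) ls ls′ → Near r (clusterOf (letter t) ls) (clusterOf (letter t) ls′)
  wide cs = clusters-near (PW.map (Close-≤ (reach₂≥ t _)) cs)
  singles-near : ∀ {ls ls′} → Pointwise (Close far) ls ls′ → Near r (singleOf (letter t) ls) (singleOf (letter t) ls′)
  singles-near = singleOf-near (reach₂≥ t r) (reach₂≥ t _) (letter-near t r) (letter-near t (reach₂ t r))
  states-near : ∀ {T T′} → Close far T T′ → Near (reach₂ t r) (X t T) (X t T′)
  states-near c = X-near t (reach₂ t r) (Close-≤ (ℕ.<⇒≤ (reach≥ t _)) c)
  go : ∀ c {x y} → NearRoot far x y → NearRoot r (rootStep (X t) (letter t) c x) (rootStep (X t) (letter t) c y)
  go c    (rootSingle [])                = win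
  go c    (rootSingle (e ∷ []))          = calm-near (letters-near e) win
  go fold (rootSingle (e ∷ f ∷ []))      = duel-near clusters-near (states-near e) (letters-near e) (states-near f) (letters-near f)
  go idle (rootSingle (e ∷ f ∷ []))      = wrap-near (singles-near (e ∷ f ∷ []))
  go cut  (rootSingle (e ∷ f ∷ []))      = wrap-near (singles-near (e ∷ f ∷ []))
  go cut  (rootSingle (e ∷ f ∷ g ∷ ls))  = lose
  go idle (rootSingle (e ∷ f ∷ g ∷ ls))  = wrap-near (singles-near (e ∷ f ∷ g ∷ ls))
  go fold (rootSingle (e ∷ f ∷ g ∷ ls))  = wrap-near (singles-near (e ∷ f ∷ g ∷ ls))
  go c    (rootCluster [])               = win
  go c    (rootCluster (e ∷ []))         = calm-near (letters-near e) win
  go c    (rootCluster (e ∷ f ∷ ls))     = wrap-near (wide (e ∷ f ∷ ls))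
  go c    (folded [])                    = lose
  go c    (folded (e ∷ []))              = lose
  go c    (folded (e ∷ f ∷ ls))          = foldUp-near (wide (e ∷ f ∷ ls))
  go c    win                            = win
  go c    lose                           = lose

rootReach : ℕ → ℕ → ℕ
rootReach zero    r = r
rootReach (suc t) r = rootReach t (reach₂ t (reach₂ t r))

Y-near : ∀ t r ℓ {es es′} → Pointwise (Close (rootReach t r)) es es′ → NearRoot r (Y t ℓ es) (Y t ℓ es′)
Y-near zero    r ℓ cs = rootSingle cs
Y-near (suc t) r ℓ cs = rootStep-near t r (ℓ t) (Y-near t (reach₂ t (reach₂ t r)) ℓ cs)

isWin-near : ∀ {r x y} → NearRoot r x y → isWin x ≡ isWin y
isWin-near (rootSingle _)  = refl
isWin-near (rootCluster _) = refl
isWin-near (folded _)      = refl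
isWin-near win             = refl
isWin-near lose            = refl

-- Exclusivity

infix 4 _≋_ _≋ᴿ_

-- Equality up to the order of limbs: the folding vertex and the merged ones list the limbs of their
-- cluster in different orders, and the order of a vertex's own limbs depends on the edge from which
-- it is viewed.
data _≋_ : State → State → Set where
  single  : ∀ {ls ls′} → ls ↭ ls′ → single ls ≋ single ls′
  cluster : ∀ {ls ls′} → ls ↭ ls′ → cluster ls ≋ cluster ls′
  dead    : dead ≋ dead
  gone    : gone ≋ gone

≋-refl : ∀ x → x ≋ x
≋-refl (single _)  = single ↭-refl
≋-refl (cluster _) = cluster ↭-refl
≋-refl dead        = dead
≋-refl gone        = gone

≋-trans : ∀ {x y z} → x ≋ y → y ≋ z → x ≋ z
≋-trans (single p)  (single q)  = single (↭-trans p q)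
≋-trans (cluster p) (cluster q) = cluster (↭-trans p q)
≋-trans dead        dead        = dead
≋-trans gone        gone        = gone

keep-≋ : ∀ p {x y} → x ≋ y → keep p x ≋ keep p y
keep-≋ p (single q)  = single (prep p q)
keep-≋ p (cluster q) = cluster (prep p q)
keep-≋ p dead        = dead
keep-≋ p gone        = gone

keep-swap : ∀ p q {x y} → x ≋ y → keep p (keep q x) ≋ keep q (keep p y)
keep-swap p q (single r)  = single (swap p q r)
keep-swap p q (cluster r) = cluster (swap p q r)
keep-swap p q dead        = dead
keep-swap p q gone        = gone

attach-≋ : ∀ a {x y} → x ≋ y → attach a x ≋ attach a y
attach-≋ (cluster qs) (single r)  = cluster (++⁺ˡ qs r)
attach-≋ (cluster qs) (cluster r) = dead
attach-≋ (cluster qs) dead        = dead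
attach-≋ (cluster qs) gone        = dead
attach-≋ (single _)   r           = dead
attach-≋ dead         r           = dead
attach-≋ gone         r           = dead

attach-dead : ∀ a → attach a dead ≡ dead
attach-dead (single _)  = refl
attach-dead (cluster _) = refl
attach-dead dead        = refl
attach-dead gone        = refl

-- `attach` accepts only an unmerged second argument and never returns one; hence simultaneous
-- fusions kill in either order.
attach-twice : ∀ a b x → attach a (attach b x) ≡ dead
attach-twice (single _)  b x = refl
attach-twice dead        b x = refl
attach-twice gone        b x = refl
attach-twice (cluster _) (single _)  x           = refl
attach-twice (cluster _) dead        x           = refl
attach-twice (cluster _) gone        x           = refl
attach-twice (cluster _) (cluster _) (single _)  = refl
attach-twice (cluster _) (cluster _) (cluster _) = refl
attach-twice (cluster _) (cluster _) dead        = refl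
attach-twice (cluster _) (cluster _) gone        = refl

attach-keep : ∀ a q {x y} → x ≋ y → attach a (keep q x) ≋ keep q (attach a y)
attach-keep (cluster qs) q (single {ls} {ls′} r) = cluster (↭-trans (Perm.shift q qs ls) (prep q (++⁺ˡ qs r)))
attach-keep (cluster qs) q (cluster r) = dead
attach-keep (cluster qs) q dead        = dead
attach-keep (cluster qs) q gone        = dead
attach-keep (single _)   q r           = dead
attach-keep dead         q r           = dead
attach-keep gone         q r           = dead

trySingle-≋ : ∀ m l p {x y} → x ≋ y → trySingle m l p x ≋ trySingle m l p y
trySingle-≋ m quiet     p r = keep-≋ p r
trySingle-≋ m vanish    p r = r
trySingle-≋ m kill      p r = dead
trySingle-≋ m (fuse ps) p r = attach-≋ (clusterOf m ps) r

≋-reflexive : ∀ {x y} → x ≡ y → x ≋ y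
≋-reflexive {x} refl = ≋-refl x

≋-sym : ∀ {x y} → x ≋ y → y ≋ x
≋-sym (single p)  = single (↭-sym p)
≋-sym (cluster p) = cluster (↭-sym p)
≋-sym dead        = dead
≋-sym gone        = gone

trySingle-swap : ∀ m l l′ p q {x y} → x ≋ y → trySingle m l p (trySingle m l′ q x) ≋ trySingle m l′ q (trySingle m l p y)
trySingle-swap m quiet     quiet     p q r = keep-swap p q r
trySingle-swap m quiet     vanish    p q r = keep-≋ p r
trySingle-swap m quiet     kill      p q r = dead
trySingle-swap m quiet     (fuse qs) p q r = ≋-sym (attach-keep (clusterOf m qs) p (≋-sym r))
trySingle-swap m vanish    l′        p q r = trySingle-≋ m l′ q r
trySingle-swap m kill      quiet     p q r = dead
trySingle-swap m kill      vanish    p q r = dead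
trySingle-swap m kill      kill      p q r = dead
trySingle-swap m kill      (fuse qs) p q r = ≋-reflexive (sym (attach-dead (clusterOf m qs)))
trySingle-swap m (fuse ps) quiet     p q r = attach-keep (clusterOf m ps) q r
trySingle-swap m (fuse ps) vanish    p q r = attach-≋ (clusterOf m ps) r
trySingle-swap m (fuse ps) kill      p q r = ≋-reflexive (attach-dead (clusterOf m ps))
trySingle-swap m (fuse ps) (fuse qs) p q {x} {y} r =
  ≋-reflexive (trans (attach-twice (clusterOf m ps) (clusterOf m qs) x) (sym (attach-twice (clusterOf m qs) (clusterOf m ps) y)))

singleOf-≋ : ∀ m {ls ls′} → ls ↭ ls′ → singleOf m ls ≋ singleOf m ls′
singleOf-≋ m Perm.refl        = ≋-refl _
singleOf-≋ m (prep p r)       = trySingle-≋ m (m p) p (singleOf-≋ m r)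
singleOf-≋ m (swap p q r)     = trySingle-swap m (m p) (m q) p q (singleOf-≋ m r)
singleOf-≋ m (Perm.trans r s) = ≋-trans (singleOf-≋ m r) (singleOf-≋ m s)

tryCluster-≋ : ∀ l p {x y} → x ≋ y → tryCluster l p x ≋ tryCluster l p y
tryCluster-≋ quiet    p r = keep-≋ p r
tryCluster-≋ vanish   p r = r
tryCluster-≋ kill     p r = dead
tryCluster-≋ (fuse _) p r = dead

tryCluster-swap : ∀ l l′ p q {x y} → x ≋ y → tryCluster l p (tryCluster l′ q x) ≋ tryCluster l′ q (tryCluster l p y)
tryCluster-swap quiet    quiet    p q r = keep-swap p q r
tryCluster-swap quiet    vanish   p q r = keep-≋ p r
tryCluster-swap quiet    kill     p q r = dead
tryCluster-swap quiet    (fuse _) p q r = dead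
tryCluster-swap vanish   l′       p q r = tryCluster-≋ l′ q r
tryCluster-swap kill     quiet    p q r = dead
tryCluster-swap kill     vanish   p q r = dead
tryCluster-swap kill     kill     p q r = dead
tryCluster-swap kill     (fuse _) p q r = dead
tryCluster-swap (fuse _) quiet    p q r = dead
tryCluster-swap (fuse _) vanish   p q r = dead
tryCluster-swap (fuse _) kill     p q r = dead
tryCluster-swap (fuse _) (fuse _) p q r = dead

clusterOf-≋ : ∀ m {ls ls′} → ls ↭ ls′ → clusterOf m ls ≋ clusterOf m ls′
clusterOf-≋ m Perm.refl        = ≋-refl _
clusterOf-≋ m (prep p r)       = tryCluster-≋ (m p) p (clusterOf-≋ m r)
clusterOf-≋ m (swap p q r)     = tryCluster-swap (m p) (m q) p q (clusterOf-≋ m r)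
clusterOf-≋ m (Perm.trans r s) = ≋-trans (clusterOf-≋ m r) (clusterOf-≋ m s)

data _≋ᴿ_ : Root → Root → Set where
  rootSingle  : ∀ {ls ls′} → ls ↭ ls′ → rootSingle ls ≋ᴿ rootSingle ls′
  rootCluster : ∀ {ls ls′} → ls ↭ ls′ → rootCluster ls ≋ᴿ rootCluster ls′
  folded      : ∀ {ls ls′} → ls ↭ ls′ → folded ls ≋ᴿ folded ls′
  win         : win ≋ᴿ win
  lose        : lose ≋ᴿ lose

≋ᴿ-refl : ∀ x → x ≋ᴿ x
≋ᴿ-refl (rootSingle _)  = rootSingle ↭-refl
≋ᴿ-refl (rootCluster _) = rootCluster ↭-refl
≋ᴿ-refl (folded _)      = folded ↭-refl
≋ᴿ-refl win             = win
≋ᴿ-refl lose            = lose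

≋ᴿ-reflexive : ∀ {x y} → x ≡ y → x ≋ᴿ y
≋ᴿ-reflexive {x} refl = ≋ᴿ-refl x

wrap-≋ : ∀ {x y} → x ≋ y → wrap x ≋ᴿ wrap y
wrap-≋ (single r)  = rootSingle r
wrap-≋ (cluster r) = rootCluster r
wrap-≋ dead        = lose
wrap-≋ gone        = lose

foldUp-≋ : ∀ {x y} → x ≋ y → foldUp x ≋ᴿ foldUp y
foldUp-≋ (single r)  = lose
foldUp-≋ (cluster r) = folded r
foldUp-≋ dead        = win
foldUp-≋ gone        = lose

calm-comm : ∀ l l′ → calm l (calm l′ win) ≡ calm l′ (calm l win)
calm-comm quiet    l′       = refl
calm-comm vanish   l′       = refl
calm-comm kill     quiet    = refl
calm-comm kill     vanish   = refl
calm-comm kill     kill     = refl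
calm-comm kill     (fuse _) = refl
calm-comm (fuse _) quiet    = refl
calm-comm (fuse _) vanish   = refl
calm-comm (fuse _) kill     = refl
calm-comm (fuse _) (fuse _) = refl

both-≋ : ∀ l l′ {x y} → x ≋ᴿ y → both l l′ x ≋ᴿ both l′ l y
both-≋ quiet    quiet    r = r
both-≋ quiet    vanish   r = lose
both-≋ quiet    kill     r = lose
both-≋ quiet    (fuse _) r = lose
both-≋ vanish   quiet    r = lose
both-≋ vanish   vanish   r = lose
both-≋ vanish   kill     r = lose
both-≋ vanish   (fuse _) r = lose
both-≋ kill     quiet    r = lose
both-≋ kill     vanish   r = lose
both-≋ kill     kill     r = lose
both-≋ kill     (fuse _) r = lose
both-≋ (fuse _) quiet    r = lose
both-≋ (fuse _) vanish   r = lose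
both-≋ (fuse _) kill     r = lose
both-≋ (fuse _) (fuse _) r = lose

duel-comm : ∀ m x l y l′ → duel m x l y l′ ≋ᴿ duel m y l′ x l
duel-comm m (single (x ∷ xs)) l (single (y ∷ ys)) l′ = both-≋ l l′ (foldUp-≋ (clusterOf-≋ m (++-comm (x ∷ xs) (y ∷ ys))))
duel-comm m (single (x ∷ xs)) l (single [])       l′ = ≋ᴿ-reflexive (calm-comm l l′)
duel-comm m (single (x ∷ xs)) l (cluster _)       l′ = ≋ᴿ-reflexive (calm-comm l l′)
duel-comm m (single (x ∷ xs)) l dead              l′ = ≋ᴿ-reflexive (calm-comm l l′)
duel-comm m (single (x ∷ xs)) l gone              l′ = ≋ᴿ-reflexive (calm-comm l l′)
duel-comm m (single [])       l (single [])       l′ = ≋ᴿ-reflexive (calm-comm l l′)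
duel-comm m (single [])       l (single (_ ∷ _))  l′ = ≋ᴿ-reflexive (calm-comm l l′)
duel-comm m (single [])       l (cluster _)       l′ = ≋ᴿ-reflexive (calm-comm l l′)
duel-comm m (single [])       l dead              l′ = ≋ᴿ-reflexive (calm-comm l l′)
duel-comm m (single [])       l gone              l′ = ≋ᴿ-reflexive (calm-comm l l′)
duel-comm m (cluster _)       l (single [])       l′ = ≋ᴿ-reflexive (calm-comm l l′)
duel-comm m (cluster _)       l (single (_ ∷ _))  l′ = ≋ᴿ-reflexive (calm-comm l l′)
duel-comm m (cluster _)       l (cluster _)       l′ = ≋ᴿ-reflexive (calm-comm l l′)
duel-comm m (cluster _)       l dead              l′ = ≋ᴿ-reflexive (calm-comm l l′)
duel-comm m (cluster _)       l gone              l′ = ≋ᴿ-reflexive (calm-comm l l′)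
duel-comm m dead              l (single [])       l′ = ≋ᴿ-reflexive (calm-comm l l′)
duel-comm m dead              l (single (_ ∷ _))  l′ = ≋ᴿ-reflexive (calm-comm l l′)
duel-comm m dead              l (cluster _)       l′ = ≋ᴿ-reflexive (calm-comm l l′)
duel-comm m dead              l dead              l′ = ≋ᴿ-reflexive (calm-comm l l′)
duel-comm m dead              l gone              l′ = ≋ᴿ-reflexive (calm-comm l l′)
duel-comm m gone              l (single [])       l′ = ≋ᴿ-reflexive (calm-comm l l′)
duel-comm m gone              l (single (_ ∷ _))  l′ = ≋ᴿ-reflexive (calm-comm l l′)
duel-comm m gone              l (cluster _)       l′ = ≋ᴿ-reflexive (calm-comm l l′)
duel-comm m gone              l dead              l′ = ≋ᴿ-reflexive (calm-comm l l′)
duel-comm m gone              l gone              l′ = ≋ᴿ-reflexive (calm-comm l l′)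

-- `rootStep` branches on the number of limbs, with special treatment up to two. Only a swapped pair
-- needs an argument of its own, since there the two limbs play the two sides of a duel.
data Shape : List Tree → List Tree → Set where
  none : Shape [] []
  lone : ∀ {e} → Shape (e ∷ []) (e ∷ [])
  same : ∀ {e f} → Shape (e ∷ f ∷ []) (e ∷ f ∷ [])
  flip : ∀ {e f} → Shape (e ∷ f ∷ []) (f ∷ e ∷ [])
  more : ∀ {e f g ls e′ f′ g′ ls′} → Shape (e ∷ f ∷ g ∷ ls) (e′ ∷ f′ ∷ g′ ∷ ls′)

shape : ∀ {ls ls′} → ls ↭ ls′ → Shape ls ls′
shape {[]}            {[]}                r = none
shape {[]}            {_ ∷ _}             r with () ← ↭-length r
shape {_ ∷ _}         {[]}                r with () ← ↭-length r
shape {e ∷ []}        {_ ∷ []}            r with refl ← ↭-singleton-inv (↭-sym r) = lone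
shape {_ ∷ []}        {_ ∷ _ ∷ _}         r with () ← ↭-length r
shape {_ ∷ _ ∷ _}     {_ ∷ []}            r with () ← ↭-length r
shape {_ ∷ _ ∷ []}    {_ ∷ _ ∷ _ ∷ _}     r with () ← ↭-length r
shape {_ ∷ _ ∷ _ ∷ _} {_ ∷ _ ∷ []}        r with () ← ↭-length r
shape {_ ∷ _ ∷ _ ∷ _} {_ ∷ _ ∷ _ ∷ _}     r = more
shape {e ∷ f ∷ []}    {x ∷ y ∷ []}        r with ∈-resp-↭ r (here refl)
... | here refl with refl ← ↭-singleton-inv (↭-sym (drop-∷ r)) = same
... | there (here refl) with refl ← ↭-singleton-inv (↭-sym (drop-∷ (↭-trans r (swap x e ↭-refl)))) = flip

rootStep-≋ : ∀ X m c {x y} → x ≋ᴿ y → rootStep X m c x ≋ᴿ rootStep X m c y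
rootStep-≋ X m c (rootSingle r) with shape r
rootStep-≋ X m c    (rootSingle r) | none = win
rootStep-≋ X m c    (rootSingle r) | lone = ≋ᴿ-refl _
rootStep-≋ X m c    (rootSingle r) | same = ≋ᴿ-refl _
rootStep-≋ X m fold (rootSingle r) | flip {e} {f} = duel-comm m (X e) (m e) (X f) (m f)
rootStep-≋ X m idle (rootSingle r) | flip = wrap-≋ (singleOf-≋ m r)
rootStep-≋ X m cut  (rootSingle r) | flip = wrap-≋ (singleOf-≋ m r)
rootStep-≋ X m cut  (rootSingle r) | more = lose
rootStep-≋ X m idle (rootSingle r) | more = wrap-≋ (singleOf-≋ m r)
rootStep-≋ X m fold (rootSingle r) | more = wrap-≋ (singleOf-≋ m r)
rootStep-≋ X m c (rootCluster r) with shape r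
... | none = win
... | lone = ≋ᴿ-refl _
... | same = ≋ᴿ-refl _
... | flip = wrap-≋ (clusterOf-≋ m r)
... | more = wrap-≋ (clusterOf-≋ m r)
rootStep-≋ X m c (folded r) with shape r
... | none = lose
... | lone = lose
... | same = ≋ᴿ-refl _
... | flip = foldUp-≋ (clusterOf-≋ m r)
... | more = foldUp-≋ (clusterOf-≋ m r)
rootStep-≋ X m c win  = win
rootStep-≋ X m c lose = lose

Y-≋ : ∀ t ℓ {es es′} → es ↭ es′ → Y t ℓ es ≋ᴿ Y t ℓ es′
Y-≋ zero    ℓ r = rootSingle r
Y-≋ (suc t) ℓ r = rootStep-≋ (X t) (letter t) (ℓ t) (Y-≋ t ℓ r)

Y-win : ∀ t ℓ {es es′} → es ↭ es′ → Y t ℓ es ≡ win → Y t ℓ es′ ≡ win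
Y-win t ℓ {es} {es′} r eq with Y t ℓ es | Y t ℓ es′ | Y-≋ t ℓ r
Y-win t ℓ r refl | win | win | win = refl

-- The two ends of an edge

attach-keepˡ : ∀ p k s → attach (keep p k) s ≡ keep p (attach k s)
attach-keepˡ p (single _)  s           = refl
attach-keepˡ p (cluster _) (single _)  = refl
attach-keepˡ p (cluster _) (cluster _) = refl
attach-keepˡ p (cluster _) dead        = refl
attach-keepˡ p (cluster _) gone        = refl
attach-keepˡ p dead        s           = refl
attach-keepˡ p gone        s           = refl

unattachable : ∀ p {s} → (∀ a → attach a s ≡ dead) → ∀ a → attach a (keep p s) ≡ dead
unattachable p {single ls}  h a with () ← h (cluster [])
unattachable p {cluster ls} h a = h′ a
  where
  h′ : ∀ a → attach a (cluster (p ∷ ls)) ≡ dead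
  h′ (single _)  = refl
  h′ (cluster _) = refl
  h′ dead        = refl
  h′ gone        = refl
unattachable p {dead}       h a = h a
unattachable p {gone}       h a = h a

-- Unmerged vertices and clusters treat quiet, vanishing and killing letters alike. They differ on a
-- fusion, but it leaves no unmerged vertex to which another cluster could be attached.
single-or-dead : ∀ m ls → (∃ λ ks → singleOf m ls ≡ single ks × clusterOf m ls ≡ cluster ks) ⊎
                          ((∀ a → attach a (singleOf m ls) ≡ dead) × clusterOf m ls ≡ dead)
single-or-dead m []       = inj₁ ([] , refl , refl)
single-or-dead m (p ∷ ls) with m p | single-or-dead m ls
... | quiet   | inj₁ (ks , e , e′) = inj₁ (p ∷ ks , cong (keep p) e , cong (keep p) e′)
... | quiet   | inj₂ (h , e)       = inj₂ (unattachable p h , cong (keep p) e)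
... | vanish  | r                  = r
... | kill    | _                  = inj₂ (attach-dead , refl)
... | fuse ps | _                  = inj₂ ((λ a → attach-twice a (clusterOf m ps) (singleOf m ls)) , refl)

-- The cluster that a merged vertex computes from the limbs it receives and its own is the one that
-- the folding vertex computes in `duel`.
attach-clusterOf : ∀ m ps ls → attach (clusterOf m ps) (singleOf m ls) ≡ clusterOf m (ps ++ ls)
attach-clusterOf m []       ls with single-or-dead m ls
... | inj₁ (ks , e , e′) = trans (cong (attach (cluster [])) e) (sym e′)
... | inj₂ (h , e)       = trans (h (cluster [])) (sym e)
attach-clusterOf m (p ∷ ps) ls with m p
... | quiet  = trans (attach-keepˡ p (clusterOf m ps) (singleOf m ls)) (cong (keep p) (attach-clusterOf m ps ls))
... | vanish = attach-clusterOf m ps ls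
... | kill   = refl
... | fuse _ = refl

-- Root states of two neighbours that can never both win: one has lost, or one waits on the very
-- cluster to which the other belongs.
data Versus : Root → Root → Set where
  lostˡ  : ∀ {y} → Versus lose y
  lostʳ  : ∀ {y} → Versus y lose
  rivalˡ : ∀ {L L′} → L ↭ L′ → Versus (rootCluster L) (folded L′)
  rivalʳ : ∀ {L L′} → L ↭ L′ → Versus (folded L) (rootCluster L′)

Versus-sym : ∀ {y y′} → Versus y y′ → Versus y′ y
Versus-sym lostˡ      = lostʳ
Versus-sym lostʳ      = lostˡ
Versus-sym (rivalˡ r) = rivalʳ (↭-sym r)
Versus-sym (rivalʳ r) = rivalˡ (↭-sym r)

wrap-foldUp : ∀ {s s′} → s ≋ s′ → Versus (wrap s) (foldUp s′)
wrap-foldUp (single r)  = lostʳ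
wrap-foldUp (cluster r) = rivalˡ r
wrap-foldUp dead        = lostˡ
wrap-foldUp gone        = lostʳ

cluster-vs-folded : ∀ X m c c′ {L L′} → L ↭ L′ → Versus (rootStep X m c (rootCluster L)) (rootStep X m c′ (folded L′))
cluster-vs-folded X m c c′ r with shape r
... | none = lostʳ
... | lone = lostʳ
... | same = wrap-foldUp (clusterOf-≋ m r)
... | flip = wrap-foldUp (clusterOf-≋ m r)
... | more = wrap-foldUp (clusterOf-≋ m r)

-- A loss is final. Rivals read the same letters: with at most one limb the folded vertex loses,
-- with more the cluster survives for both, or it dies and the folded vertex alone wins.
versus-step : ∀ X m c c′ {y y′} → Versus y y′ → Versus (rootStep X m c y) (rootStep X m c′ y′)
versus-step X m c c′ lostˡ      = lostˡ
versus-step X m c c′ lostʳ      = lostʳ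
versus-step X m c c′ (rivalˡ r) = cluster-vs-folded X m c c′ r
versus-step X m c c′ (rivalʳ r) = Versus-sym (cluster-vs-folded X m c′ c (↭-sym r))

lift : Tree → State → Root
lift p (single ls)  = rootSingle (p ∷ ls)
lift p (cluster ls) = rootCluster (p ∷ ls)
lift p dead         = lose
lift p gone         = lose

lift-keep : ∀ p s → wrap (keep p s) ≡ lift p s
lift-keep p (single _)  = refl
lift-keep p (cluster _) = refl
lift-keep p dead        = refl
lift-keep p gone        = refl

data Loud : Letter → Set where
  kill : Loud kill
  fuse : ∀ {ps} → Loud (fuse ps)

calm-loud : ∀ {l r} → Loud l → calm l r ≡ lose
calm-loud kill = refl
calm-loud fuse = refl

both-loud : ∀ {l} l′ {r} → Loud l → both l l′ r ≡ lose
both-loud l′ kill = refl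
both-loud l′ fuse = refl

duel-loud : ∀ m x {l} y l′ → Loud l → duel m x l y l′ ≡ lose
duel-loud m (single (x ∷ xs)) (single (y ∷ ys)) l′ b = both-loud l′ b
duel-loud m (single (x ∷ xs)) (single [])       l′ b = calm-loud b
duel-loud m (single (x ∷ xs)) (cluster _)       l′ b = calm-loud b
duel-loud m (single (x ∷ xs)) dead              l′ b = calm-loud b
duel-loud m (single (x ∷ xs)) gone              l′ b = calm-loud b
duel-loud m (single [])       _                 l′ b = calm-loud b
duel-loud m (cluster _)       _                 l′ b = calm-loud b
duel-loud m dead              _                 l′ b = calm-loud b
duel-loud m gone              _                 l′ b = calm-loud b

offer-loud : ∀ x → Loud (offer x)
offer-loud (single [])      = kill
offer-loud (single (_ ∷ _)) = fuse
offer-loud (cluster _)      = kill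
offer-loud dead             = kill
offer-loud gone             = kill

-- p is the limb towards the neighbour, x the own state without that neighbour.
module _ (X : Tree → State) (m : Tree → Letter) (p : Tree) where

  loud-quiet : ∀ {a} {A : Set a} {l} → Loud l → l ≡ quiet → A
  loud-quiet kill ()
  loud-quiet fuse ()

  loud-vanish : ∀ {a} {A : Set a} {l} → Loud l → l ≡ vanish → A
  loud-vanish kill ()
  loud-vanish fuse ()

  both-quiet : ∀ x c → x ≢ gone → act X x c ≡ quiet → m p ≡ quiet → rootStep X m c (lift p x) ≡ lift p (next m quiet x)
  both-quiet (single (e ∷ []))     fold n q h = loud-quiet (offer-loud (X e)) q
  both-quiet (single (e ∷ []))     idle n q h rewrite h = lift-keep p (singleOf m (e ∷ []))
  both-quiet (single (e ∷ []))     cut  n q h rewrite h = lift-keep p (singleOf m (e ∷ []))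
  both-quiet (single (e ∷ f ∷ ls)) idle n q h rewrite h = lift-keep p (singleOf m (e ∷ f ∷ ls))
  both-quiet (single (e ∷ f ∷ ls)) fold n q h rewrite h = lift-keep p (singleOf m (e ∷ f ∷ ls))
  both-quiet (cluster (e ∷ ls))    c    n q h rewrite h = lift-keep p (clusterOf m (e ∷ ls))
  both-quiet gone                  c    n q h = ⊥-elim (n refl)

  vanishing : ∀ x c → act X x c ≡ vanish → rootStep X m c (lift p x) ≡ lose
  vanishing (single (e ∷ []))     fold q = loud-vanish (offer-loud (X e)) q
  vanishing (single (e ∷ f ∷ ls)) cut  q = refl
  vanishing dead                  c    q = refl
  vanishing (single [])           c    ()
  vanishing (single (e ∷ []))     idle ()
  vanishing (single (e ∷ []))     cut  ()
  vanishing (single (e ∷ f ∷ ls)) idle ()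
  vanishing (single (e ∷ f ∷ ls)) fold ()
  vanishing (cluster [])          c    ()
  vanishing (cluster (e ∷ ls))    c    ()
  vanishing gone                  c    ()

  clash : ∀ x c → Loud (act X x c) → Loud (m p) → rootStep X m c (lift p x) ≡ lose
  clash (single [])       c    b h = calm-loud h
  clash (single (e ∷ [])) fold b h = duel-loud m (X p) (X e) (m e) h
  clash (single (e ∷ [])) idle () h
  clash (single (e ∷ [])) cut  () h
  clash (single (_ ∷ _ ∷ _)) idle () h
  clash (single (_ ∷ _ ∷ _)) fold () h
  clash (single (_ ∷ _ ∷ _)) cut  () h
  clash (cluster [])      c    b h = calm-loud h
  clash (cluster (_ ∷ _)) c    () h
  clash dead              c    () h
  clash gone              c    () h

  killed-off : ∀ x c → x ≢ gone → act X x c ≡ quiet → m p ≡ kill → rootStep X m c (lift p x) ≡ lose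
  killed-off (single (e ∷ []))     fold n q h = loud-quiet (offer-loud (X e)) q
  killed-off (single (e ∷ []))     idle n q h rewrite h = refl
  killed-off (single (e ∷ []))     cut  n q h rewrite h = refl
  killed-off (single (e ∷ f ∷ ls)) idle n q h rewrite h = refl
  killed-off (single (e ∷ f ∷ ls)) fold n q h rewrite h = refl
  killed-off (cluster (e ∷ ls))    c    n q h rewrite h = refl
  killed-off gone                  c    n q h = ⊥-elim (n refl)

  fused-with : ∀ x c {ps} → x ≢ gone → act X x c ≡ quiet → m p ≡ fuse ps →
               rootStep X m c (lift p x) ≡ lose ⊎
               (∃ λ y → ∃ λ ls → x ≡ single (y ∷ ls) × rootStep X m c (lift p x) ≡ wrap (clusterOf m (ps ++ (y ∷ ls))))
  fused-with (single (e ∷ []))     fold n q h = loud-quiet (offer-loud (X e)) q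
  fused-with (single (e ∷ []))     idle {ps} n q h rewrite h = inj₂ (e , [] , refl , cong wrap (attach-clusterOf m ps (e ∷ [])))
  fused-with (single (e ∷ []))     cut  {ps} n q h rewrite h = inj₂ (e , [] , refl , cong wrap (attach-clusterOf m ps (e ∷ [])))
  fused-with (single (e ∷ f ∷ ls)) idle {ps} n q h rewrite h = inj₂ (e , f ∷ ls , refl , cong wrap (attach-clusterOf m ps (e ∷ f ∷ ls)))
  fused-with (single (e ∷ f ∷ ls)) fold {ps} n q h rewrite h = inj₂ (e , f ∷ ls , refl , cong wrap (attach-clusterOf m ps (e ∷ f ∷ ls)))
  fused-with (cluster (e ∷ ls))    c    n q h rewrite h = inj₁ refl
  fused-with gone                  c    n q h = ⊥-elim (n refl)

  fusing-with : ∀ x c {ps y ls} → act X x c ≡ fuse ps → X p ≡ single (y ∷ ls) → m p ≡ quiet →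
                rootStep X m c (lift p x) ≡ lose ⊎ rootStep X m c (lift p x) ≡ foldUp (clusterOf m ((y ∷ ls) ++ ps))
  fusing-with (single [])           c    () _ _
  fusing-with (single (e ∷ []))     idle () _ _
  fusing-with (single (e ∷ []))     cut  () _ _
  fusing-with (single (e ∷ f ∷ ls)) idle () _ _
  fusing-with (single (e ∷ f ∷ ls)) fold () _ _
  fusing-with (single (e ∷ f ∷ ls)) cut  () _ _
  fusing-with (cluster [])          c    () _ _
  fusing-with (cluster (e ∷ ls))    c    () _ _
  fusing-with dead                  c    () _ _
  fusing-with gone                  c    () _ _
  fusing-with (single (e ∷ [])) fold {ps} q h h′ with X e in eq
  fusing-with (single (e ∷ [])) fold {ps} refl h h′ | single (z ∷ zs) rewrite h | h′ with m e
  ... | quiet  = inj₂ refl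
  ... | vanish = inj₁ refl
  ... | kill   = inj₁ refl
  ... | fuse _ = inj₁ refl

-- The top of `p′` folds while the top of `p` is quiet. Unless one of them loses, the latter enters
-- the cluster on which the former waits, and their limb lists differ only by swapping `ps` with the
-- own limbs.
half : ∀ X m p p′ c c′ {ps} → X p ≢ gone → m p ≡ act X (X p) c → m p ≡ quiet → m p′ ≡ act X (X p′) c′ → m p′ ≡ fuse ps →
       Versus (rootStep X m c (lift p′ (X p))) (rootStep X m c′ (lift p (X p′)))
half X m p p′ c c′ {ps} n e q e′ q′ with fused-with X m p′ (X p) c n (trans (sym e) q) q′
... | inj₁ z rewrite z = lostˡ
... | inj₂ (y , ls , xp , z) with fusing-with X m p (X p′) c′ (trans (sym e′) q′) xp q
...   | inj₁ z′ rewrite z′ = lostʳ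
...   | inj₂ z′ rewrite z | z′ = wrap-foldUp (clusterOf-≋ m (++-comm ps (y ∷ ls)))

-- Case split on the letters crossing the edge. A vanishing sender has lost; a kill excludes a quiet
-- receiver; two kills or fusions clash and the first end loses; a fusion meeting a quiet end is
-- `half`.
meet : ∀ X m p p′ c c′ → X p ≢ gone → X p′ ≢ gone → m p ≡ act X (X p) c → m p′ ≡ act X (X p′) c′ →
       (m p ≡ quiet × m p′ ≡ quiet) ⊎ Versus (rootStep X m c (lift p′ (X p))) (rootStep X m c′ (lift p (X p′)))
meet X m p p′ c c′ n n′ e e′ with m p in q | m p′ in q′
... | quiet  | quiet  = inj₁ (refl , refl)
... | vanish | _      = inj₂ (subst (λ y → Versus y _) (sym (vanishing X m p′ (X p) c (sym e))) lostˡ)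
... | quiet  | vanish = inj₂ (subst (Versus _) (sym (vanishing X m p (X p′) c′ (sym e′))) lostʳ)
... | kill   | vanish = inj₂ (subst (Versus _) (sym (vanishing X m p (X p′) c′ (sym e′))) lostʳ)
... | fuse _ | vanish = inj₂ (subst (Versus _) (sym (vanishing X m p (X p′) c′ (sym e′))) lostʳ)
... | quiet  | kill   = inj₂ (subst (λ y → Versus y _) (sym (killed-off X m p′ (X p) c n (sym e) q′)) lostˡ)
... | kill   | quiet  = inj₂ (subst (Versus _) (sym (killed-off X m p (X p′) c′ n′ (sym e′) q)) lostʳ)
... | quiet  | fuse _ = inj₂ (half X m p p′ c c′ n (trans q e) q (trans q′ e′) q′)
... | fuse _ | quiet  = inj₂ (Versus-sym (half X m p′ p c′ c n′ (trans q′ e′) q′ (trans q e) q))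
... | kill   | kill   = inj₂ (subst (λ y → Versus y _) (sym (clash X m p′ (X p) c (subst Loud e kill) (subst Loud (sym q′) kill))) lostˡ)
... | kill   | fuse _ = inj₂ (subst (λ y → Versus y _) (sym (clash X m p′ (X p) c (subst Loud e kill) (subst Loud (sym q′) fuse))) lostˡ)
... | fuse _ | kill   = inj₂ (subst (λ y → Versus y _) (sym (clash X m p′ (X p) c (subst Loud e fuse) (subst Loud (sym q′) kill))) lostˡ)
... | fuse _ | fuse _ = inj₂ (subst (λ y → Versus y _) (sym (clash X m p′ (X p) c (subst Loud e fuse) (subst Loud (sym q′) fuse))) lostˡ)

keep-≢gone : ∀ p s → s ≢ gone → keep p s ≢ gone
keep-≢gone p (single _)  n ()
keep-≢gone p (cluster _) n ()
keep-≢gone p dead        n ()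
keep-≢gone p gone        n _ = n refl

attach-≢gone : ∀ a s → attach a s ≢ gone
attach-≢gone (cluster _) (single _)  ()
attach-≢gone (cluster _) (cluster _) ()
attach-≢gone (cluster _) dead        ()
attach-≢gone (cluster _) gone        ()
attach-≢gone (single _)  s           ()
attach-≢gone dead        s           ()
attach-≢gone gone        s           ()

clusterOf-≢gone : ∀ m ls → clusterOf m ls ≢ gone
clusterOf-≢gone m []       ()
clusterOf-≢gone m (p ∷ ls) with m p
... | quiet  = keep-≢gone p (clusterOf m ls) (clusterOf-≢gone m ls)
... | vanish = clusterOf-≢gone m ls
... | kill   = λ ()
... | fuse _ = λ ()

singleOf-≢gone : ∀ m ls → singleOf m ls ≢ gone
singleOf-≢gone m []       ()
singleOf-≢gone m (p ∷ ls) with m p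
... | quiet   = keep-≢gone p (singleOf m ls) (singleOf-≢gone m ls)
... | vanish  = singleOf-≢gone m ls
... | kill    = λ ()
... | fuse ps = attach-≢gone (clusterOf m ps) (singleOf m ls)

next-≢gone : ∀ X m x c → x ≢ gone → act X x c ≡ quiet → next m quiet x ≢ gone
next-≢gone X m (single ls)  c n q = singleOf-≢gone m ls
next-≢gone X m (cluster ls) c n q = clusterOf-≢gone m ls
next-≢gone X m gone         c n q = n

around : Tree → Tree → List Tree
around p′ p = p′ ∷ child false p ∷ child true p ∷ []

-- While neither end has acted across the edge, each limb state's assumption about its parent holds,
-- so an end's true state is its limb state with the limb of the other end added. The first action
-- turns this into `opposed` for good.
data Facing (t : ℕ) (p p′ : Tree) : Set where
  coupled : X t p ≢ gone → X t p′ ≢ gone → Y t (label p) (around p′ p) ≡ lift p′ (X t p) → Y t (label p′) (around p p′) ≡ lift p (X t p′) → Facing t p p′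
  opposed : Versus (Y t (label p) (around p′ p)) (Y t (label p′) (around p p′)) → Facing t p p′

facing : ∀ t p p′ → Facing t p p′
facing zero    p p′ = coupled (λ ()) (λ ()) refl refl
facing (suc t) p p′ with facing t p p′
... | opposed v = opposed (versus-step (X t) (letter t) (label p t) (label p′ t) v)
... | coupled n n′ e e′ with meet (X t) (letter t) p p′ (label p t) (label p′ t) n n′ refl refl
...   | inj₂ v = opposed (subst₂ (λ y y′ → Versus (rootStep (X t) (letter t) (label p t) y) (rootStep (X t) (letter t) (label p′ t) y′)) (sym e) (sym e′) v)
...   | inj₁ (q , q′) = coupled
  (subst (_≢ gone) (cong (λ l → next (letter t) l (X t p)) (sym q)) (next-≢gone (X t) (letter t) (X t p) (label p t) n q))
  (subst (_≢ gone) (cong (λ l → next (letter t) l (X t p′)) (sym q′)) (next-≢gone (X t) (letter t) (X t p′) (label p′ t) n′ q′))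
  (trans (cong (rootStep (X t) (letter t) (label p t)) e)
    (trans (both-quiet (X t) (letter t) p′ (X t p) (label p t) n q q′) (cong (λ l → lift p′ (next (letter t) l (X t p))) (sym q))))
  (trans (cong (rootStep (X t) (letter t) (label p′ t)) e′)
    (trans (both-quiet (X t) (letter t) p (X t p′) (label p′ t) n′ q′ q) (cong (λ l → lift p (next (letter t) l (X t p′))) (sym q′))))

lift-≢win : ∀ p x → lift p x ≢ win
lift-≢win p (single _)  ()
lift-≢win p (cluster _) ()
lift-≢win p dead        ()
lift-≢win p gone        ()

versus-≢win : ∀ {y y′} → Versus y y′ → y ≡ win → y′ ≡ win → ⊥
versus-≢win lostˡ () _
versus-≢win lostʳ _ ()

exclusive : ∀ t p p′ → Y t (label p) (around p′ p) ≡ win → Y t (label p′) (around p p′) ≡ win → ⊥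
exclusive t p p′ w w′ with facing t p p′
... | coupled _ _ e _ = lift-≢win p′ (X t p) (trans (sym e) w)
... | opposed v       = versus-≢win v w w′

-- The random independent set

δ : ∀ {n} → Subset n → Subset n → ℚ
δ []            []            = 1ℚ
δ (outside ∷ S) (outside ∷ T) = δ S T
δ (inside  ∷ S) (inside  ∷ T) = δ S T
δ (outside ∷ S) (inside  ∷ T) = 0ℚ
δ (inside  ∷ S) (outside ∷ T) = 0ℚ

δ≥0 : ∀ {n} (S T : Subset n) → 0ℚ ≤ δ S T
δ≥0 []            []            = 0≤1
δ≥0 (outside ∷ S) (outside ∷ T) = δ≥0 S T
δ≥0 (inside  ∷ S) (inside  ∷ T) = δ≥0 S T
δ≥0 (outside ∷ S) (inside  ∷ T) = ≤-refl
δ≥0 (inside  ∷ S) (outside ∷ T) = ≤-refl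

δ-≢ : ∀ {n} (S T : Subset n) → S ≢ T → δ S T ≡ 0ℚ
δ-≢ []            []            n = ⊥-elim (n refl)
δ-≢ (outside ∷ S) (outside ∷ T) n = δ-≢ S T (n ∘ cong (outside ∷_))
δ-≢ (inside  ∷ S) (inside  ∷ T) n = δ-≢ S T (n ∘ cong (inside ∷_))
δ-≢ (outside ∷ S) (inside  ∷ T) n = refl
δ-≢ (inside  ∷ S) (outside ∷ T) n = refl

module _ {A : Set} where

  sumℚ-ext : ∀ {f g : A → ℚ} xs → (∀ a → f a ≡ g a) → sumℚ (map f xs) ≡ sumℚ (map g xs)
  sumℚ-ext []       e = refl
  sumℚ-ext (x ∷ xs) e = cong₂ _+_ (e x) (sumℚ-ext xs e)

  sumℚ-zero : ∀ (xs : List A) → sumℚ (map (λ _ → 0ℚ) xs) ≡ 0ℚ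
  sumℚ-zero []       = refl
  sumℚ-zero (x ∷ xs) = trans (+-identityˡ _) (sumℚ-zero xs)

  sumℚ-map-++ : ∀ (f : A → ℚ) xs ys → sumℚ (map f (xs ++ ys)) ≡ sumℚ (map f xs) + sumℚ (map f ys)
  sumℚ-map-++ f []       ys = sym (+-identityˡ _)
  sumℚ-map-++ f (x ∷ xs) ys = trans (cong (f x +_) (sumℚ-map-++ f xs ys)) (sym (+-assoc (f x) _ _))

  sumℚ-map-map : ∀ {B : Set} (f : A → ℚ) (g : B → A) xs → sumℚ (map f (map g xs)) ≡ sumℚ (map (f ∘ g) xs)
  sumℚ-map-map f g []       = refl
  sumℚ-map-map f g (x ∷ xs) = cong (f (g x) +_) (sumℚ-map-map f g xs)

  sumℚ-swap : ∀ {B : Set} (P : Positive B) (f : A → B → ℚ) xs → sumℚ (map (λ a → ⟨ P ⟩ (f a)) xs) ≡ ⟨ P ⟩ (λ b → sumℚ (map (λ a → f a b) xs))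
  sumℚ-swap P f []       = sym (null P)
  sumℚ-swap P f (x ∷ xs) = trans (cong (⟨ P ⟩ (f x) +_) (sumℚ-swap P f xs)) (sym (add P (f x) (λ b → sumℚ (map (λ a → f a b) xs))))

  sumℚ-filter : ∀ {p} {Q : Pred A p} (Q? : ∀ a → Dec (Q a)) (f : A → ℚ) xs →
                sumℚ (map f (filter Q? xs)) ≡ sumℚ (map (λ a → if does (Q? a) then f a else 0ℚ) xs)
  sumℚ-filter Q? f []       = refl
  sumℚ-filter Q? f (x ∷ xs) with does (Q? x)
  ... | true  = cong (f x +_) (sumℚ-filter Q? f xs)
  ... | false = trans (sumℚ-filter Q? f xs) (sym (+-identityˡ _))

sumℚ-δ : ∀ {n} (S : Subset n) (c : Subset n → ℚ) → sumℚ (map (λ T → c T * δ S T) (subsets n)) ≡ c S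
sumℚ-δ []            c = trans (+-identityʳ _) (*-identityʳ (c []))
sumℚ-δ {suc n} (b ∷ S) c = trans (sumℚ-map-++ f (map (outside ∷_) (subsets n)) (map (inside ∷_) (subsets n)))
  (trans (cong₂ _+_ (sumℚ-map-map f (outside ∷_) (subsets n)) (sumℚ-map-map f (inside ∷_) (subsets n))) (split b))
  where
  f : Subset (suc n) → ℚ
  f T = c T * δ (b ∷ S) T
  vanishes : ∀ (g : Subset n → ℚ) → sumℚ (map (λ T → g T * 0ℚ) (subsets n)) ≡ 0ℚ
  vanishes g = trans (sumℚ-ext (subsets n) (λ T → *-zeroʳ (g T))) (sumℚ-zero (subsets n))
  split : ∀ b → sumℚ (map (λ T → c (outside ∷ T) * δ (b ∷ S) (outside ∷ T)) (subsets n)) +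
                sumℚ (map (λ T → c (inside ∷ T) * δ (b ∷ S) (inside ∷ T)) (subsets n)) ≡ c (b ∷ S)
  split outside = trans (cong₂ _+_ (sumℚ-δ S (λ T → c (outside ∷ T))) (vanishes (λ T → c (inside ∷ T)))) (+-identityʳ _)
  split inside  = trans (cong₂ _+_ (vanishes (λ T → c (outside ∷ T))) (sumℚ-δ S (λ T → c (inside ∷ T)))) (+-identityˡ _)

module _ {Ω : Set} (P : Positive Ω) (P₁ : Normalised P) {n} (S : Ω → Subset n) {Q : Subset n → Set} (S-Q : ∀ ω → Q (S ω)) where

  -- The image of `P` under the random set `S`, with `δ` as the indicator of equality.
  law-of : Distribution Q
  law-of = record
    { mass      = λ T → ⟨ P ⟩ λ ω → δ (S ω) T
    ; mass≥0    = λ T → pos P λ ω → δ≥0 (S ω) T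
    ; supported = λ T ¬q → trans (ext P λ ω → δ-≢ (S ω) T λ e → ¬q (subst Q e (S-Q ω))) (null P)
    ; total     = trans (sumℚ-swap P (λ T ω → δ (S ω) T) (subsets n))
        (trans (ext P λ ω → trans (sumℚ-ext (subsets n) (λ T → sym (*-identityˡ (δ (S ω) T)))) (sumℚ-δ (S ω) (λ _ → 1ℚ))) P₁)
    }

  law-of-contains : ∀ v → Distribution.probContains law-of v ≡ ⟨ P ⟩ λ ω → if does (v ∈? S ω) then 1ℚ else 0ℚ
  law-of-contains v = trans (sumℚ-filter (v ∈?_) (Distribution.mass law-of) (subsets n))
    (trans (sumℚ-ext (subsets n) (λ T → pull (does (v ∈? T)) T))
      (trans (sumℚ-swap P (λ T ω → c T * δ (S ω) T) (subsets n)) (ext P λ ω → sumℚ-δ (S ω) c)))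
    where
    c : Subset n → ℚ
    c T = if does (v ∈? T) then 1ℚ else 0ℚ
    pull : ∀ b T → (if b then ⟨ P ⟩ (λ ω → δ (S ω) T) else 0ℚ) ≡ ⟨ P ⟩ (λ ω → (if b then 1ℚ else 0ℚ) * δ (S ω) T)
    pull true  T = ext P λ ω → sym (*-identityˡ (δ (S ω) T))
    pull false T = sym (trans (ext P λ ω → *-zeroˡ (δ (S ω) T)) (null P))

isWinᵇ : Root → Bool
isWinᵇ win = true
isWinᵇ _   = false

isWinᵇ⇒win : ∀ {x} → isWinᵇ x ≡ true → x ≡ win
isWinᵇ⇒win {win} _ = refl

isWinᵇ-isWin : ∀ x → (if isWinᵇ x then 1ℚ else 0ℚ) ≡ isWin x
isWinᵇ-isWin (rootSingle _)  = refl
isWinᵇ-isWin (rootCluster _) = refl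
isWinᵇ-isWin (folded _)      = refl
isWinᵇ-isWin win             = refl
isWinᵇ-isWin lose            = refl

does-∈? : ∀ {n} v (S : Subset n) → does (v ∈? S) ≡ Vec.lookup S v
does-∈? zero    (inside  ∷ S) = refl
does-∈? zero    (outside ∷ S) = refl
does-∈? (suc v) (b ∷ S)       = does-∈? v S

-- Random labels on the vertices of the graph

module Field (one : ℕ) .{{_ : NonZero one}} (foldRate cutRate : ℕ → ℕ)
             (valid : ∀ t → foldRate t ℕ.+ cutRate t ℕ.≤ one) (H : ℕ) where

  open Rounds one foldRate cutRate valid H
  open RootSteps one foldRate cutRate valid H using (rootTrees)

  _∷ᶠ_ : ∀ {n} → Label → (Fin n → Label) → Fin (suc n) → Label
  (ℓ ∷ᶠ ω) zero    = ℓ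
  (ℓ ∷ᶠ ω) (suc v) = ω v

  field′ : ∀ n → Positive (Fin n → Label)
  ⟨ field′ zero ⟩ f = f λ ()
  mono (field′ zero) le = le λ ()
  add (field′ zero) f g = refl
  scale (field′ zero) k f = refl
  ⟨ field′ (suc n) ⟩ f = ⟨ labels 0 H ⟩ λ ℓ → ⟨ field′ n ⟩ λ ω → f (ℓ ∷ᶠ ω)
  mono (field′ (suc n)) le = mono (labels 0 H) λ ℓ → mono (field′ n) λ ω → le (ℓ ∷ᶠ ω)
  add (field′ (suc n)) f g = trans (ext (labels 0 H) λ ℓ → add (field′ n) (λ ω → f (ℓ ∷ᶠ ω)) (λ ω → g (ℓ ∷ᶠ ω))) (add (labels 0 H) _ _)
  scale (field′ (suc n)) k f = trans (ext (labels 0 H) λ ℓ → scale (field′ n) k (λ ω → f (ℓ ∷ᶠ ω))) (scale (labels 0 H) k _)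

  field-normalised : ∀ n → Normalised (field′ n)
  field-normalised zero    = refl
  field-normalised (suc n) = trans (ext (labels 0 H) λ _ → field-normalised n) (labels-normalised 0 H)

  label₁ : ∀ {c} → ⟨ labels 0 H ⟩ (λ _ → c) ≡ c
  label₁ = const₁ (labels 0 H) (labels-normalised 0 H) _

  marginal : ∀ {n} v (f : Label → ℚ) → ⟨ field′ n ⟩ (λ ω → f (ω v)) ≡ ⟨ labels 0 H ⟩ f
  marginal {suc n} zero    f = ext (labels 0 H) λ ℓ → const₁ (field′ n) (field-normalised n) (f ℓ)
  marginal {suc n} (suc v) f = trans (ext (labels 0 H) λ _ → marginal v f) label₁

  _agree-on_ : ∀ {n} → (Fin n → Label) × (Fin n → Label) → (Fin n → Set) → Set
  (ω , ω′) agree-on Q = ∀ v → Q v → ω v ≡ ω′ v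

  -- Labels of distinct vertices are independent. If the first argument of `h` is read only where
  -- `χ` holds and the second only elsewhere, the two copies of the field may be drawn
  -- independently.
  decouple : ∀ {n} (χ : Fin n → Bool) (h : (Fin n → Label) → (Fin n → Label) → ℚ) →
             (∀ ω ω′ η → (ω , ω′) agree-on (λ v → χ v ≡ true) → h ω η ≡ h ω′ η) →
             (∀ ω η η′ → (η , η′) agree-on (λ v → χ v ≡ false) → h ω η ≡ h ω η′) →
             ⟨ field′ n ⟩ (λ ω → h ω ω) ≡ ⟨ field′ n ⟩ λ ω → ⟨ field′ n ⟩ λ η → h ω η
  decouple {zero}  χ h l r = refl
  decouple {suc n} χ h l r with χ zero in eq
  ... | true = ext (labels 0 H) λ ℓ → trans
      (ext (field′ n) λ ω → r (ℓ ∷ᶠ ω) (ℓ ∷ᶠ ω) (ℓ₀ ∷ᶠ ω) (skip false eq))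
      (trans (decouple (χ ∘ suc) (λ ω η → h (ℓ ∷ᶠ ω) (ℓ₀ ∷ᶠ η)) (λ ω ω′ η a → l _ _ _ λ { zero _ → refl ; (suc v) e → a v e })
          (λ ω η η′ a → r _ _ _ λ { zero _ → refl ; (suc v) e → a v e }))
        (ext (field′ n) λ ω → sym (trans (ext (labels 0 H) λ ℓ′ → ext (field′ n) λ η → r (ℓ ∷ᶠ ω) (ℓ′ ∷ᶠ η) (ℓ₀ ∷ᶠ η) (skip false eq)) label₁)))
    where
    ℓ₀ : Label
    ℓ₀ _ = idle
    skip : ∀ b {ℓ ℓ′ : Label} {ω : Fin n → Label} → χ zero ≡ true → (ℓ ∷ᶠ ω , ℓ′ ∷ᶠ ω) agree-on (λ v → χ v ≡ false)
    skip b e zero    e′ with () ← trans (sym e) e′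
    skip b e (suc v) _  = refl
  ... | false = trans
      (ext (labels 0 H) λ ℓ → trans
        (ext (field′ n) λ ω → l (ℓ ∷ᶠ ω) (ℓ₀ ∷ᶠ ω) (ℓ ∷ᶠ ω) (skip eq))
        (decouple (χ ∘ suc) (λ ω η → h (ℓ₀ ∷ᶠ ω) (ℓ ∷ᶠ η)) (λ ω ω′ η a → l _ _ _ λ { zero _ → refl ; (suc v) e → a v e })
          (λ ω η η′ a → r _ _ _ λ { zero _ → refl ; (suc v) e → a v e })))
      (trans (sym (labels-swap (field′ n) 0 H (λ ω ℓ → ⟨ field′ n ⟩ (λ η → h (ℓ₀ ∷ᶠ ω) (ℓ ∷ᶠ η)))))
        (sym (trans (ext (labels 0 H) λ ℓ′ → ext (field′ n) λ ω → ext (labels 0 H) λ ℓ → ext (field′ n) λ η → l (ℓ′ ∷ᶠ ω) (ℓ₀ ∷ᶠ ω) (ℓ ∷ᶠ η) (skip eq)) label₁)))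
    where
    ℓ₀ : Label
    ℓ₀ _ = idle
    skip : ∀ {ℓ ℓ′ : Label} {ω : Fin n → Label} → χ zero ≡ false → (ℓ ∷ᶠ ω , ℓ′ ∷ᶠ ω) agree-on (λ v → χ v ≡ true)
    skip e zero    e′ with () ← trans (sym e) e′
    skip e (suc v) _  = refl

  module _ {n} (G : Graph n) (cubic : Cubic G) where

    open Graph G
    open Arcs G cubic

    -- A branch of the universal cover. Every copy of a vertex carries the label of that vertex, so
    -- limbs overlap wherever walks meet again.
    limb : (Fin n → Label) → Arc → Tree
    limb ω a p = ω (finish a p)

    limbs : (Fin n → Label) → Fin n → List Tree
    limbs ω v = limb ω (into v zero) ∷ limb ω (into v (suc zero)) ∷ limb ω (into v (suc (suc zero))) ∷ []

    chosen : (Fin n → Label) → Subset n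
    chosen ω = tabulate λ v → isWinᵇ (Y H (ω v) (limbs ω v))

    chosen-win : ∀ ω {v} → v ∈ chosen ω → Y H (ω v) (limbs ω v) ≡ win
    chosen-win ω {v} v∈ = isWinᵇ⇒win (trans (sym (lookup∘tabulate _ v)) ([]=⇒lookup v∈))

    around-limbs : ∀ ω v j → limbs ω v ↭ limb ω (into v j) ∷ limb ω (into v (other j false)) ∷ limb ω (into v (other j true)) ∷ []
    around-limbs ω v zero             = ↭-refl
    around-limbs ω v (suc zero)       = swap _ _ ↭-refl
    around-limbs ω v (suc (suc zero)) = ↭-trans (prep _ (swap _ _ ↭-refl)) (swap _ _ ↭-refl)

    -- An edge of the graph lifts to the cover, where each end sees the other's limb. Up to
    -- reordering, and because the limb back to `v` is again `limb ω (v , j)`, both ends have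
    -- exactly the form that `exclusive` treats.
    chosen-independent : ∀ ω → Independent G (chosen ω)
    chosen-independent ω v u v∈ u∈ v~u with nbr-surjective v~u
    ... | j , refl = exclusive H (limb ω (v , j)) (limb ω (into v j))
      (Y-win H (ω v) (around-limbs ω v j) (chosen-win ω v∈))
      (subst (λ a → Y H (ω (nbr v j)) (limb ω a ∷ limb ω (into (nbr v j) (other i false)) ∷ limb ω (into (nbr v j) (other i true)) ∷ []) ≡ win)
        (rev-into v j) (Y-win H (ω (nbr v j)) (around-limbs ω (nbr v j) i) (chosen-win ω u∈)))
      where i = proj₂ (into v j)

    cut-limb : ℕ → Arc → (Fin n → Label) → Tree
    cut-limb zero    a ω = blank
    cut-limb (suc R) a ω = node (ω (head a)) (cut-limb R (down false a) ω) (cut-limb R (down true a) ω)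

    cut-limb-close : ∀ R a ω → Close R (limb ω a) (cut-limb R a ω)
    cut-limb-close (suc R) a ω []          _         = refl
    cut-limb-close (suc R) a ω (false ∷ p) (s≤s p<R) = cut-limb-close R (down false a) ω p p<R
    cut-limb-close (suc R) a ω (true ∷ p)  (s≤s p<R) = cut-limb-close R (down true a) ω p p<R

    touches : ℕ → Arc → Fin n → Bool
    touches zero    a v = false
    touches (suc R) a v = does (head a Fin.≟ v) ∨ (touches R (down false a) v ∨ touches R (down true a) v)

    ∨-true : ∀ a {b} → a ∨ b ≡ true → a ≡ true ⊎ b ≡ true
    ∨-true true  _ = inj₁ refl
    ∨-true false e = inj₂ e

    ∨-trueˡ : ∀ {a b} → a ≡ true → a ∨ b ≡ true
    ∨-trueˡ refl = refl

    ∨-trueʳ : ∀ a {b} → b ≡ true → a ∨ b ≡ true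
    ∨-trueʳ true  _ = refl
    ∨-trueʳ false e = e

    touches-finish : ∀ R a v → touches R a v ≡ true → ∃ λ p → length p ℕ.< R × finish a p ≡ v
    touches-finish (suc R) a v t with head a Fin.≟ v
    ... | yes e = [] , s≤s z≤n , e
    ... | no _ with ∨-true (touches R (down false a) v) t
    ...   | inj₁ t′ with p , lt , e ← touches-finish R (down false a) v t′ = false ∷ p , s≤s lt , e
    ...   | inj₂ t′ with p , lt , e ← touches-finish R (down true a) v t′ = true ∷ p , s≤s lt , e

    cut-limb-cong : ∀ R a {ω ω′} → (ω , ω′) agree-on (λ v → touches R a v ≡ true) → cut-limb R a ω ≡ cut-limb R a ω′
    cut-limb-cong zero    a agree = refl
    cut-limb-cong (suc R) a {ω} {ω′} agree = trans
      (cong (λ ℓ → node ℓ (cut-limb R (down false a) ω) (cut-limb R (down true a) ω)) (agree (head a) (∨-trueˡ (dec-true (head a Fin.≟ head a) refl))))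
      (cong₂ (node (ω′ (head a)))
        (cut-limb-cong R (down false a) λ v e → agree v (∨-trueʳ (does (head a Fin.≟ v)) (∨-trueˡ e)))
        (cut-limb-cong R (down true a) λ v e → agree v (∨-trueʳ (does (head a Fin.≟ v)) (∨-trueʳ (touches R (down false a) v) e))))

    module _ {g} (girth : GirthAtLeast G g) (N : ℕ) (2N<g : N ℕ.+ N ℕ.< g) where

      untouched : ∀ {R} → R ℕ.≤ N → ∀ u {j j′} → j ≢ j′ → ∀ v → touches R (into u j′) v ≡ true → touches R (into u j) v ≡ false
      untouched {R} R≤N u {j} {j′} j≢j′ v t with touches R (into u j) v in eq
      ... | false = refl
      ... | true with p , p<R , e ← touches-finish R (into u j) v eq | q , q<R , e′ ← touches-finish R (into u j′) v t =
        ⊥-elim (finish-disjoint girth 2N<g u j≢j′ p q (ℕ.≤-trans p<R R≤N) (ℕ.≤-trans q<R R≤N) (trans e (sym e′)))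

      untouched-centre : ∀ {R} → R ℕ.≤ N → ∀ u j → touches R (into u j) u ≡ false
      untouched-centre {R} R≤N u j with touches R (into u j) u in eq
      ... | false = refl
      ... | true with p , p<R , e ← touches-finish R (into u j) u eq = ⊥-elim (finish-≢ girth 2N<g u j p (ℕ.≤-trans p<R R≤N) e)

      -- Splits one limb off at u from whatever else depends only on u and on other limbs at u.
      split-limb : ∀ {R} → R ℕ.≤ N → ∀ u j (F : Tree → (Fin n → Label) → ℚ) →
                   (∀ L η η′ → (η , η′) agree-on (λ v → v ≡ u ⊎ ∃ λ j′ → j ≢ j′ × touches R (into u j′) v ≡ true) → F L η ≡ F L η′) →
                   ⟨ field′ n ⟩ (λ ω → F (cut-limb R (into u j) ω) ω) ≡ ⟨ field′ n ⟩ λ ω → ⟨ field′ n ⟩ λ η → F (cut-limb R (into u j) ω) η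
      split-limb {R} R≤N u j F indep = decouple (touches R (into u j)) (λ ω η → F (cut-limb R (into u j) ω) η)
        (λ ω ω′ η agree → cong (λ L → F L η) (cut-limb-cong R (into u j) agree))
        (λ ω η η′ agree → indep _ η η′ λ
          { v (inj₁ refl) → agree v (untouched-centre R≤N u j)
          ; v (inj₂ (j′ , j≢j′ , t)) → agree v (untouched R≤N u j≢j′ v t) })

      -- The two child limbs are split off in turn, which leaves a single label at `u`. The order of
      -- integration is then changed to match that of `trees`.
      cut-limb-law : ∀ R → R ℕ.≤ N → ∀ a f → ⟨ field′ n ⟩ (λ ω → f (cut-limb R a ω)) ≡ ⟨ trees R ⟩ f
      cut-limb-law zero    _   a       f = const₁ (field′ n) (field-normalised n) (f blank)
      cut-limb-law (suc R) R<N (u , i) f = begin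
        ⟨ field′ n ⟩ (λ ω → f (node (ω u) (cut-limb R a₀ ω) (cut-limb R a₁ ω)))
          ≡⟨ split-limb R≤N u (other i false) (λ L η → f (node (η u) L (cut-limb R a₁ η)))
               (λ L η η′ agree → cong₂ (λ ℓ M → f (node ℓ L M)) (agree u (inj₁ refl))
                 (cut-limb-cong R a₁ λ v t → agree v (inj₂ (other i true , others-≢ i , t)))) ⟩
        ⟨ field′ n ⟩ (λ ω → ⟨ field′ n ⟩ (λ η → f (node (η u) (cut-limb R a₀ ω) (cut-limb R a₁ η))))
          ≡⟨ ext (field′ n) (λ ω → trans
               (split-limb R≤N u (other i true) (λ M η → f (node (η u) (cut-limb R a₀ ω) M)) (λ M η η′ agree → cong (λ ℓ → f (node ℓ _ M)) (agree u (inj₁ refl))))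
               (ext (field′ n) λ η → marginal u (λ ℓ → f (node ℓ (cut-limb R a₀ ω) (cut-limb R a₁ η))))) ⟩
        ⟨ field′ n ⟩ (λ ω → ⟨ field′ n ⟩ (λ η → ⟨ labels 0 H ⟩ (λ ℓ → f (node ℓ (cut-limb R a₀ ω) (cut-limb R a₁ η)))))
          ≡⟨ ext (field′ n) (λ ω → cut-limb-law R R≤N a₁ (λ M → ⟨ labels 0 H ⟩ (λ ℓ → f (node ℓ (cut-limb R a₀ ω) M)))) ⟩
        ⟨ field′ n ⟩ (λ ω → ⟨ trees R ⟩ (λ M → ⟨ labels 0 H ⟩ (λ ℓ → f (node ℓ (cut-limb R a₀ ω) M))))
          ≡⟨ cut-limb-law R R≤N a₀ (λ L → ⟨ trees R ⟩ (λ M → ⟨ labels 0 H ⟩ (λ ℓ → f (node ℓ L M)))) ⟩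
        ⟨ trees R ⟩ (λ L → ⟨ trees R ⟩ (λ M → ⟨ labels 0 H ⟩ (λ ℓ → f (node ℓ L M))))
          ≡⟨ ext (trees R) (λ L → labels-swap (trees R) 0 H (λ M ℓ → f (node ℓ L M))) ⟩
        ⟨ trees R ⟩ (λ L → ⟨ labels 0 H ⟩ (λ ℓ → ⟨ trees R ⟩ (λ M → f (node ℓ L M))))
          ≡⟨ labels-swap (trees R) 0 H (λ L ℓ → ⟨ trees R ⟩ (λ M → f (node ℓ L M))) ⟩
        ⟨ trees (suc R) ⟩ f ∎
        where
        open ≡-Reasoning
        a₀ = into u (other i false)
        a₁ = into u (other i true)
        R≤N : R ℕ.≤ N
        R≤N = ℕ.<⇒≤ R<N

      root-law : ∀ u (F : Label → List Tree → ℚ) →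
                 ⟨ field′ n ⟩ (λ ω → F (ω u) (cut-limb N (into u zero) ω ∷ cut-limb N (into u (suc zero)) ω ∷ cut-limb N (into u (suc (suc zero))) ω ∷ [])) ≡
                 ⟨ rootTrees N ⟩ (λ (ℓ , es) → F ℓ es)
      root-law u F = begin
        ⟨ field′ n ⟩ (λ ω → F (ω u) (c₀ ω ∷ c₁ ω ∷ c₂ ω ∷ []))
          ≡⟨ split-limb ℕ.≤-refl u zero (λ L η → F (η u) (L ∷ c₁ η ∷ c₂ η ∷ [])) (λ L η η′ agree → cong₂ (λ ℓ es → F ℓ (L ∷ es)) (agree u (inj₁ refl))
               (cong₂ (λ M M′ → M ∷ M′ ∷ []) (cut-limb-cong N (into u (suc zero)) λ v t → agree v (inj₂ (suc zero , (λ ()) , t)))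
                 (cut-limb-cong N (into u (suc (suc zero))) λ v t → agree v (inj₂ (suc (suc zero) , (λ ()) , t))))) ⟩
        ⟨ field′ n ⟩ (λ ω → ⟨ field′ n ⟩ (λ η → F (η u) (c₀ ω ∷ c₁ η ∷ c₂ η ∷ [])))
          ≡⟨ ext (field′ n) (λ ω → split-limb ℕ.≤-refl u (suc zero) (λ L η → F (η u) (c₀ ω ∷ L ∷ c₂ η ∷ [])) (λ L η η′ agree →
               cong₂ (λ ℓ M → F ℓ (c₀ ω ∷ L ∷ M ∷ [])) (agree u (inj₁ refl)) (cut-limb-cong N (into u (suc (suc zero))) λ v t → agree v (inj₂ (suc (suc zero) , (λ ()) , t))))) ⟩
        ⟨ field′ n ⟩ (λ ω → ⟨ field′ n ⟩ (λ η → ⟨ field′ n ⟩ (λ ζ → F (ζ u) (c₀ ω ∷ c₁ η ∷ c₂ ζ ∷ []))))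
          ≡⟨ ext (field′ n) (λ ω → ext (field′ n) λ η → trans
               (split-limb ℕ.≤-refl u (suc (suc zero)) (λ L ζ → F (ζ u) (c₀ ω ∷ c₁ η ∷ L ∷ [])) (λ L ζ ζ′ agree → cong (λ ℓ → F ℓ _) (agree u (inj₁ refl))))
               (ext (field′ n) λ ζ → marginal u (λ ℓ → F ℓ (c₀ ω ∷ c₁ η ∷ c₂ ζ ∷ [])))) ⟩
        ⟨ field′ n ⟩ (λ ω → ⟨ field′ n ⟩ (λ η → ⟨ field′ n ⟩ (λ ζ → ⟨ labels 0 H ⟩ (λ ℓ → F ℓ (c₀ ω ∷ c₁ η ∷ c₂ ζ ∷ [])))))
          ≡⟨ ext (field′ n) (λ ω → trans
               (ext (field′ n) λ η → cut-limb-law N ℕ.≤-refl (into u (suc (suc zero))) (λ M → ⟨ labels 0 H ⟩ (λ ℓ → F ℓ (c₀ ω ∷ c₁ η ∷ M ∷ []))))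
               (cut-limb-law N ℕ.≤-refl (into u (suc zero)) (λ L → ⟨ trees N ⟩ (λ M → ⟨ labels 0 H ⟩ (λ ℓ → F ℓ (c₀ ω ∷ L ∷ M ∷ [])))))) ⟩
        ⟨ field′ n ⟩ (λ ω → ⟨ trees N ⟩ (λ L → ⟨ trees N ⟩ (λ M → ⟨ labels 0 H ⟩ (λ ℓ → F ℓ (c₀ ω ∷ L ∷ M ∷ [])))))
          ≡⟨ cut-limb-law N ℕ.≤-refl (into u zero) (λ K → ⟨ trees N ⟩ (λ L → ⟨ trees N ⟩ (λ M → ⟨ labels 0 H ⟩ (λ ℓ → F ℓ (K ∷ L ∷ M ∷ []))))) ⟩
        ⟨ trees N ⟩ (λ K → ⟨ trees N ⟩ (λ L → ⟨ trees N ⟩ (λ M → ⟨ labels 0 H ⟩ (λ ℓ → F ℓ (K ∷ L ∷ M ∷ [])))))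
          ≡⟨ labels-swap (nest 0 (N ∷ N ∷ N ∷ [])) 0 H (λ es ℓ → F ℓ es) ⟩
        ⟨ rootTrees N ⟩ (λ (ℓ , es) → F ℓ es) ∎
        where
        open ≡-Reasoning
        c₀ = cut-limb N (into u zero)
        c₁ = cut-limb N (into u (suc zero))
        c₂ = cut-limb N (into u (suc (suc zero)))

      independent-law : Distribution (Independent G)
      independent-law = law-of (field′ n) (field-normalised n) chosen {Q = Independent G} chosen-independent

      independent-law-contains : rootReach H 0 ℕ.≤ N → ∀ v →
        Distribution.probContains independent-law v ≡ ⟨ rootTrees N ⟩ λ (ℓ , es) → isWin (Y H ℓ es)
      independent-law-contains reaches v = trans (law-of-contains (field′ n) (field-normalised n) chosen {Q = Independent G} chosen-independent v)
        (trans (ext (field′ n) λ ω → trans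
            (cong (λ b → if b then 1ℚ else 0ℚ) (trans (does-∈? v (chosen ω)) (lookup∘tabulate _ v)))
            (trans (isWinᵇ-isWin (Y H (ω v) (limbs ω v)))
              (isWin-near (Y-near H 0 (ω v) (near ω (into v zero) ∷ near ω (into v (suc zero)) ∷ near ω (into v (suc (suc zero))) ∷ [])))))
          (root-law v (λ ℓ es → isWin (Y H ℓ es))))
        where
        near : ∀ ω a → Close (rootReach H 0) (limb ω a) (cut-limb N a ω)
        near ω a = Close-≤ reaches (cut-limb-close N a ω)

-- Numerical evaluation and conclusion

open import Data.Integer.Base using (+_)

-- Rounding errors roughly double in each round, hence a precision above 500 bits. The
-- rates were found by numerical experiment: they make 10000 * win-count / one about 4353.7.
rounds one : ℕ
rounds = 500
one    = 2 ℕ.^ 600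

foldRate cutRate : ℕ → ℕ
foldRate t = one ℕ./ (4 ℕ.+ (t ∸ 180))
-- In round zero every vertex has three undecided neighbours, so nothing can happen but cuts: the
-- larger first rate seeds the process.
cutRate zero    = one ℕ./ 200
cutRate (suc t) = one ℕ./ 10000

rates-valid : ∀ t → foldRate t ℕ.+ cutRate t ℕ.≤ one
rates-valid t = ℕ.≤-trans (ℕ.+-mono-≤ (ℕ.≤-trans (/-monoʳ-≤ one (ℕ.m≤m+n 4 (t ∸ 180))) (ℕ.≤ᵇ⇒≤ (one ℕ./ 4) (one ℕ./ 2) tt)) (small t)) (ℕ.≤ᵇ⇒≤ (one ℕ./ 2 ℕ.+ one ℕ./ 2) one tt)
  where
  small : ∀ t → cutRate t ℕ.≤ one ℕ./ 2
  small zero    = ℕ.≤ᵇ⇒≤ (one ℕ./ 200) (one ℕ./ 2) tt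
  small (suc t) = ℕ.≤ᵇ⇒≤ (one ℕ./ 10000) (one ℕ./ 2) tt

open Iteration one foldRate cutRate
open Correct rates-valid rounds
open Field one foldRate cutRate rates-valid rounds
open FixedPoint one using (num; num-ratio)

opaque
  win-count : ℕ
  win-count = wins (atRoot (after rounds))

  -- A Boolean comparison of closed natural numbers, decided by evaluating all rounds of the
  -- recursion; `opaque` confines that evaluation to this place.
  enough-wins : 4352 ℕ.* one ℕ.≤ 10000 ℕ.* win-count
  enough-wins = ℕ.≤ᵇ⇒≤ (4352 ℕ.* one) (10000 ℕ.* win-count) tt

  win-count-sound : Σ ℕ λ N → ∀ R → N ℕ.≤ R → num win-count ≤ ⟨ RootSteps.rootTrees one foldRate cutRate rates-valid rounds R ⟩ λ (ℓ , es) → isWin (Y rounds ℓ es)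
  win-count-sound = win-probability

-- Deep enough for the bound on random trees and for the truncated limbs to determine the outcome at
-- the root.
depth : ℕ
depth = proj₁ win-count-sound ℕ.⊔ rootReach rounds 0

theorem1 : Σ ℕ λ g → 0 < g ×
    (∀ n (G : Graph n) → Cubic G → GirthAtLeast G g →
    Σ (Distribution (Independent G)) λ μ →
    ∀ (v : Fin n) → (+ 4352) / 10000 ≤ℚ Distribution.probContains μ v)
theorem1 = suc (depth ℕ.+ depth) , s≤s z≤n , λ n G cubic girth →
  independent-law G cubic girth depth ℕ.≤-refl , λ v → ≤-trans (num-ratio {4352} {10000} enough-wins)
    (≤-trans (proj₂ win-count-sound depth (ℕ.m≤m⊔n _ _))
      (≤-reflexive (sym (independent-law-contains G cubic girth depth ℕ.≤-refl (ℕ.m≤n⊔m (proj₁ win-count-sound) _) v))))
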